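{- Every $3$-connected bipartite cubic graph $H$ satisfies \[\rho(H)\ \geqslant\ \beta'(H)+3b'(H)-3\ \geqslant\ 3n(H)-9.\] Moreover, (i) the first inequality holds with equality if and only if $H\in\mathcal{J}\cup\mathcal{K}$, and (ii) both hold with equality if and only if $H\in\mathcal{K}$.
   Context: Graphs are loopless but may have parallel edges; $n(H)$ is the number of vertices. For a connected bipartite cubic graph $H[A,B]$ and $a\in A$, $b\in B$, an $(a,b)$-matching is a spanning subgraph in which $a,b$ have degree $3$ and all other vertices degree $1$; the pair $(a,b)$ is $\lambda$-matchable if one exists; $\rho(H)$ is the number of $\lambda$-matchable pairs $(a,b)$ with $a\in A$, $b\in B$; for a vertex $u$, $\rho_H(u)$ is the number of vertices $w$ such that the pair formed by $u$ and $w$ is $\lambda$-matchable. A cut $C$ of a matching covered graph is tight if $|C\cap M|=1$ for all perfect matchings $M$; repeated contraction along nontrivial tight cuts yields graphs free of nontrivial tight cuts, called braces if bipartite (bricks otherwise); this list is unique. $b'(H)$ is the number of braces of order at least $6$, and $\beta'(H)=\sum (n(J)/2)^2$ over braces $J$ of order at least $6$. $\Theta$ is the graph with two vertices and three parallel edges; $\mathbb{C}_4$ is the $4$-cycle with every other edge doubled. $\mathcal{J}$ is the family of cubic braces distinct from $\Theta$ and $\mathbb{C}_4$ (equivalently, simple cubic braces). Splicing of $G_1$ at $u$ with $G_2$ at $v$ (equal degree, bijection $\pi:\partial(u)\to\partial(v)$): from $(G_1-u)\cup(G_2-v)$ add, for each $e\in\partial(u)$, an edge joining the end of $e$ other than $u$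 to the end of $\pi(e)$ other than $v$. The family $\mathcal{K}$: $K_{3,3}\in\mathcal{K}$, and if $H\in\mathcal{K}$ and $v\in V(H)$ satisfies $\rho_H(v)=3$, then any graph obtained by splicing $H$ at $v$ with $K_{3,3}$ (at any vertex, any bijection) belongs to $\mathcal{K}$. -}

module Defs where

open import Data.Bool using (_∧_; _xor_)
open import Data.Fin using (Fin; zero; suc; #_; _↑ˡ_; _↑ʳ_; remQuot)
open import Data.Fin.Properties using (_≟_; all?; +↔⊎)
open import Data.Fin.Subset using (Subset; inside; outside; ⁅_⁆; ∁; _∩_; ∣_∣; _∈_; _∉_) renaming (⊥ to ∅)
open import Data.Fin.Subset.Properties using (_∈?_; anySubset?; x∈∁p⇒x∉p; x∉p⇒x∈∁p; ∣∁p∣≡n∸∣p∣; ∣p∣≤n)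
open import Data.List using (List; [_]; _++_; length; filter; map; allFin; cartesianProduct)
open import Data.Nat using (ℕ; _+_; _∸_; _^_; _/_; _≤_; _<_; _≤?_)
open import Data.Nat.ListAction using (sum)
open import Data.Nat.Induction using (<-wellFounded)
open import Data.Product using (∃; ∃₂; _×_; _,_; proj₁; proj₂)
open import Data.Sum using (_⊎_; inj₁; inj₂)
open import Data.Sum.Function.Propositional using (_⊎-↔_)
open import Data.Unit using (⊤; tt)
open import Data.Vec using ([]; _∷_; here; there; lookup; tabulate)
open import Data.Vec.Properties using (lookup∘tabulate; lookup⇒[]=; []=⇒lookup)
open import Function using (_⇔_; _↔_; mk⇔; mk↔ₛ′; Inverse)
open import Function.Properties.Inverse using (↔-sym; ↔-trans)
open import Induction.WellFounded using (Acc; acc)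
open import Relation.Binary.Construct.Closure.ReflexiveTransitive using (Star)
open import Relation.Binary.PropositionalEquality using (_≡_; _≢_; refl; sym; trans; cong; cong₂)
open import Relation.Nullary using (¬_; Dec; yes; no; contradiction)
open import Relation.Nullary.Decidable using (_×-dec_; _⊎-dec_; ¬?; decidable-stable; _→-dec_; True; toWitness)

import Data.Nat.Properties as ℕₚ

-- Edges are labelled, so parallel edges are distinct.  The order of the two
-- components of `ends e` carries no meaning.
record Graph : Set where
  field
    order size : ℕ
    ends       : Fin size → Fin order × Fin order
    loopless   : ∀ e → proj₁ (ends e) ≢ proj₂ (ends e)

  Vertex Edge : Set
  Vertex = Fin order
  Edge   = Fin size

  Joins : Edge → Vertex → Vertex → Set
  Joins e x y = ends e ≡ (x , y) ⊎ ends e ≡ (y , x)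

  ∂ : Subset order → Subset size
  ∂ X = tabulate λ e → lookup X (proj₁ (ends e)) xor lookup X (proj₂ (ends e))

  -- F is the edge set of a spanning subgraph.  Each edge at v counts once, as
  -- there are no loops.
  degree : Subset size → Vertex → ℕ
  degree F v = ∣ F ∩ ∂ ⁅ v ⁆ ∣

open Graph public using (order; size; Vertex; Edge)

module _ (G : Graph) where
  open Graph G using (Joins; ∂; degree)

  Cubic : Set
  Cubic = ∀ v → ∣ ∂ ⁅ v ⁆ ∣ ≡ 3

  -- The two sides of the bipartition are A and its complement.
  IsBipartition : Subset (order G) → Set
  IsBipartition A = ∀ e → e ∈ ∂ A

  Bipartite : Set
  Bipartite = ∃ IsBipartition

  bipartite? : Dec Bipartite
  bipartite? = anySubset? λ A → all? λ e → e ∈? ∂ A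

  ConnectedWithout : Subset (order G) → Set
  ConnectedWithout S = ∀ {u v} → u ∉ S → v ∉ S → Star Step u v
    where
    Step : Vertex G → Vertex G → Set
    Step x y = x ∉ S × y ∉ S × ∃ λ e → Joins e x y

  Connected : Set
  Connected = ConnectedWithout ∅

  -- There is no condition order > 3, so Θ is 3-connected, as it is when
  -- 3-connectedness is defined by three internally disjoint paths between any
  -- two vertices.  Among cubic graphs Θ is the only one affected.
  ThreeConnected : Set
  ThreeConnected = 2 ≤ order G × (∀ S → ∣ S ∣ < 3 → ConnectedWithout S)

  IsPerfectMatching : Subset (size G) → Set
  IsPerfectMatching M = ∀ v → degree M v ≡ 1

  perfectMatching? : ∀ M → Dec (IsPerfectMatching M)
  perfectMatching? M = all? λ v → degree M v ℕₚ.≟ 1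

  MatchingCovered : Set
  MatchingCovered =
    2 ≤ order G × Connected × (∀ e → ∃ λ M → IsPerfectMatching M × e ∈ M)

  IsλMatching : Vertex G → Vertex G → Subset (size G) → Set
  IsλMatching a b M =
    degree M a ≡ 3 × degree M b ≡ 3 × (∀ v → ¬ (v ≡ a ⊎ v ≡ b) → degree M v ≡ 1)

  λMatching? : ∀ a b M → Dec (IsλMatching a b M)
  λMatching? a b M =
    degree M a ℕₚ.≟ 3 ×-dec degree M b ℕₚ.≟ 3 ×-dec
    all? (λ v → ¬? (v ≟ a ⊎-dec v ≟ b) →-dec degree M v ℕₚ.≟ 1)

  module _ (A : Subset (order G)) where

    λMatchable : Vertex G × Vertex G → Set
    λMatchable (a , b) = a ∈ A × b ∉ A × ∃ (IsλMatching a b)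

    λMatchable? : ∀ p → Dec (λMatchable p)
    λMatchable? (a , b) =
      a ∈? A ×-dec ¬? (b ∈? A) ×-dec anySubset? (λMatching? a b)

    ρ : ℕ
    ρ = length (filter λMatchable? (cartesianProduct (allFin (order G)) (allFin (order G))))

    -- u may lie on either side of the bipartition.
    ρAt : Vertex G → ℕ
    ρAt u = length (filter (λ w → λMatchable? (u , w) ⊎-dec λMatchable? (w , u))
                           (allFin (order G)))

  Tight : Subset (order G) → Set
  Tight X = ∀ M → IsPerfectMatching M → ∣ ∂ X ∩ M ∣ ≡ 1

  NontrivialTight : Subset (order G) → Set
  NontrivialTight X = 2 ≤ ∣ X ∣ × 2 ≤ ∣ ∁ X ∣ × Tight X

  TightCutFree : Set
  TightCutFree = ∀ X → ¬ NontrivialTight X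

  IsBrace : Set
  IsBrace = MatchingCovered × Bipartite × TightCutFree

-- Graphs on arbitrary vertex and edge types: contraction and splicing are
-- first built on sums of subtypes, and then transported along isomorphism to
-- graphs on Fin.
record AbstractGraph : Set₁ where
  field
    V E   : Set
    Joins : E → V → V → Set

⌊_⌋ : Graph → AbstractGraph
⌊ G ⌋ = record { V = Vertex G ; E = Edge G ; Joins = Graph.Joins G }

infix 4 _≅_
record _≅_ (G H : AbstractGraph) : Set where
  private
    module G = AbstractGraph G
    module H = AbstractGraph H
  field
    vertices : G.V ↔ H.V
    edges    : G.E ↔ H.E
    joins    : ∀ e x y → G.Joins e x y ⇔
                 H.Joins (Inverse.to edges e) (Inverse.to vertices x) (Inverse.to vertices y)

Members : ∀ {n} → Subset n → Set
Members p = ∃ (_∈ p)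

module _ (G : Graph) (X : Subset (order G)) where
  open Graph G using (Joins; ends)

  edgesInside : Subset (size G)
  edgesInside = tabulate λ e → lookup X (proj₁ (ends e)) ∧ lookup X (proj₂ (ends e))

  -- inj₂ tt is the vertex to which X is shrunk.
  data _↦_ : Vertex G → Members (∁ X) ⊎ ⊤ → Set where
    keep   : ∀ {v} (v∉X : v ∈ ∁ X) → v ↦ inj₁ (v , v∉X)
    shrink : ∀ {v} → v ∈ X → v ↦ inj₂ tt

  contraction : AbstractGraph
  contraction = record
    { V     = Members (∁ X) ⊎ ⊤
    ; E     = Members (∁ edgesInside)
    ; Joins = λ (e , _) x y → ∃₂ λ a b → Joins e a b × a ↦ x × b ↦ y
    }

-- `TightCutDecomposition G Js`: some tight cut decomposition procedure applied
-- to G ends with the list Js.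
data TightCutDecomposition : Graph → List Graph → Set where
  indecomposable : ∀ {G} → TightCutFree G → TightCutDecomposition G [ G ]
  contract : ∀ {G G₁ G₂ Js₁ Js₂} X → NontrivialTight G X →
             ⌊ G₁ ⌋ ≅ contraction G X → ⌊ G₂ ⌋ ≅ contraction G (∁ X) →
             TightCutDecomposition G₁ Js₁ → TightCutDecomposition G₂ Js₂ →
             TightCutDecomposition G (Js₁ ++ Js₂)

-- The bipartite members of a tight cut decomposition are its braces.
bracesOfOrder≥6 : List Graph → List Graph
bracesOfOrder≥6 = filter λ J → bipartite? J ×-dec 6 ≤? order J

b′ : List Graph → ℕ
b′ Js = length (bracesOfOrder≥6 Js)

-- Braces have even order, so the division is exact.
β′ : List Graph → ℕ
β′ Js = sum (map (λ J → (order J / 2) ^ 2) (bracesOfOrder≥6 Js))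

fromEnds : ∀ {n m} (f : Fin m → Fin n × Fin n)
           {_ : True (all? λ e → ¬? (proj₁ (f e) ≟ proj₂ (f e)))} → Graph
fromEnds f {t} = record { ends = f ; loopless = toWitness t }

Θ : Graph
Θ = fromEnds {2} {3} λ _ → # 0 , # 1

ℂ₄ : Graph
ℂ₄ = fromEnds {4} {6} (lookup ((# 0 , # 1) ∷ (# 0 , # 1) ∷ (# 1 , # 2) ∷
                               (# 2 , # 3) ∷ (# 2 , # 3) ∷ (# 3 , # 0) ∷ []))

𝒥 : Graph → Set
𝒥 G = Cubic G × IsBrace G × ¬ ⌊ G ⌋ ≅ ⌊ Θ ⌋ × ¬ ⌊ G ⌋ ≅ ⌊ ℂ₄ ⌋

K₃,₃ : Graph
K₃,₃ = fromEnds {6} {9} λ e → let (i , j) = remQuot {3} 3 e in i ↑ˡ 3 , 3 ↑ʳ j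

module _ (G₁ G₂ : Graph) (u : Vertex G₁) (v : Vertex G₂) where
  private
    module G₁ = Graph G₁
    module G₂ = Graph G₂

  StarBijection : Set
  StarBijection = Members (G₁.∂ ⁅ u ⁆) ↔ Members (G₂.∂ ⁅ v ⁆)

  module _ (π : StarBijection) where

    SpliceVertex SpliceEdge : Set
    SpliceVertex = Members (∁ ⁅ u ⁆) ⊎ Members (∁ ⁅ v ⁆)
    SpliceEdge   = Members (∁ (G₁.∂ ⁅ u ⁆)) ⊎ Members (∁ (G₂.∂ ⁅ v ⁆)) ⊎ Members (G₁.∂ ⁅ u ⁆)

    data SpliceJoins : SpliceEdge → SpliceVertex → SpliceVertex → Set where
      left  : ∀ {e x y} → G₁.Joins (proj₁ e) (proj₁ x) (proj₁ y) →
              SpliceJoins (inj₁ e) (inj₁ x) (inj₁ y)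
      right : ∀ {e x y} → G₂.Joins (proj₁ e) (proj₁ x) (proj₁ y) →
              SpliceJoins (inj₂ (inj₁ e)) (inj₂ x) (inj₂ y)
      link  : ∀ {e x y} → G₁.Joins (proj₁ e) u (proj₁ x) →
              G₂.Joins (proj₁ (Inverse.to π e)) v (proj₁ y) →
              SpliceJoins (inj₂ (inj₂ e)) (inj₁ x) (inj₂ y)
      link′ : ∀ {e x y} → G₁.Joins (proj₁ e) u (proj₁ x) →
              G₂.Joins (proj₁ (Inverse.to π e)) v (proj₁ y) →
              SpliceJoins (inj₂ (inj₂ e)) (inj₂ y) (inj₁ x)

    splicing : AbstractGraph
    splicing = record { V = SpliceVertex ; E = SpliceEdge ; Joins = SpliceJoins }

data 𝒦 : Graph → Set where
  base   : ∀ {G} → ⌊ G ⌋ ≅ ⌊ K₃,₃ ⌋ → 𝒦 G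
  splice : ∀ {H G} A v w (π : StarBijection H K₃,₃ v w) →
           𝒦 H → IsBipartition H A → ρAt H A v ≡ 3 →
           ⌊ G ⌋ ≅ splicing H K₃,₃ v w π → 𝒦 G

∈-unique : ∀ {n} {x : Fin n} {p : Subset n} (i j : x ∈ p) → i ≡ j
∈-unique here      here      = refl
∈-unique (there i) (there j) = cong there (∈-unique i j)

members : ∀ {n} (p : Subset n) → Members p ↔ Fin ∣ p ∣
members p = mk↔ₛ′ (to p) (from p) (to∘from p) (from∘to p)
  where
  to : ∀ {n} (p : Subset n) → Members p → Fin ∣ p ∣
  to (inside  ∷ p) (zero  , here)    = zero
  to (inside  ∷ p) (suc x , there i) = suc (to p (x , i))
  to (outside ∷ p) (suc x , there i) = to p (x , i)

  next : ∀ {n b} {p : Subset n} → Members p → Members (b ∷ p)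
  next (x , i) = suc x , there i

  from : ∀ {n} (p : Subset n) → Fin ∣ p ∣ → Members p
  from (inside  ∷ p) zero    = zero , here
  from (inside  ∷ p) (suc k) = next (from p k)
  from (outside ∷ p) k       = next (from p k)

  to∘from : ∀ {n} (p : Subset n) k → to p (from p k) ≡ k
  to∘from (inside  ∷ p) zero    = refl
  to∘from (inside  ∷ p) (suc k) = cong suc (to∘from p k)
  to∘from (outside ∷ p) k       = to∘from p k

  from∘to : ∀ {n} (p : Subset n) x → from p (to p x) ≡ x
  from∘to (inside  ∷ p) (zero  , here)    = refl
  from∘to (inside  ∷ p) (suc x , there i) = cong next (from∘to p (x , i))
  from∘to (outside ∷ p) (suc x , there i) = cong next (from∘to p (x , i))

module Contract (G : Graph) (X : Subset (order G)) where
  open Graph G using (ends; loopless)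
  private module C = AbstractGraph (contraction G X)

  vs : C.V ↔ Fin (∣ ∁ X ∣ + 1)
  vs = ↔-trans (members (∁ X) ⊎-↔ unit) (↔-sym +↔⊎)
    where
    unit : ⊤ ↔ Fin 1
    unit = mk↔ₛ′ (λ _ → zero) (λ _ → tt) (λ { zero → refl ; (suc ()) }) (λ _ → refl)

  es : C.E ↔ Fin ∣ ∁ (edgesInside G X) ∣
  es = members _

  module vs = Inverse vs
  module es = Inverse es

  vs-injective : ∀ {x y} → vs.to x ≡ vs.to y → x ≡ y
  vs-injective eq =
    trans (sym (vs.strictlyInverseʳ _)) (trans (cong vs.from eq) (vs.strictlyInverseʳ _))

  shrunk : Vertex G → C.V
  shrunk v with v ∈? X
  ... | yes _  = inj₂ tt
  ... | no v∉X = inj₁ (v , x∉p⇒x∈∁p v∉X)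

  ↦-shrunk : ∀ v → _↦_ G X v (shrunk v)
  ↦-shrunk v with v ∈? X
  ... | yes v∈X = shrink v∈X
  ... | no v∉X  = keep (x∉p⇒x∈∁p v∉X)

  ↦-functional : ∀ {v x y} → _↦_ G X v x → _↦_ G X v y → x ≡ y
  ↦-functional (keep i)   (keep j)   = cong (λ k → inj₁ (_ , k)) (∈-unique i j)
  ↦-functional (keep i)   (shrink j) = contradiction j (x∈∁p⇒x∉p i)
  ↦-functional (shrink i) (keep j)   = contradiction i (x∈∁p⇒x∉p j)
  ↦-functional (shrink _) (shrink _) = refl

  ↦⇒≡ : ∀ {v x} → _↦_ G X v x → shrunk v ≡ x
  ↦⇒≡ = ↦-functional (↦-shrunk _)

  ≡⇒↦ : ∀ {v x} → shrunk v ≡ x → _↦_ G X v x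
  ≡⇒↦ refl = ↦-shrunk _

  shrunk-injective : ∀ {v w} → shrunk v ≡ shrunk w → v ≡ w ⊎ (v ∈ X × w ∈ X)
  shrunk-injective {v} {w} eq with v ∈? X | w ∈? X
  ... | yes i | yes j = inj₂ (i , j)
  shrunk-injective refl | no _ | no _ = inj₁ refl

  src tgt : Edge G → Vertex G
  src e = proj₁ (ends e)
  tgt e = proj₂ (ends e)

  inside-edge : ∀ {e} → src e ∈ X → tgt e ∈ X → e ∈ edgesInside G X
  inside-edge {e} i j = lookup⇒[]= e _
    (trans (lookup∘tabulate _ e) (cong₂ _∧_ ([]=⇒lookup i) ([]=⇒lookup j)))

  ends′ : Fin ∣ ∁ (edgesInside G X) ∣ → Fin (∣ ∁ X ∣ + 1) × Fin (∣ ∁ X ∣ + 1)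
  ends′ e = let (e₀ , _) = es.from e in vs.to (shrunk (src e₀)) , vs.to (shrunk (tgt e₀))

  graph : Graph
  graph = record { ends = ends′ ; loopless = loopless′ }
    where
    loopless′ : ∀ e → proj₁ (ends′ e) ≢ proj₂ (ends′ e)
    loopless′ e eq with shrunk-injective (vs-injective eq)
    ... | inj₁ s≡t     = loopless (proj₁ (es.from e)) s≡t
    ... | inj₂ (i , j) = x∈∁p⇒x∉p (proj₂ (es.from e)) (inside-edge i j)

  iso : ⌊ graph ⌋ ≅ contraction G X
  iso = record
    { vertices = ↔-sym vs
    ; edges    = ↔-sym es
    ; joins    = λ e x y → mk⇔ (fwd e x y) (bwd e x y)
    }
    where
    down : ∀ {v x} → vs.to (shrunk v) ≡ x → _↦_ G X v (vs.from x)
    down {v} refl = ≡⇒↦ (sym (vs.strictlyInverseʳ (shrunk v)))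

    up : ∀ {v x} → _↦_ G X v (vs.from x) → vs.to (shrunk v) ≡ x
    up {x = x} r = trans (cong vs.to (↦⇒≡ r)) (vs.strictlyInverseˡ x)

    fwd : ∀ e x y → Graph.Joins graph e x y → C.Joins (es.from e) (vs.from x) (vs.from y)
    fwd e x y (inj₁ eq) = _ , _ , inj₁ refl , down (cong proj₁ eq) , down (cong proj₂ eq)
    fwd e x y (inj₂ eq) = _ , _ , inj₂ refl , down (cong proj₂ eq) , down (cong proj₁ eq)

    bwd : ∀ e x y → C.Joins (es.from e) (vs.from x) (vs.from y) → Graph.Joins graph e x y
    bwd e x y (_ , _ , inj₁ eq , r , s) rewrite eq = inj₁ (cong₂ _,_ (up r) (up s))
    bwd e x y (_ , _ , inj₂ eq , r , s) rewrite eq = inj₂ (cong₂ _,_ (up s) (up r))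

  smaller : 2 ≤ ∣ X ∣ → order graph < order G
  smaller 2≤X rewrite ∣∁p∣≡n∸∣p∣ X = begin-strict
    (order G ∸ ∣ X ∣) + 1       <⟨ ℕₚ.+-monoʳ-< (order G ∸ ∣ X ∣) 2≤X ⟩
    (order G ∸ ∣ X ∣) + ∣ X ∣   ≡⟨ ℕₚ.m∸n+n≡m (∣p∣≤n X) ⟩
    order G                     ∎
    where open ℕₚ.≤-Reasoning

tight? : ∀ G X → Dec (Tight G X)
tight? G X with anySubset? (λ M → perfectMatching? G M ×-dec ¬? (∣ Graph.∂ G X ∩ M ∣ ℕₚ.≟ 1))
... | yes (M , pm , ≢1) = no λ tight → ≢1 (tight M pm)
... | no none = yes λ M pm → decidable-stable (_ ℕₚ.≟ 1) λ ≢1 → none (M , pm , ≢1)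

-- A statement about all tight cut decompositions of G is never vacuous.
tightCutDecomposition : ∀ G → ∃ (TightCutDecomposition G)
tightCutDecomposition G = go G (<-wellFounded (order G))
  where
  go : ∀ G → Acc _<_ (order G) → ∃ (TightCutDecomposition G)
  go G (acc rec)
    with anySubset? (λ X → 2 ≤? ∣ X ∣ ×-dec 2 ≤? ∣ ∁ X ∣ ×-dec tight? G X)
  ... | no none = _ , indecomposable λ X nt → none (X , nt)
  ... | yes (X , nt@(2≤X , 2≤∁X , _)) =
    _ , contract X nt C₁.iso C₂.iso (proj₂ (go C₁.graph (rec (C₁.smaller 2≤X))))
                                    (proj₂ (go C₂.graph (rec (C₂.smaller 2≤∁X))))
    where
    module C₁ = Contract G X
    module C₂ = Contract G (∁ X)

{-# OPTIONS --safe #-}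
-- Orient the edges of a cubic bipartite graph from A to its complement B.  The
-- numbers of edges that leave and that enter a vertex set S differ by
-- 3 (|S ∩ A| - |S ∩ B|), and the supply–demand theorem shows that, in a
-- 3-edge-connected graph, a ∈ A and b ∈ B fail to form a λ-matchable pair only
-- if some S with a ∈ S and b ∉ S is entered by three edges and left by none.
-- Cuts of three edges are exactly the tight cuts.  So all pairs of a brace are
-- matchable, adjacent pairs always are, and if G₁ and G₂ are the contractions
-- along a nontrivial tight cut, and p, q ≥ 3 are the values of ρ at the two
-- contracted vertices, then
--   ρ(G) = (ρ(G₁) - p) + (ρ(G₂) - q) + p q ≥ ρ(G₁) + ρ(G₂) + 3.
-- Both inequalities follow by induction along the decomposition; equality in
-- the first one for a graph that is not a brace forces p = q = 3 throughout
-- and hence ρ(G) = 3 n(G) - 9.  Conversely, if ρ(G) = 3 n(G) - 9 then a tight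
-- cut with a minimal shore splits off a brace J with (n(J)/2)² = 3 n(J) - 9,
-- that is J = K₃,₃, and so G ∈ 𝒦.  Since this cut is chosen independently of
-- the given decomposition, uniqueness of the decomposition is not needed.
module Submission where

open import Defs
open import Data.Bool using (Bool; _xor_; _∧_; _∨_; false; if_then_else_; not; true)
open import Data.Bool.Properties using (not-involutive; xor-comm; ∧-comm; ∧-identityʳ; ∧-zeroʳ; ∨-identityʳ; ∨-zeroʳ)
open import Data.Empty using (⊥; ⊥-elim)
open import Data.Fin using (Fin; _↑ʳ_; _↑ˡ_; combine; remQuot; splitAt; suc; zero)
open import Data.Fin.Permutation using (↔⇒≡)
open import Data.Fin.Properties using (+↔⊎; _≟_; all?; any?; combine-injective; combine-remQuot; remQuot-combine; splitAt⁻¹-↑ʳ; splitAt⁻¹-↑ˡ)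
open import Data.Fin.Subset using (Subset; _∈_; _∉_; _∩_; _∪_; ⁅_⁆; ∁; ∣_∣)
open import Data.Fin.Subset.Properties using (anySubset?; x∈⁅x⁆; x∈⁅y⁆⇒x≡y; x∈∁p⇒x∉p; x∉p⇒x∈∁p; ∉⊥; ∣⊥∣≡0)
open import Data.List as List using (List; []; [_]; _++_; _∷_; cartesianProduct; filter; length; map)
open import Data.List.Properties using (filter-++; filter-accept; filter-reject; length-++; map-++; map-tabulate)
open import Data.Maybe using (Maybe; just; nothing)
open import Data.Maybe.Properties using (just-injective)
open import Data.Nat using (_%_; _/_; _<_; _^_; _≤?_; _≤_; suc; s≤s; zero; z≤n; ℕ)
open import Data.Nat.DivMod using ([m+kn]%n≡m%n; m*n/n≡m)
open import Data.Nat.ListAction.Properties using (sum-++)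
open import Data.Nat.Properties using (+-*-semiring)
open import Data.Nat.Tactic.RingSolver using (solve-∀)
open import Data.Product using (_,_; _×_; proj₁; proj₂; ∃; ∃₂)
open import Data.Sum using ([_,_]′; _⊎_; inj₁; inj₂)
open import Data.Sum.Function.Propositional using (_⊎-↔_)
open import Data.Unit using (tt)
open import Data.Vec using ([]; _∷_; lookup; tabulate)
open import Data.Vec.Properties using ([]=⇒lookup; lookup-map; lookup-zipWith; lookup⇒[]=; lookup∘tabulate; tabulate-cong; tabulate∘lookup)
open import Function using (Equivalence; Inverse; _↔_; _⇔_; _∘_; mk↔ₛ′; mk⇔)
open import Function.Construct.Identity using (↔-id)
open import Function.Properties.Inverse using (↔-sym; ↔-trans)
open import Relation.Binary.Construct.Closure.ReflexiveTransitive using (Star; _◅_; ε)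
open import Relation.Binary.PropositionalEquality using (_≡_; _≢_; cong; cong₂; module ≡-Reasoning; refl; subst; subst₂; sym; trans)
open import Relation.Nullary using (Dec; contradiction; does; no; yes; ¬_)
open import Relation.Nullary.Decidable using (_×-dec_; _⊎-dec_; dec-false; dec-true; decidable-stable; toWitness; ¬?)

import Algebra.Properties.Semiring.Sum +-*-semiring as Sum
import Data.Integer as ℤ
import Data.Integer.Properties as ℤₚ
import Data.Integer.Tactic.RingSolver as ℤ-Solver
import Data.Nat as ℕ
import Data.Nat.ListAction as ListAction
import Data.Nat.Properties as ℕₚ

-- Connectivity by vertices is awkward to keep under contraction, so the induction carries
-- `EdgeConnected` instead: every cut of a contraction is a cut of `G` with the same edges. In a
-- cubic bipartite graph it follows from 3-connectedness, because the numbers of cut edges in the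
-- two directions agree modulo 3.
--
-- The product `p q` has this origin. Let `a` lie in the shore with more vertices in A and `b` in
-- the other. A λ-matching for them must use all three cut edges, so it splits into λ-matchings of
-- both contractions in which the contracted vertex is one of the two special vertices; conversely,
-- any two of those agree on the cut and can be glued. If `a` and `b` lie in the same shore, one cut
-- edge is used, and the other shore contributes a perfect matching through that edge. The fourth
-- position of `a` and `b` is excluded by counting.
--
-- Everything is proved in ℕ with the negative terms moved across, hence the forms `ρ + 3`, `m + 6`
-- and `ρ + 9`; the passage to ℤ comes at the end.

module CubicBipartiteGraphs where
  open import Data.Nat using (_+_; _*_)

  -- Linear arithmetic: a conclusion is read off an identity between the
  -- hypotheses, added up side by side, and the goal with its slack d.
  infixr 5 _⊕_
  _⊕_ : ∀ {a b c d} → a ≤ b → c ≤ d → a + c ≤ b + d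
  _⊕_ = ℕₚ.+-mono-≤

  by-≤ : ∀ {l r x y} d → l ≤ r → x + r + d ≡ y + l → x ≤ y
  by-≤ {l} {r} {x} {y} d l≤r eq = ℕₚ.+-cancelʳ-≤ r x y (begin
    x + r     ≤⟨ ℕₚ.m≤m+n (x + r) d ⟩
    x + r + d ≡⟨ eq ⟩
    y + l     ≤⟨ ℕₚ.+-monoʳ-≤ y l≤r ⟩
    y + r     ∎)
    where open ℕₚ.≤-Reasoning

  by-⊥ : ∀ {l r} d → l ≤ r → l ≡ suc (d + r) → ⊥
  by-⊥ {l} {r} d l≤r refl = ℕₚ.<-irrefl refl (ℕₚ.≤-trans (s≤s (ℕₚ.m≤n+m r d)) l≤r)

  by-≡ : ∀ {l r x y} → l ≡ r → x + r ≡ y + l → x ≡ y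
  by-≡ {l} {r} {x} {y} refl eq = ℕₚ.+-cancelʳ-≡ l x y eq

  -- Indicators of Booleans, and subsets as Boolean functions

  𝟙 : Bool → ℕ
  𝟙 true  = 1
  𝟙 false = 0

  𝟙≤1 : ∀ b → 𝟙 b ≤ 1
  𝟙≤1 true  = s≤s z≤n
  𝟙≤1 false = z≤n

  1≤𝟙 : ∀ {b} → 1 ≤ 𝟙 b → b ≡ true
  1≤𝟙 {true} _ = refl

  true≢false : ∀ {b} → b ≡ true → b ≡ false → ⊥
  true≢false refl ()

  ≡false : ∀ {b} → b ≢ true → b ≡ false
  ≡false {false} _ = refl
  ≡false {true} ≢ = contradiction refl ≢

  ∧-true : ∀ {a b} → a ∧ b ≡ true → a ≡ true × b ≡ true
  ∧-true {true} {true} _ = refl , refl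

  not-true : ∀ {b} → not b ≡ true → b ≡ false
  not-true {false} _ = refl

  not-self : ∀ {b} → b ≡ not b → ⊥
  not-self {true}  ()
  not-self {false} ()

  not-xor : ∀ a b → not a xor not b ≡ a xor b
  not-xor true  true  = refl
  not-xor true  false = refl
  not-xor false true  = refl
  not-xor false false = refl

  𝟙-∧ : ∀ a b → 𝟙 (a ∧ b) ≡ 𝟙 a * 𝟙 b
  𝟙-∧ true  b = sym (ℕₚ.+-identityʳ _)
  𝟙-∧ false b = refl

  𝟙-not : ∀ b → 𝟙 b + 𝟙 (not b) ≡ 1
  𝟙-not true  = refl
  𝟙-not false = refl

  𝟙-split : ∀ b n → n ≡ 𝟙 b * n + 𝟙 (not b) * n
  𝟙-split true  = solve-∀
  𝟙-split false = solve-∀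

  infix 7 _==_
  _==_ : ∀ {n} → Fin n → Fin n → Bool
  x == y = does (x ≟ y)

  ==-refl : ∀ {n} (x : Fin n) → x == x ≡ true
  ==-refl x = dec-true (x ≟ x) refl

  ≢⇒== : ∀ {n} {x y : Fin n} → x ≢ y → x == y ≡ false
  ≢⇒== {x = x} {y} = dec-false (x ≟ y)

  ==⇒≡ : ∀ {n} {x y : Fin n} → x == y ≡ true → x ≡ y
  ==⇒≡ {x = x} {y} eq with x ≟ y
  ... | yes p = p

  ∈⇒lookup : ∀ {n} {x : Fin n} {p : Subset n} → x ∈ p → lookup p x ≡ true
  ∈⇒lookup = []=⇒lookup

  lookup⇒∈ : ∀ {n} {x : Fin n} {p : Subset n} → lookup p x ≡ true → x ∈ p
  lookup⇒∈ {x = x} {p} = lookup⇒[]= x p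

  ∉⇒lookup : ∀ {n} {x : Fin n} {p : Subset n} → x ∉ p → lookup p x ≡ false
  ∉⇒lookup x∉p = ≡false (x∉p ∘ lookup⇒∈)

  lookup⇒∉ : ∀ {n} {x : Fin n} {p : Subset n} → lookup p x ≡ false → x ∉ p
  lookup⇒∉ eq x∈p = true≢false (∈⇒lookup x∈p) eq

  lookup-⁅⁆ : ∀ {n} (x y : Fin n) → lookup ⁅ x ⁆ y ≡ y == x
  lookup-⁅⁆ x y with y ≟ x
  ... | yes refl = ∈⇒lookup (x∈⁅x⁆ x)
  ... | no y≢x   = ∉⇒lookup (λ y∈ → y≢x (x∈⁅y⁆⇒x≡y x y∈))

  lookup-∁ : ∀ {n} (p : Subset n) x → lookup (∁ p) x ≡ not (lookup p x)
  lookup-∁ p x = lookup-map x not p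

  lookup-∩ : ∀ {n} (p q : Subset n) x → lookup (p ∩ q) x ≡ lookup p x ∧ lookup q x
  lookup-∩ p q x = lookup-zipWith _∧_ x p q

  lookup-∪ : ∀ {n} (p q : Subset n) x → lookup (p ∪ q) x ≡ lookup p x ∨ lookup q x
  lookup-∪ p q x = lookup-zipWith _∨_ x p q

  -- Finite sums

  -- Opaque, so that sum f = sum g is solved by unifying f with g.
  opaque
    sum : ∀ {n} → (Fin n → ℕ) → ℕ
    sum f = Sum.sum f

    sum-zero : (f : Fin 0 → ℕ) → sum f ≡ 0
    sum-zero f = refl

    sum-suc : ∀ {n} (f : Fin (suc n) → ℕ) → sum f ≡ f zero + sum (f ∘ suc)
    sum-suc f = refl

    sum-cong : ∀ {n} {f g : Fin n → ℕ} → (∀ i → f i ≡ g i) → sum f ≡ sum g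
    sum-cong = Sum.sum-cong-≗

    sum-+ : ∀ {n} (f g : Fin n → ℕ) → sum (λ i → f i + g i) ≡ sum f + sum g
    sum-+ = Sum.∑-distrib-+

    sum-swap : ∀ {m n} (f : Fin m → Fin n → ℕ) →
               sum (λ i → sum (λ j → f i j)) ≡ sum (λ j → sum (λ i → f i j))
    sum-swap = Sum.∑-comm

    sum-↔ : ∀ {m n} (π : Fin m ↔ Fin n) (f : Fin n → ℕ) → sum f ≡ sum (f ∘ Inverse.to π)
    sum-↔ π f = Sum.sum-permute f π

    *-sumˡ : ∀ {n} c (f : Fin n → ℕ) → c * sum f ≡ sum (λ i → c * f i)
    *-sumˡ = Sum.*-distribˡ-sum

    *-sumʳ : ∀ {n} c (f : Fin n → ℕ) → sum f * c ≡ sum (λ i → f i * c)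
    *-sumʳ = Sum.*-distribʳ-sum

  ∣∣-sum : ∀ {n} (p : Subset n) → ∣ p ∣ ≡ sum (𝟙 ∘ lookup p)
  ∣∣-sum []          = sym (sum-zero _)
  ∣∣-sum (true ∷ p)  = trans (cong suc (∣∣-sum p)) (sym (sum-suc _))
  ∣∣-sum (false ∷ p) = trans (∣∣-sum p) (sym (sum-suc _))

  sum-mono : ∀ {n} {f g : Fin n → ℕ} → (∀ i → f i ≤ g i) → sum f ≤ sum g
  sum-mono {zero}  {f} f≤g rewrite sum-zero f = z≤n
  sum-mono {suc n} {f} {g} f≤g rewrite sum-suc f | sum-suc g = f≤g zero ⊕ sum-mono (f≤g ∘ suc)

  sum-const : ∀ n c → sum {n} (λ _ → c) ≡ n * c
  sum-const zero    c = sum-zero _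
  sum-const (suc n) c = trans (sum-suc _) (cong (c +_) (sum-const n c))

  sum-0 : ∀ {n} {f : Fin n → ℕ} → (∀ i → f i ≡ 0) → sum f ≡ 0
  sum-0 {n} f≡0 = trans (sum-cong f≡0) (trans (sum-const n 0) (ℕₚ.*-zeroʳ n))

  term≤sum : ∀ {n} (f : Fin n → ℕ) i → f i ≤ sum f
  term≤sum f zero    rewrite sum-suc f = ℕₚ.m≤m+n _ _
  term≤sum f (suc i) rewrite sum-suc f = ℕₚ.≤-trans (term≤sum (f ∘ suc) i) (ℕₚ.m≤n+m _ _)

  terms≤sum : ∀ {n} (f : Fin n → ℕ) {i j} → i ≢ j → f i + f j ≤ sum f
  terms≤sum f {zero}  {zero}  i≢j = contradiction refl i≢j
  terms≤sum f {zero}  {suc j} i≢j rewrite sum-suc f = ℕₚ.+-monoʳ-≤ _ (term≤sum (f ∘ suc) j)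
  terms≤sum f {suc i} {zero}  i≢j rewrite sum-suc f =
    subst (_≤ f zero + sum (f ∘ suc)) (ℕₚ.+-comm (f zero) _) (ℕₚ.+-monoʳ-≤ _ (term≤sum (f ∘ suc) i))
  terms≤sum f {suc i} {suc j} i≢j rewrite sum-suc f =
    ℕₚ.≤-trans (terms≤sum (f ∘ suc) (i≢j ∘ cong suc)) (ℕₚ.m≤n+m _ _)

  sum-single : ∀ {n} {f : Fin n → ℕ} i → (∀ j → j ≢ i → f j ≡ 0) → sum f ≡ f i
  sum-single {f = f} zero    f≡0 rewrite sum-suc f =
    trans (cong (f zero +_) (sum-0 (λ j → f≡0 (suc j) λ ()))) (ℕₚ.+-identityʳ _)
  sum-single {f = f} (suc i) f≡0 rewrite sum-suc f =
    cong₂ _+_ (f≡0 zero λ ()) (sum-single i (λ j j≢i → f≡0 (suc j) λ { refl → j≢i refl }))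

  sum-δ : ∀ {n} (f : Fin n → ℕ) i → sum (λ j → f j * 𝟙 (j == i)) ≡ f i
  sum-δ f i = trans
    (sum-single i λ j j≢i → trans (cong (λ b → f j * 𝟙 b) (≢⇒== j≢i)) (ℕₚ.*-zeroʳ (f j)))
    (trans (cong (λ b → f i * 𝟙 b) (==-refl i)) (ℕₚ.*-identityʳ (f i)))

  sum-δ′ : ∀ {n} (f : Fin n → ℕ) i → sum (λ j → f j * 𝟙 (i == j)) ≡ f i
  sum-δ′ f i = trans
    (sum-single i λ j j≢i → trans (cong (λ b → f j * 𝟙 b) (≢⇒== (j≢i ∘ sym))) (ℕₚ.*-zeroʳ (f j)))
    (trans (cong (λ b → f i * 𝟙 b) (==-refl i)) (ℕₚ.*-identityʳ (f i)))

  0<sum : ∀ {n} (f : Fin n → ℕ) → 0 < sum f → ∃ λ i → 0 < f i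
  0<sum {zero}  f 0<Σ = contradiction (sum-zero f) (ℕₚ.>⇒≢ 0<Σ)
  0<sum {suc n} f 0<Σ rewrite sum-suc f with f zero in eq
  ... | suc _ = zero , subst (0 <_) (sym eq) (s≤s z≤n)
  ... | zero  = let i , 0<fi = 0<sum (f ∘ suc) 0<Σ in suc i , 0<fi

  sum≡0 : ∀ {n} (f : Fin n → ℕ) → sum f ≡ 0 → ∀ i → f i ≡ 0
  sum≡0 f Σ≡0 i = ℕₚ.n≤0⇒n≡0 (subst (f i ≤_) Σ≡0 (term≤sum f i))

  sum-mono-≡ : ∀ {n} {f g : Fin n → ℕ} → (∀ i → f i ≤ g i) → sum g ≤ sum f → ∀ i → f i ≡ g i
  sum-mono-≡ {suc n} {f} {g} f≤g Σ≤ zero rewrite sum-suc f | sum-suc g =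
    ℕₚ.≤-antisym (f≤g zero) (by-≤ 0 (Σ≤ ⊕ sum-mono (f≤g ∘ suc)) (lemma (g zero) (f zero) (sum (f ∘ suc)) (sum (g ∘ suc))))
    where
    lemma : ∀ g₀ f₀ Σf Σg → g₀ + (f₀ + Σf + Σg) + 0 ≡ f₀ + (g₀ + Σg + Σf)
    lemma = solve-∀
  sum-mono-≡ {suc n} {f} {g} f≤g Σ≤ (suc i) rewrite sum-suc f | sum-suc g =
    sum-mono-≡ (f≤g ∘ suc) (by-≤ 0 (Σ≤ ⊕ f≤g zero) (lemma (g zero) (f zero) (sum (f ∘ suc)) (sum (g ∘ suc)))) i
    where
    lemma : ∀ g₀ f₀ Σf Σg → Σg + (f₀ + Σf + g₀) + 0 ≡ Σf + (g₀ + Σg + f₀)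
    lemma = solve-∀

  -- Grouping by the fibres of `f`. Once the fibres are counted, this compares sums over a
  -- contraction with sums over the original graph.
  sum-push : ∀ {m n} (f : Fin m → Fin n) (w : Fin m → ℕ) (h : Fin n → ℕ) →
             sum (λ x → w x * h (f x)) ≡ sum (λ y → sum (λ x → w x * 𝟙 (f x == y)) * h y)
  sum-push f w h = begin
    sum (λ x → w x * h (f x))
      ≡⟨ sum-cong (λ x → cong (w x *_) (sum-δ′ h (f x))) ⟨
    sum (λ x → w x * sum (λ y → h y * 𝟙 (f x == y)))
      ≡⟨ sum-cong (λ x → *-sumˡ (w x) _) ⟩
    sum (λ x → sum (λ y → w x * (h y * 𝟙 (f x == y))))
      ≡⟨ sum-swap (λ x y → w x * (h y * 𝟙 (f x == y))) ⟩
    sum (λ y → sum (λ x → w x * (h y * 𝟙 (f x == y))))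
      ≡⟨ sum-cong (λ y → trans (sum-cong λ x → lemma (w x) (h y) _) (sym (*-sumʳ (h y) _))) ⟩
    sum (λ y → sum (λ x → w x * 𝟙 (f x == y)) * h y) ∎
    where
    open ≡-Reasoning
    lemma : ∀ w h d → w * (h * d) ≡ w * d * h
    lemma = solve-∀

  -- Supply and demand

  weight : ∀ {n} → (Fin n → Bool) → (Fin n → ℕ) → ℕ
  weight S p = sum λ v → 𝟙 (S v) * p v

  cut : ∀ {m n} → (Fin m → Bool) → (α β : Fin m → Fin n) → (Fin n → Bool) → ℕ
  cut c α β S = sum λ e → 𝟙 (c e ∧ S (α e) ∧ not (S (β e)))

  weight-cong : ∀ {n} {S T : Fin n → Bool} p → (∀ v → S v ≡ T v) → weight S p ≡ weight T p
  weight-cong p S≗T = sum-cong λ v → cong (λ b → 𝟙 b * p v) (S≗T v)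

  cut-cong : ∀ {m n} (c : Fin m → Bool) (α β : Fin m → Fin n) {S T} → (∀ v → S v ≡ T v) →
             cut c α β S ≡ cut c α β T
  cut-cong c α β S≗T = sum-cong λ e → cong₂ (λ s t → 𝟙 (c e ∧ s ∧ not t)) (S≗T (α e)) (S≗T (β e))

  weight-+ : ∀ {n} (S : Fin n → Bool) p q → weight S (λ v → p v + q v) ≡ weight S p + weight S q
  weight-+ S p q = trans (sum-cong λ v → ℕₚ.*-distribˡ-+ (𝟙 (S v)) (p v) (q v)) (sum-+ _ _)

  weight-* : ∀ {n} (S : Fin n → Bool) c p → weight S (λ v → c * p v) ≡ c * weight S p
  weight-* S c p = trans (sum-cong λ v → lemma (𝟙 (S v)) c (p v)) (sym (*-sumˡ c _))
    where
    lemma : ∀ s c p → s * (c * p) ≡ c * (s * p)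
    lemma = solve-∀

  weight-δ : ∀ {n} (S : Fin n → Bool) x → weight S (λ v → 𝟙 (x == v)) ≡ 𝟙 (S x)
  weight-δ S x = sum-δ′ (𝟙 ∘ S) x

  weight-modular : ∀ {n} (S T : Fin n → Bool) p →
    weight (λ v → S v ∧ T v) p + weight (λ v → S v ∨ T v) p ≡ weight S p + weight T p
  weight-modular S T p = trans (sym (sum-+ _ _))
    (trans (sum-cong λ v → lemma (S v) (T v) (p v)) (sum-+ _ _))
    where
    lemma : ∀ s t n → 𝟙 (s ∧ t) * n + 𝟙 (s ∨ t) * n ≡ 𝟙 s * n + 𝟙 t * n
    lemma true  t     n = ℕₚ.+-comm (𝟙 t * n) (1 * n)
    lemma false t     n = refl

  cut-submodular : ∀ {m n} (c : Fin m → Bool) (α β : Fin m → Fin n) S T →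
    cut c α β (λ v → S v ∧ T v) + cut c α β (λ v → S v ∨ T v) ≤ cut c α β S + cut c α β T
  cut-submodular c α β S T = subst₂ _≤_ (sum-+ _ _) (sum-+ _ _)
    (sum-mono λ e → lemma (c e) (S (α e)) (S (β e)) (T (α e)) (T (β e)))
    where
    lemma : ∀ c sa sb ta tb →
      𝟙 (c ∧ (sa ∧ ta) ∧ not (sb ∧ tb)) + 𝟙 (c ∧ (sa ∨ ta) ∧ not (sb ∨ tb))
        ≤ 𝟙 (c ∧ sa ∧ not sb) + 𝟙 (c ∧ ta ∧ not tb)
    lemma false _ _ _ _ = z≤n
    lemma true false _     false _     = z≤n
    lemma true false true  true  _     = z≤n
    lemma true false false true  tb    = ℕₚ.≤-refl
    lemma true true  true  ta    tb    = ℕₚ.≤-reflexive (ℕₚ.+-identityʳ _)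
    lemma true true  false false false = s≤s z≤n
    lemma true true  false false true  = z≤n
    lemma true true  false true  false = ℕₚ.≤-refl
    lemma true true  false true  true  = ℕₚ.≤-refl

  -- The supply–demand theorem for unit capacities (Gale, Hoffman).  The first
  -- edge is deleted or used; if neither is possible, a set that blocks the
  -- deletion and a set that blocks the use uncross to a violated set.
  flow : ∀ m {n} (c : Fin m → Bool) (α β : Fin m → Fin n) (p q : Fin n → ℕ) → sum p ≡ sum q →
         (∀ (S : Subset n) → weight (lookup S) p ≤ weight (lookup S) q + cut c α β (lookup S)) →
         ∃ λ (F : Fin m → Bool) → (∀ e → F e ≡ true → c e ≡ true) ×
           (∀ v → sum (λ e → 𝟙 (F e) * 𝟙 (α e == v)) + q v ≡ sum (λ e → 𝟙 (F e) * 𝟙 (β e == v)) + p v)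
  flow zero c α β p q Σp≡Σq cond = (λ ()) , (λ ()) , λ v →
    cong₂ _+_ (trans (sum-zero _) (sym (sum-zero _))) (sym (sum-mono-≡ p≤q (ℕₚ.≤-reflexive (sym Σp≡Σq)) v))
    where
    at : ∀ v r → weight (lookup ⁅ v ⁆) r ≡ r v
    at v r = trans (sum-cong λ x → trans (cong (λ b → 𝟙 b * r x) (lookup-⁅⁆ v x)) (ℕₚ.*-comm (𝟙 (x == v)) (r x)))
                   (sum-δ r v)
    -- Without edges, the condition at singletons gives `p ≤ q`, and the equal totals turn this into
    -- equality.
    p≤q : ∀ v → p v ≤ q v
    p≤q v = subst₂ _≤_ (at v p) (trans (cong (_ +_) (sum-zero _)) (trans (ℕₚ.+-identityʳ _) (at v q))) (cond ⁅ v ⁆)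
  flow (suc m) {n} c α β p q Σp≡Σq cond = step (c zero) refl
    where
    α₀ = α zero
    β₀ = β zero
    c⁻ = c ∘ suc
    α⁻ = α ∘ suc
    β⁻ = β ∘ suc
    Goal = ∃ λ (F : Fin (suc m) → Bool) → (∀ e → F e ≡ true → c e ≡ true) ×
           (∀ v → sum (λ e → 𝟙 (F e) * 𝟙 (α e == v)) + q v ≡ sum (λ e → 𝟙 (F e) * 𝟙 (β e == v)) + p v)
    R : (Fin n → Bool) → ℕ
    R = cut c⁻ α⁻ β⁻

    Deletable : Subset n → Set
    Deletable S = weight (lookup S) p ≤ weight (lookup S) q + R (lookup S)

    delete : (∀ S → Deletable S) → Goal
    delete cond′ with flow m c⁻ α⁻ β⁻ p q Σp≡Σq cond′
    ... | F , F⊆c , F-flow =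
      (λ { zero → false ; (suc e) → F e }) , (λ { zero () ; (suc e) → F⊆c e }) ,
      λ v → trans (cong (_+ q v) (sum-suc _)) (trans (F-flow v) (cong (_+ p v) (sym (sum-suc _))))

    -- Using the first edge hands one unit on to `β₀`. At `α₀` the demand is raised instead of the
    -- supply lowered, since `p α₀` may be 0.
    p⁺ q⁺ : Fin n → ℕ
    p⁺ v = p v + 𝟙 (β₀ == v)
    q⁺ v = q v + 𝟙 (α₀ == v)

    sum⁺ : ∀ (r : Fin n → ℕ) x → sum (λ v → r v + 𝟙 (x == v)) ≡ sum r + 1
    sum⁺ r x = trans (sum-+ r _) (cong (sum r +_)
      (trans (sum-cong λ v → sym (ℕₚ.*-identityˡ _)) (sum-δ′ (λ _ → 1) x)))

    use : c zero ≡ true → (∀ S → weight (lookup S) p⁺ ≤ weight (lookup S) q⁺ + R (lookup S)) → Goal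
    use c₀ cond′ with flow m c⁻ α⁻ β⁻ p⁺ q⁺ (trans (sum⁺ p β₀) (trans (cong (_+ 1) Σp≡Σq) (sym (sum⁺ q α₀)))) cond′
    ... | F , F⊆c , F-flow =
      (λ { zero → true ; (suc e) → F e }) , (λ { zero _ → c₀ ; (suc e) → F⊆c e }) ,
      λ v → trans (cong (_+ q v) (sum-suc _)) (trans (lemma (𝟙 (α₀ == v)) _ (q v)) (trans (F-flow v)
        (trans (sym (lemma (𝟙 (β₀ == v)) _ (p v))) (cong (_+ p v) (sym (sum-suc _))))))
      where
      lemma : ∀ d s r → 1 * d + s + r ≡ s + (r + d)
      lemma = solve-∀

    module _ (c₀ : c zero ≡ true) (S₁ : Subset n) (blocked : ¬ Deletable S₁) where
      Z : (Fin n → Bool) → ℕ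
      Z S = 𝟙 (S α₀ ∧ not (S β₀))

      cond₀ : ∀ (S : Subset n) → weight (lookup S) p ≤ weight (lookup S) q + (Z (lookup S) + R (lookup S))
      cond₀ S = subst (λ b → weight (lookup S) p ≤ weight (lookup S) q + (𝟙 (b ∧ lookup S α₀ ∧ not (lookup S β₀)) + R (lookup S)))
                      c₀ (subst (λ z → weight (lookup S) p ≤ weight (lookup S) q + z) (sum-suc _) (cond S))

      -- For a set that the first edge does not leave, the condition is the same with and without
      -- that edge, so such a set cannot block the deletion.
      crosses : ∀ a b → lookup S₁ α₀ ≡ a → lookup S₁ β₀ ≡ b → a ≡ true × b ≡ false
      crosses true  false _ _  = refl , refl
      crosses true  true  i j = ⊥-elim (blocked (subst (λ z → weight (lookup S₁) p ≤ weight (lookup S₁) q + (z + R (lookup S₁)))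
        (cong₂ (λ a b → 𝟙 (a ∧ not b)) i j) (cond₀ S₁)))
      crosses false b     i j = ⊥-elim (blocked (subst (λ z → weight (lookup S₁) p ≤ weight (lookup S₁) q + (z + R (lookup S₁)))
        (cong₂ (λ a b → 𝟙 (a ∧ not b)) i j) (cond₀ S₁)))

      α₀∈S₁ = proj₁ (crosses _ _ refl refl)
      β₀∉S₁ = proj₂ (crosses _ _ refl refl)

      -- Add the conditions for `S₁ ∩ S₂` and `S₁ ∪ S₂` and apply submodularity: the left sides for
      -- `S₁` and `S₂` together exceed the right sides by at most 1, the share of the first edge.
      -- Two violated inequalities would exceed by at least 2.
      usable : ∀ S₂ → weight (lookup S₂) p⁺ ≤ weight (lookup S₂) q⁺ + R (lookup S₂)
      usable S₂ = decidable-stable (_ ≤? _) λ unusable →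
        by-⊥ 0 (ℕₚ.≰⇒> blocked ⊕ subst₂ _<_ (cong (_+ R s₂) q⁺≡) p⁺≡ (ℕₚ.≰⇒> unusable)
                ⊕ cond∩ ⊕ cond∪ ⊕ cut-submodular c⁻ α⁻ β⁻ s₁ s₂ ⊕ ℕₚ.≤-reflexive (sym (weight-modular s₁ s₂ p))
                ⊕ ℕₚ.≤-reflexive (weight-modular s₁ s₂ q))
               (lemma (weight s₁ p) (weight s₂ p) (weight s₁ q) (weight s₂ q)
                      (R s₁) (R s₂) (R s∩) (R s∪) (weight s∩ p) (weight s∪ p) (weight s∩ q) (weight s∪ q)
                      (lookup S₂ α₀) (lookup S₂ β₀))
        where
        s₁ = lookup S₁
        s₂ = lookup S₂
        s∩ s∪ : Fin n → Bool
        s∩ v = s₁ v ∧ s₂ v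
        s∪ v = s₁ v ∨ s₂ v
        p⁺≡ : weight s₂ p⁺ ≡ weight s₂ p + 𝟙 (s₂ β₀)
        p⁺≡ = trans (weight-+ s₂ p _) (cong (weight s₂ p +_) (weight-δ s₂ β₀))
        q⁺≡ : weight s₂ q⁺ ≡ weight s₂ q + 𝟙 (s₂ α₀)
        q⁺≡ = trans (weight-+ s₂ q _) (cong (weight s₂ q +_) (weight-δ s₂ α₀))
        Z∩ : Z s∩ ≡ 𝟙 (s₂ α₀)
        Z∩ = trans (cong₂ (λ a b → 𝟙 ((a ∧ s₂ α₀) ∧ not (b ∧ s₂ β₀))) α₀∈S₁ β₀∉S₁) (aux (s₂ α₀))
          where
          aux : ∀ a → 𝟙 (a ∧ true) ≡ 𝟙 a
          aux true  = refl
          aux false = refl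
        Z∪ : Z s∪ ≡ 𝟙 (not (s₂ β₀))
        Z∪ = cong₂ (λ a b → 𝟙 ((a ∨ s₂ α₀) ∧ not (b ∨ s₂ β₀))) α₀∈S₁ β₀∉S₁
        cond∩ : weight s∩ p ≤ weight s∩ q + (𝟙 (s₂ α₀) + R s∩)
        cond∩ = subst₂ _≤_ (weight-cong p eq) (cong₂ _+_ (weight-cong q eq) (cong₂ _+_
                  (trans (cong₂ (λ a b → 𝟙 (a ∧ not b)) (eq α₀) (eq β₀)) Z∩) (cut-cong c⁻ α⁻ β⁻ eq))) (cond₀ (S₁ ∩ S₂))
          where
          eq = lookup-∩ S₁ S₂
        cond∪ : weight s∪ p ≤ weight s∪ q + (𝟙 (not (s₂ β₀)) + R s∪)
        cond∪ = subst₂ _≤_ (weight-cong p eq) (cong₂ _+_ (weight-cong q eq) (cong₂ _+_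
                  (trans (cong₂ (λ a b → 𝟙 (a ∧ not b)) (eq α₀) (eq β₀)) Z∪) (cut-cong c⁻ α⁻ β⁻ eq))) (cond₀ (S₁ ∪ S₂))
          where
          eq = lookup-∪ S₁ S₂
        lemma : ∀ p₁ p₂ q₁ q₂ r₁ r₂ r₃ r₄ p₃ p₄ q₃ q₄ a b →
          suc (q₁ + r₁) + (suc (q₂ + 𝟙 a + r₂) + (p₃ + (p₄ + ((r₃ + r₄) + ((p₁ + p₂) + (q₃ + q₄))))))
          ≡ suc (p₁ + (p₂ + 𝟙 b + ((q₃ + (𝟙 a + r₃)) + ((q₄ + (𝟙 (not b) + r₄)) + ((r₁ + r₂) + ((p₃ + p₄) + (q₁ + q₂)))))))
        lemma p₁ p₂ q₁ q₂ r₁ r₂ r₃ r₄ p₃ p₄ q₃ q₄ a true  = aux p₁ p₂ q₁ q₂ r₁ r₂ r₃ r₄ p₃ p₄ q₃ q₄ (𝟙 a)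
          where
          aux : ∀ p₁ p₂ q₁ q₂ r₁ r₂ r₃ r₄ p₃ p₄ q₃ q₄ a →
            suc (q₁ + r₁) + (suc (q₂ + a + r₂) + (p₃ + (p₄ + ((r₃ + r₄) + ((p₁ + p₂) + (q₃ + q₄))))))
            ≡ suc (p₁ + (p₂ + 1 + ((q₃ + (a + r₃)) + ((q₄ + (0 + r₄)) + ((r₁ + r₂) + ((p₃ + p₄) + (q₁ + q₂)))))))
          aux = solve-∀
        lemma p₁ p₂ q₁ q₂ r₁ r₂ r₃ r₄ p₃ p₄ q₃ q₄ a false = aux p₁ p₂ q₁ q₂ r₁ r₂ r₃ r₄ p₃ p₄ q₃ q₄ (𝟙 a)
          where
          aux : ∀ p₁ p₂ q₁ q₂ r₁ r₂ r₃ r₄ p₃ p₄ q₃ q₄ a →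
            suc (q₁ + r₁) + (suc (q₂ + a + r₂) + (p₃ + (p₄ + ((r₃ + r₄) + ((p₁ + p₂) + (q₃ + q₄))))))
            ≡ suc (p₁ + (p₂ + 0 + ((q₃ + (a + r₃)) + ((q₄ + (1 + r₄)) + ((r₁ + r₂) + ((p₃ + p₄) + (q₁ + q₂)))))))
          aux = solve-∀

    step : ∀ b → c zero ≡ b → Goal
    step false c₀ = delete λ S → subst (λ b → weight (lookup S) p ≤ weight (lookup S) q
      + (𝟙 (b ∧ lookup S α₀ ∧ not (lookup S β₀)) + R (lookup S))) c₀
      (subst (λ z → weight (lookup S) p ≤ weight (lookup S) q + z) (sum-suc _) (cond S))
    step true  c₀ with anySubset? (λ S → ¬? (weight (lookup S) p ≤? weight (lookup S) q + R (lookup S)))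
    ... | no ok             = delete λ S → decidable-stable (_ ≤? _) λ blocked → ok (S , blocked)
    ... | yes (S₁ , blocked) = use c₀ (usable c₀ S₁ blocked)

  -- Bipartite graphs

  EdgeConnected : Graph → Set
  EdgeConnected G = ∀ X {x y} → x ∈ X → y ∉ X → 3 ≤ ∣ Graph.∂ G X ∣

  -- The slack 2 is the gain from integrality. It supplies what is missing when an inequality
  -- between colour classes is read off three times its value.
  div3 : ∀ x y → 3 * x ≤ 3 * y + 2 → x ≤ y
  div3 x y 3x≤ = ℕₚ.≮⇒≥ λ y<x → by-⊥ 0 (3x≤ ⊕ ℕₚ.*-monoʳ-≤ 3 y<x) (lemma x y)
    where
    lemma : ∀ x y → 3 * x + 3 * suc y ≡ suc (0 + (3 * y + 2 + 3 * x))
    lemma = solve-∀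

  ∂-joins : ∀ G {e x y} → Graph.Joins G e x y → ∀ X → lookup (Graph.∂ G X) e ≡ lookup X x xor lookup X y
  ∂-joins G {e} (inj₁ eq) X = trans (lookup∘tabulate _ e) (cong (λ p → lookup X (proj₁ p) xor lookup X (proj₂ p)) eq)
  ∂-joins G {e} {x} {y} (inj₂ eq) X = trans (lookup∘tabulate _ e)
    (trans (cong (λ p → lookup X (proj₁ p) xor lookup X (proj₂ p)) eq) (xor-comm (lookup X y) (lookup X x)))

  joins-sym : ∀ G {e x y} → Graph.Joins G e x y → Graph.Joins G e y x
  joins-sym G (inj₁ eq) = inj₂ eq
  joins-sym G (inj₂ eq) = inj₁ eq

  joins-unique : ∀ G {e x y z w} → Graph.Joins G e x y → Graph.Joins G e z w →
                 (x ≡ z × y ≡ w) ⊎ (x ≡ w × y ≡ z)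
  joins-unique G (inj₁ p) (inj₁ q) with refl ← trans (sym p) q = inj₁ (refl , refl)
  joins-unique G (inj₁ p) (inj₂ q) with refl ← trans (sym p) q = inj₂ (refl , refl)
  joins-unique G (inj₂ p) (inj₁ q) with refl ← trans (sym p) q = inj₂ (refl , refl)
  joins-unique G (inj₂ p) (inj₂ q) with refl ← trans (sym p) q = inj₁ (refl , refl)

  joins-≢ : ∀ G {e x y} → Graph.Joins G e x y → x ≢ y
  joins-≢ G {e} (inj₁ p) x≡y = Graph.loopless G e (trans (cong proj₁ p) (trans x≡y (sym (cong proj₂ p))))
  joins-≢ G {e} (inj₂ p) x≡y = Graph.loopless G e (trans (cong proj₁ p) (trans (sym x≡y) (sym (cong proj₂ p))))

  ∣∩∣-sum : ∀ {n} (p q : Subset n) → ∣ p ∩ q ∣ ≡ sum λ e → 𝟙 (lookup p e) * 𝟙 (lookup q e)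
  ∣∩∣-sum p q = trans (∣∣-sum (p ∩ q)) (sum-cong λ e → trans (cong 𝟙 (lookup-∩ p q e)) (𝟙-∧ (lookup p e) (lookup q e)))

  all : ∀ {n} → Fin n → Bool
  all _ = true

  module Bipartitioned (G : Graph) (A : Subset (order G)) (bip : IsBipartition G A) where
    open Graph G using (ends; Joins; ∂; degree)

    sides : ∀ e → ∃₂ λ x y → Joins e x y × lookup A x ≡ true × lookup A y ≡ false
    sides e = aux _ _ refl refl (trans (sym (lookup∘tabulate _ e)) (∈⇒lookup (bip e)))
      where
      aux : ∀ s t → lookup A (proj₁ (ends e)) ≡ s → lookup A (proj₂ (ends e)) ≡ t → s xor t ≡ true →
            ∃₂ λ x y → Joins e x y × lookup A x ≡ true × lookup A y ≡ false
      aux true  false p q _ = _ , _ , inj₁ refl , p , q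
      aux false true  p q _ = _ , _ , inj₂ refl , q , p

    α β : Edge G → Vertex G
    α e = proj₁ (sides e)
    β e = proj₁ (proj₂ (sides e))

    αβ-joins : ∀ e → Joins e (α e) (β e)
    αβ-joins e = proj₁ (proj₂ (proj₂ (sides e)))

    α∈A : ∀ e → lookup A (α e) ≡ true
    α∈A e = proj₁ (proj₂ (proj₂ (proj₂ (sides e))))

    β∉A : ∀ e → lookup A (β e) ≡ false
    β∉A e = proj₂ (proj₂ (proj₂ (proj₂ (sides e))))

    α-unique : ∀ {e x y} → Joins e x y → lookup A x ≡ true → x ≡ α e × y ≡ β e
    α-unique {e} j x∈A with joins-unique G j (αβ-joins e)
    ... | inj₁ eqs         = eqs
    ... | inj₂ (refl , _) = ⊥-elim (true≢false x∈A (β∉A e))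

    joins-colours : ∀ {e x y} → Joins e x y → lookup A y ≡ not (lookup A x)
    joins-colours {e} j with joins-unique G j (αβ-joins e)
    ... | inj₁ (refl , refl) = trans (β∉A e) (cong not (sym (α∈A e)))
    ... | inj₂ (refl , refl) = trans (α∈A e) (cong not (sym (β∉A e)))

    d : (Edge G → Bool) → Vertex G → ℕ
    d F v = sum λ e → 𝟙 (F e) * (𝟙 (α e == v) + 𝟙 (β e == v))

    star : ∀ v e → 𝟙 (lookup (∂ ⁅ v ⁆) e) ≡ 𝟙 (α e == v) + 𝟙 (β e == v)
    star v e = trans (cong 𝟙 (trans (∂-joins G (αβ-joins e) ⁅ v ⁆) (cong₂ _xor_ (lookup-⁅⁆ v (α e)) (lookup-⁅⁆ v (β e)))))
                     (aux (α e == v) (β e == v) λ p q → joins-≢ G (αβ-joins e) (trans (==⇒≡ p) (sym (==⇒≡ q))))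
      where
      aux : ∀ a b → (a ≡ true → b ≡ true → ⊥) → 𝟙 (a xor b) ≡ 𝟙 a + 𝟙 b
      aux true  true  absurd = ⊥-elim (absurd refl refl)
      aux true  false _ = refl
      aux false b     _ = refl

    degree-d : ∀ M v → degree M v ≡ d (lookup M) v
    degree-d M v = trans (∣∩∣-sum M (∂ ⁅ v ⁆)) (sum-cong λ e → cong (𝟙 (lookup M e) *_) (star v e))

    d-tabulate : ∀ F v → degree (tabulate F) v ≡ d F v
    d-tabulate F v = trans (degree-d (tabulate F) v) (sum-cong λ e →
      cong (λ b → 𝟙 b * (𝟙 (α e == v) + 𝟙 (β e == v))) (lookup∘tabulate F e))

    ∣∂∣-d : ∀ v → ∣ ∂ ⁅ v ⁆ ∣ ≡ d all v
    ∣∂∣-d v = trans (∣∣-sum (∂ ⁅ v ⁆)) (sum-cong λ e → trans (star v e) (sym (ℕₚ.*-identityˡ _)))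

    handshake : ∀ F w → sum (λ v → w v * d F v) ≡ sum (λ e → 𝟙 (F e) * (w (α e) + w (β e)))
    handshake F w = begin
      sum (λ v → w v * d F v)
        ≡⟨ sum-cong (λ v → *-sumˡ (w v) _) ⟩
      sum (λ v → sum (λ e → w v * (𝟙 (F e) * (𝟙 (α e == v) + 𝟙 (β e == v)))))
        ≡⟨ sum-swap (λ v e → w v * (𝟙 (F e) * (𝟙 (α e == v) + 𝟙 (β e == v)))) ⟩
      sum (λ e → sum (λ v → w v * (𝟙 (F e) * (𝟙 (α e == v) + 𝟙 (β e == v)))))
        ≡⟨ sum-cong (λ e → trans (sum-cong λ v → lemma (w v) (𝟙 (F e)) _ _) (sym (*-sumˡ (𝟙 (F e)) _))) ⟩
      sum (λ e → 𝟙 (F e) * sum (λ v → w v * 𝟙 (α e == v) + w v * 𝟙 (β e == v)))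
        ≡⟨ sum-cong (λ e → cong (𝟙 (F e) *_) (trans (sum-+ _ _) (cong₂ _+_ (sum-δ′ w (α e)) (sum-δ′ w (β e))))) ⟩
      sum (λ e → 𝟙 (F e) * (w (α e) + w (β e))) ∎
      where
      open ≡-Reasoning
      lemma : ∀ w f a b → w * (f * (a + b)) ≡ f * (w * a + w * b)
      lemma = solve-∀

    out into : (Edge G → Bool) → (Vertex G → Bool) → ℕ
    out  F S = sum λ e → 𝟙 (F e) * 𝟙 (S (α e) ∧ not (S (β e)))
    into F S = sum λ e → 𝟙 (F e) * 𝟙 (not (S (α e)) ∧ S (β e))

    massA massB : (Vertex G → Bool) → (Vertex G → ℕ) → ℕ
    massA S f = sum λ v → 𝟙 (S v ∧ lookup A v) * f v
    massB S f = sum λ v → 𝟙 (S v ∧ not (lookup A v)) * f v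

    numA numB : (Vertex G → Bool) → ℕ
    numA S = massA S λ _ → 1
    numB S = massB S λ _ → 1

    -- The edges of `F` with their A-end in `S` and those with their B-end in `S` differ only in the
    -- edges that cross the boundary. Applied below to all edges, to perfect matchings and to
    -- λ-matchings.
    balance : ∀ F S → massA S (d F) + into F S ≡ massB S (d F) + out F S
    balance F S = begin
      massA S (d F) + into F S
        ≡⟨ cong (_+ into F S) (handshake F λ v → 𝟙 (S v ∧ lookup A v)) ⟩
      sum (λ e → 𝟙 (F e) * (𝟙 (S (α e) ∧ lookup A (α e)) + 𝟙 (S (β e) ∧ lookup A (β e)))) + into F S
        ≡⟨ sum-+ _ _ ⟨
      sum (λ e → 𝟙 (F e) * (𝟙 (S (α e) ∧ lookup A (α e)) + 𝟙 (S (β e) ∧ lookup A (β e)))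
                  + 𝟙 (F e) * 𝟙 (not (S (α e)) ∧ S (β e)))
        ≡⟨ sum-cong pointwise ⟩
      sum (λ e → 𝟙 (F e) * (𝟙 (S (α e) ∧ not (lookup A (α e))) + 𝟙 (S (β e) ∧ not (lookup A (β e))))
                  + 𝟙 (F e) * 𝟙 (S (α e) ∧ not (S (β e))))
        ≡⟨ sum-+ _ _ ⟩
      sum (λ e → 𝟙 (F e) * (𝟙 (S (α e) ∧ not (lookup A (α e))) + 𝟙 (S (β e) ∧ not (lookup A (β e))))) + out F S
        ≡⟨ cong (_+ out F S) (handshake F λ v → 𝟙 (S v ∧ not (lookup A v))) ⟨
      massB S (d F) + out F S ∎
      where
      open ≡-Reasoning
      aux : ∀ f s t → f * (𝟙 (s ∧ true) + 𝟙 (t ∧ false)) + f * 𝟙 (not s ∧ t)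
                    ≡ f * (𝟙 (s ∧ false) + 𝟙 (t ∧ true)) + f * 𝟙 (s ∧ not t)
      aux f true  true  = refl
      aux f true  false = ℕₚ.+-comm (f * 1) (f * 0)
      aux f false true  = ℕₚ.+-comm (f * 0) (f * 1)
      aux f false false = refl
      pointwise : ∀ e → 𝟙 (F e) * (𝟙 (S (α e) ∧ lookup A (α e)) + 𝟙 (S (β e) ∧ lookup A (β e)))
                          + 𝟙 (F e) * 𝟙 (not (S (α e)) ∧ S (β e))
                      ≡ 𝟙 (F e) * (𝟙 (S (α e) ∧ not (lookup A (α e))) + 𝟙 (S (β e) ∧ not (lookup A (β e))))
                          + 𝟙 (F e) * 𝟙 (S (α e) ∧ not (S (β e)))
      pointwise e rewrite α∈A e | β∉A e = aux (𝟙 (F e)) (S (α e)) (S (β e))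

    out-∁ : ∀ F X → out F (lookup (∁ X)) ≡ into F (lookup X)
    out-∁ F X = sum-cong λ e → cong (λ b → 𝟙 (F e) * 𝟙 b)
      (trans (cong₂ (λ a b → a ∧ not b) (lookup-∁ X (α e)) (lookup-∁ X (β e)))
             (cong (not (lookup X (α e)) ∧_) (not-involutive (lookup X (β e)))))

    into-∁ : ∀ F X → into F (lookup (∁ X)) ≡ out F (lookup X)
    into-∁ F X = sum-cong λ e → cong (λ b → 𝟙 (F e) * 𝟙 b)
      (trans (cong₂ (λ a b → not a ∧ b) (lookup-∁ X (α e)) (lookup-∁ X (β e)))
             (cong (_∧ not (lookup X (β e))) (not-involutive (lookup X (α e)))))

    xor-split : ∀ a b → 𝟙 (a xor b) ≡ 𝟙 (a ∧ not b) + 𝟙 (not a ∧ b)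
    xor-split true  b = sym (ℕₚ.+-identityʳ _)
    xor-split false b = refl

    cut-size : ∀ X M → ∣ ∂ X ∩ M ∣ ≡ out (lookup M) (lookup X) + into (lookup M) (lookup X)
    cut-size X M = trans (∣∩∣-sum (∂ X) M) (trans (sum-cong λ e →
      trans (ℕₚ.*-comm (𝟙 (lookup (∂ X) e)) _) (trans (cong (𝟙 (lookup M e) *_)
        (trans (cong 𝟙 (∂-joins G (αβ-joins e) X)) (xor-split (lookup X (α e)) (lookup X (β e)))))
        (ℕₚ.*-distribˡ-+ (𝟙 (lookup M e)) _ _))) (sum-+ _ _))

    ∣∂X∣ : ∀ X → ∣ ∂ X ∣ ≡ out all (lookup X) + into all (lookup X)
    ∣∂X∣ X = trans (∣∣-sum (∂ X)) (trans (sum-cong λ e →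
      trans (cong 𝟙 (∂-joins G (αβ-joins e) X)) (trans (xor-split (lookup X (α e)) (lookup X (β e)))
        (sym (cong₂ _+_ (ℕₚ.*-identityˡ (𝟙 (lookup X (α e) ∧ _))) (ℕₚ.*-identityˡ (𝟙 (not (lookup X (α e)) ∧ _))))))) (sum-+ _ _))

    mass-cong : ∀ S {f g} → (∀ v → f v ≡ g v) → massA S f ≡ massA S g × massB S f ≡ massB S g
    mass-cong S f≗g = sum-cong (λ v → cong (𝟙 (S v ∧ lookup A v) *_) (f≗g v)) ,
                      sum-cong (λ v → cong (𝟙 (S v ∧ not (lookup A v)) *_) (f≗g v))

    massA-+ : ∀ S f g → massA S (λ v → f v + g v) ≡ massA S f + massA S g
    massA-+ S = weight-+ (λ v → S v ∧ lookup A v)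

    massB-+ : ∀ S f g → massB S (λ v → f v + g v) ≡ massB S f + massB S g
    massB-+ S = weight-+ (λ v → S v ∧ not (lookup A v))

    massA-* : ∀ S c f → massA S (λ v → c * f v) ≡ c * massA S f
    massA-* S = weight-* (λ v → S v ∧ lookup A v)

    massB-* : ∀ S c f → massB S (λ v → c * f v) ≡ c * massB S f
    massB-* S = weight-* (λ v → S v ∧ not (lookup A v))

    perfect-balance : ∀ F → (∀ v → d F v ≡ 1) → ∀ S → numA S + into F S ≡ numB S + out F S
    perfect-balance F F-perfect S = let eqA , eqB = mass-cong S F-perfect in
      trans (cong (_+ into F S) (sym eqA)) (trans (balance F S) (cong (_+ out F S) eqB))

    -- Take `f` on A as supply and `f` on B as demand. All edges run from A to B, so no vertex has
    -- both entering and leaving edges, and conservation at a vertex becomes the degree condition.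
    factor : ∀ (c : Edge G → Bool) (f : Vertex G → ℕ) → massA all f ≡ massB all f →
             (∀ X → massA (lookup X) f ≤ massB (lookup X) f + cut c α β (lookup X)) →
             ∃ λ F → (∀ e → F e ≡ true → c e ≡ true) × (∀ v → d F v ≡ f v)
    factor c f total cond with flow (size G) c α β p q total (λ S → subst₂ (λ x y → x ≤ y + _) (massA-p (lookup S)) (massB-q (lookup S)) (cond S))
      where
      p q : Vertex G → ℕ
      p v = 𝟙 (lookup A v) * f v
      q v = 𝟙 (not (lookup A v)) * f v
      assoc : ∀ s a n → 𝟙 (s ∧ a) * n ≡ 𝟙 s * (𝟙 a * n)
      assoc s a n = trans (cong (_* n) (𝟙-∧ s a)) (ℕₚ.*-assoc (𝟙 s) (𝟙 a) n)
      massA-p : ∀ S → massA S f ≡ weight S p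
      massA-p S = sum-cong λ v → assoc (S v) (lookup A v) (f v)
      massB-q : ∀ S → massB S f ≡ weight S q
      massB-q S = sum-cong λ v → assoc (S v) (not (lookup A v)) (f v)
    ... | F , F⊆c , F-flow = F , F⊆c , λ v → trans (d-split v) (at v (lookup A v) refl (F-flow v))
      where
      outF inF : Vertex G → ℕ
      outF v = sum λ e → 𝟙 (F e) * 𝟙 (α e == v)
      inF  v = sum λ e → 𝟙 (F e) * 𝟙 (β e == v)
      d-split : ∀ v → d F v ≡ outF v + inF v
      d-split v = trans (sum-cong λ e → ℕₚ.*-distribˡ-+ (𝟙 (F e)) _ _) (sum-+ _ _)
      vanish : ∀ v (γ : Edge G → Vertex G) → (∀ e → γ e ≢ v) → sum (λ e → 𝟙 (F e) * 𝟙 (γ e == v)) ≡ 0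
      vanish v γ γ≢v = sum-0 λ e → trans (cong (λ b → 𝟙 (F e) * 𝟙 b) (≢⇒== (γ≢v e))) (ℕₚ.*-zeroʳ (𝟙 (F e)))
      at : ∀ v b → lookup A v ≡ b →
           outF v + 𝟙 (not (lookup A v)) * f v ≡ inF v + 𝟙 (lookup A v) * f v → outF v + inF v ≡ f v
      at v true eq h rewrite eq | vanish v β (λ e βe≡v → true≢false eq (trans (cong (lookup A) (sym βe≡v)) (β∉A e)))
        = trans h (ℕₚ.+-identityʳ (f v))
      at v false eq h rewrite eq | vanish v α (λ e αe≡v → true≢false (α∈A e) (trans (cong (lookup A) αe≡v) eq))
        = trans (sym (ℕₚ.+-identityʳ (inF v))) (trans (sym h) (ℕₚ.+-identityʳ (f v)))

  does⇒ : ∀ {p} {P : Set p} (p? : Dec P) → does p? ≡ true → P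
  does⇒ (yes p) _ = p

  ≡-iff : ∀ {a b} → (a ≡ true → b ≡ true) → (b ≡ true → a ≡ true) → a ≡ b
  ≡-iff {true}  {b}     f g = sym (f refl)
  ≡-iff {false} {true}  f g = g refl
  ≡-iff {false} {false} f g = refl

  2≤∣∣ : ∀ {n} {X : Subset n} {x y} → x ≢ y → x ∈ X → y ∈ X → 2 ≤ ∣ X ∣
  2≤∣∣ {X = X} {x} {y} x≢y x∈X y∈X =
    subst₂ _≤_ (cong₂ (λ a b → 𝟙 a + 𝟙 b) (∈⇒lookup x∈X) (∈⇒lookup y∈X)) (sym (∣∣-sum X)) (terms≤sum (𝟙 ∘ lookup X) x≢y)

  λ-sym : ∀ G {a b M} → IsλMatching G a b M → IsλMatching G b a M
  λ-sym G (da , db , rest) = db , da , λ v v∉ → rest v (v∉ ∘ λ { (inj₁ p) → inj₂ p ; (inj₂ p) → inj₁ p })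

  -- Cubic bipartite graphs

  module CubicBipartite (G : Graph) (A : Subset (order G)) (bip : IsBipartition G A) (cubic : Cubic G) where
    open Graph G using (ends; Joins; ∂; degree)
    open Bipartitioned G A bip public

    d-all : ∀ v → d all v ≡ 3
    d-all v = trans (sym (∣∂∣-d v)) (cubic v)

    cubic-balance : ∀ S → 3 * numA S + into all S ≡ 3 * numB S + out all S
    cubic-balance S = let eqA , eqB = mass-cong S d-all in
      trans (cong (_+ into all S) (trans (sym (massA-* S 3 (λ _ → 1))) (sym eqA)))
        (trans (balance all S) (cong (_+ out all S) (trans eqB (massB-* S 3 (λ _ → 1)))))

    out-all : ∀ F → out F all ≡ 0
    out-all F = sum-0 λ e → ℕₚ.*-zeroʳ (𝟙 (F e))

    into-all : ∀ F → into F all ≡ 0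
    into-all F = sum-0 λ e → ℕₚ.*-zeroʳ (𝟙 (F e))

    balanced : numA all ≡ numB all
    balanced = ℕₚ.*-cancelˡ-≡ (numA all) (numB all) 3
      (by-≡ (cubic-balance all) (trans (cong (3 * numA all +_) (cong (3 * numB all +_) (out-all all)))
        (trans (lemma (numA all) (numB all)) (cong (λ z → 3 * numB all + (3 * numA all + z)) (sym (into-all all))))))
      where
      lemma : ∀ x y → 3 * x + (3 * y + 0) ≡ 3 * y + (3 * x + 0)
      lemma = solve-∀

    -- The excess of A over B in `S` is a third of `out - into`. This is the supply condition for
    -- perfect matchings.
    numA≤ : ∀ S → numA S ≤ numB S + out all S
    numA≤ S = div3 _ _ (by-≤ (2 * out all S + 2 + into all S) (ℕₚ.≤-reflexive (cubic-balance S))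
      (lemma (numA S) (numB S) (out all S) (into all S)))
      where
      lemma : ∀ x y o r → 3 * x + (3 * y + o) + (2 * o + 2 + r) ≡ 3 * (y + o) + 2 + (3 * x + r)
      lemma = solve-∀

    -- One entering edge brings `3 * numA S` down to at most `3 * numB S + out - 1`, which is within
    -- the slack of `div3` for the successor.
    numA< : ∀ S → 0 < into all S → numA S < numB S + out all S
    numA< S 0<r = div3 _ _ (by-≤ (2 * out all S) (ℕₚ.≤-reflexive (cubic-balance S) ⊕ 0<r)
      (lemma (numA S) (numB S) (out all S) (into all S)))
      where
      lemma : ∀ x y o r → 3 * suc x + (3 * y + o + r) + 2 * o ≡ 3 * (y + o) + 2 + (3 * x + r + 1)
      lemma = solve-∀

    massA-δ : ∀ S {x} → lookup A x ≡ true → massA S (λ v → 𝟙 (x == v)) ≡ 𝟙 (S x)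
    massA-δ S {x} x∈A = trans (weight-δ (λ v → S v ∧ lookup A v) x) (cong 𝟙 (trans (cong (S x ∧_) x∈A) (∧-identityʳ (S x))))

    massA-δ-0 : ∀ S {x} → lookup A x ≡ false → massA S (λ v → 𝟙 (x == v)) ≡ 0
    massA-δ-0 S {x} x∉A = trans (weight-δ (λ v → S v ∧ lookup A v) x) (cong 𝟙 (trans (cong (S x ∧_) x∉A) (∧-zeroʳ (S x))))

    massB-δ : ∀ S {x} → lookup A x ≡ false → massB S (λ v → 𝟙 (x == v)) ≡ 𝟙 (S x)
    massB-δ S {x} x∉A = trans (weight-δ (λ v → S v ∧ not (lookup A v)) x) (cong 𝟙 (trans (cong (λ b → S x ∧ not b) x∉A) (∧-identityʳ (S x))))

    massB-δ-0 : ∀ S {x} → lookup A x ≡ true → massB S (λ v → 𝟙 (x == v)) ≡ 0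
    massB-δ-0 S {x} x∈A = trans (weight-δ (λ v → S v ∧ not (lookup A v)) x) (cong 𝟙 (trans (cong (λ b → S x ∧ not b) x∈A) (∧-zeroʳ (S x))))

    -- A perfect matching through `e₀`: forbid `e₀`, ask for degree 0 at its ends and 1 elsewhere,
    -- then add `e₀`. By `exchange`, the supply condition becomes `numA S ≤ numB S + out all S`,
    -- with an extra 1 on the left exactly when `e₀` enters `S`; in that case `numA<` applies.
    private module Cover (e₀ : Edge G) where
      c : Edge G → Bool
      c e = not (e == e₀)
      f : Vertex G → ℕ
      f v = 𝟙 (not (α e₀ == v ∨ β e₀ == v))
      f-split : ∀ v → f v + (𝟙 (α e₀ == v) + 𝟙 (β e₀ == v)) ≡ 1
      f-split v = aux (α e₀ == v) (β e₀ == v) λ p q → joins-≢ G (αβ-joins e₀) (trans (==⇒≡ p) (sym (==⇒≡ q)))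
        where
        aux : ∀ a b → (a ≡ true → b ≡ true → ⊥) → 𝟙 (not (a ∨ b)) + (𝟙 a + 𝟙 b) ≡ 1
        aux true  true  absurd = ⊥-elim (absurd refl refl)
        aux true  false _ = refl
        aux false true  _ = refl
        aux false false _ = refl
      fA : ∀ S → massA S f + 𝟙 (S (α e₀)) ≡ numA S
      fA S = trans (cong (massA S f +_) (sym (trans (massA-+ S _ _)
          (trans (cong₂ _+_ (massA-δ S (α∈A e₀)) (massA-δ-0 S (β∉A e₀))) (ℕₚ.+-identityʳ _)))))
        (trans (sym (massA-+ S f _)) (proj₁ (mass-cong S f-split)))
      fB : ∀ S → massB S f + 𝟙 (S (β e₀)) ≡ numB S
      fB S = trans (cong (massB S f +_) (sym (trans (massB-+ S _ _)
          (cong₂ _+_ (massB-δ-0 S (α∈A e₀)) (massB-δ S (β∉A e₀))))))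
        (trans (sym (massB-+ S f _)) (proj₂ (mass-cong S f-split)))
      cut-split : ∀ S → cut c α β S + 𝟙 (S (α e₀) ∧ not (S (β e₀))) ≡ out all S
      cut-split S = trans (cong (cut c α β S +_) (sym (sum-δ crossing e₀)))
        (trans (sym (sum-+ _ _)) (sum-cong λ e → aux (e == e₀) (S (α e) ∧ not (S (β e)))))
        where
        crossing : Edge G → ℕ
        crossing e = 𝟙 (S (α e) ∧ not (S (β e)))
        aux : ∀ b x → 𝟙 (not b ∧ x) + 𝟙 x * 𝟙 b ≡ 1 * 𝟙 x
        aux true  true  = refl
        aux true  false = refl
        aux false true  = refl
        aux false false = refl
      entering : ∀ S → S (α e₀) ≡ false → S (β e₀) ≡ true → 0 < into all S
      entering S p q = ℕₚ.≤-trans (ℕₚ.≤-reflexive (sym (cong₂ (λ a b → 1 * 𝟙 (not a ∧ b)) p q)))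
        (term≤sum (λ e → 1 * 𝟙 (not (S (α e)) ∧ S (β e))) e₀)
      total : massA all f ≡ massB all f
      total = ℕₚ.+-cancelʳ-≡ 1 _ _ (trans (fA all) (trans balanced (sym (fB all))))
      strict : ∀ S a b → S (α e₀) ≡ a → S (β e₀) ≡ b → numA S + 𝟙 (not a ∧ b) ≤ numB S + out all S
      strict S false true  p q = subst (_≤ numB S + out all S) (ℕₚ.+-comm 1 (numA S)) (numA< S (entering S p q))
      strict S false false p q = subst (_≤ numB S + out all S) (sym (ℕₚ.+-identityʳ (numA S))) (numA≤ S)
      strict S true  b     p q = subst (_≤ numB S + out all S) (sym (ℕₚ.+-identityʳ (numA S))) (numA≤ S)
      exchange : ∀ a b → 𝟙 b + 𝟙 (a ∧ not b) ≡ 𝟙 a + 𝟙 (not a ∧ b)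
      exchange true  true  = refl
      exchange true  false = refl
      exchange false b     = ℕₚ.+-identityʳ (𝟙 b)
      cond : ∀ X → massA (lookup X) f ≤ massB (lookup X) f + cut c α β (lookup X)
      cond X = by-≤ 0 (subst₂ _≤_ (cong (_+ 𝟙 (not (S (α e₀)) ∧ S (β e₀))) (sym (fA S))) (cong₂ _+_ (sym (fB S)) (sym (cut-split S))) (strict S _ _ refl refl)
                        ⊕ ℕₚ.≤-reflexive (exchange (S (α e₀)) (S (β e₀))))
        (lemma (massA S f) (massB S f) (cut c α β S) (𝟙 (S (α e₀))) (𝟙 (S (β e₀))) _ _)
        where
        S = lookup X
        lemma : ∀ x y c a b s z → x + (y + b + (c + z) + (a + s)) + 0 ≡ y + c + (x + a + s + (b + z))
        lemma = solve-∀
      flowing : ∃ λ F → (∀ e → F e ≡ true → c e ≡ true) × (∀ v → d F v ≡ f v)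
      flowing = factor c f total cond
      F : Edge G → Bool
      F = proj₁ flowing
      M : Edge G → Bool
      M e = F e ∨ e == e₀
      M-split : ∀ f b x → (f ≡ true → not b ≡ true) → 𝟙 (f ∨ b) * x ≡ 𝟙 f * x + x * 𝟙 b
      M-split true  true  x disjoint = ⊥-elim (true≢false (disjoint refl) refl)
      M-split true  false x _ = sym (trans (cong (1 * x +_) (ℕₚ.*-zeroʳ x)) (ℕₚ.+-identityʳ (1 * x)))
      M-split false b     x _ = ℕₚ.*-comm (𝟙 b) x
      M-perfect : ∀ v → d M v ≡ 1
      M-perfect v = trans (sum-cong λ e → M-split (F e) (e == e₀) (𝟙 (α e == v) + 𝟙 (β e == v)) (proj₁ (proj₂ flowing) e))
        (trans (sum-+ _ _) (trans (cong₂ _+_ (proj₂ (proj₂ flowing) v) (sum-δ (λ e → 𝟙 (α e == v) + 𝟙 (β e == v)) e₀)) (f-split v)))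

    covered : ∀ e₀ → ∃ λ M → IsPerfectMatching G M × e₀ ∈ M
    covered e₀ = tabulate M , (λ v → trans (d-tabulate M v) (M-perfect v)) ,
      lookup⇒∈ (trans (lookup∘tabulate M e₀) (trans (cong (F e₀ ∨_) (==-refl e₀)) (∨-zeroʳ (F e₀))))
      where open Cover e₀

    -- For `a ≡ b` the value there would be 5, so `a ≢ b` is assumed wherever λ-matchings are
    -- compared with this function.
    λdeg : Vertex G → Vertex G → Vertex G → ℕ
    λdeg a b v = 1 + 2 * (𝟙 (a == v) + 𝟙 (b == v))

    λ⇒deg : ∀ {a b M} → a ≢ b → IsλMatching G a b M → ∀ v → d (lookup M) v ≡ λdeg a b v
    λ⇒deg {a} {b} {M} a≢b (da , db , rest) v = trans (sym (degree-d M v)) (aux (a ≟ v) (b ≟ v))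
      where
      aux : (p : Dec (a ≡ v)) (q : Dec (b ≡ v)) → degree M v ≡ 1 + 2 * (𝟙 (does p) + 𝟙 (does q))
      aux (yes refl) (yes refl) = contradiction refl a≢b
      aux (yes refl) (no _)     = da
      aux (no _)     (yes refl) = db
      aux (no a≢v)   (no b≢v)   = rest v [ a≢v ∘ sym , b≢v ∘ sym ]′

    deg⇒λ : ∀ {a b F} → a ≢ b → (∀ v → d F v ≡ λdeg a b v) → IsλMatching G a b (tabulate F)
    deg⇒λ {a} {b} {F} a≢b F-deg = at a (trans (F-deg a) (cong₂ (λ p q → 1 + 2 * (𝟙 p + 𝟙 q)) (==-refl a) (≢⇒== (a≢b ∘ sym)))) ,
      at b (trans (F-deg b) (cong₂ (λ p q → 1 + 2 * (𝟙 p + 𝟙 q)) (≢⇒== a≢b) (==-refl b))) ,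
      λ v v∉ → at v (trans (F-deg v) (cong₂ (λ p q → 1 + 2 * (𝟙 p + 𝟙 q)) (≢⇒== (v∉ ∘ inj₁ ∘ sym)) (≢⇒== (v∉ ∘ inj₂ ∘ sym))))
      where
      at : ∀ v {k} → d F v ≡ k → degree (tabulate F) v ≡ k
      at v = trans (d-tabulate F v)

    λ-massA : ∀ S {a b} → lookup A a ≡ true → lookup A b ≡ false → massA S (λdeg a b) ≡ numA S + 2 * 𝟙 (S a)
    λ-massA S {a} {b} a∈A b∉A = trans (massA-+ S (λ _ → 1) _) (cong (numA S +_) (trans (massA-* S 2 _)
      (cong (2 *_) (trans (massA-+ S _ _) (trans (cong₂ _+_ (massA-δ S a∈A) (massA-δ-0 S b∉A)) (ℕₚ.+-identityʳ _))))))

    λ-massB : ∀ S {a b} → lookup A a ≡ true → lookup A b ≡ false → massB S (λdeg a b) ≡ numB S + 2 * 𝟙 (S b)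
    λ-massB S {a} {b} a∈A b∉A = trans (massB-+ S (λ _ → 1) _) (cong (numB S +_) (trans (massB-* S 2 _)
      (cong (2 *_) (trans (massB-+ S _ _) (cong₂ _+_ (massB-δ-0 S a∈A) (massB-δ S b∉A))))))

    λ-balance : ∀ {a b M} → lookup A a ≡ true → lookup A b ≡ false → IsλMatching G a b M → ∀ S →
      numA S + 2 * 𝟙 (S a) + into (lookup M) S ≡ numB S + 2 * 𝟙 (S b) + out (lookup M) S
    λ-balance {a} {b} {M} a∈A b∉A m S = let eqA , eqB = mass-cong S (λ⇒deg {M = M} (λ { refl → true≢false a∈A b∉A }) m) in
      trans (cong (_+ into (lookup M) S) (sym (trans eqA (λ-massA S a∈A b∉A))))
        (trans (balance (lookup M) S) (cong (_+ out (lookup M) S) (trans eqB (λ-massB S a∈A b∉A))))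

    -- Otherwise the degrees of a λ-matching would add up to more on one side.
    λ-opposite : ∀ {a b M} → IsλMatching G a b M → lookup A b ≡ not (lookup A a)
    λ-opposite {a} {b} {M} m@(da , _ , rest) = aux _ _ refl refl
      where
      total : massA all (d (lookup M)) ≡ massB all (d (lookup M))
      total = ℕₚ.+-cancelʳ-≡ 0 _ _ (trans (cong (massA all (d (lookup M)) +_) (sym (into-all (lookup M))))
        (trans (balance (lookup M) all) (cong (massB all (d (lookup M)) +_) (out-all (lookup M)))))
      -- The disjunction also covers `a ≡ b`, which is not excluded at this point: `λ-≢` is itself
      -- derived from this lemma.
      excess : Vertex G → ℕ
      excess v = 𝟙 (a == v ∨ b == v)
      deg : ∀ v → d (lookup M) v ≡ 1 + 2 * excess v
      deg v = trans (sym (degree-d M v)) (go (a ≟ v) (b ≟ v))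
        where
        go : (p : Dec (a ≡ v)) (q : Dec (b ≡ v)) → degree M v ≡ 1 + 2 * 𝟙 (does p ∨ does q)
        go (yes refl) _          = da
        go (no _)     (yes refl) = proj₁ (proj₂ m)
        go (no a≢v)   (no b≢v)   = rest v [ a≢v ∘ sym , b≢v ∘ sym ]′
      excess-balanced : massA all excess ≡ massB all excess
      excess-balanced = ℕₚ.*-cancelˡ-≡ _ _ 2 (ℕₚ.+-cancelˡ-≡ (numA all) _ _ (trans
        (sym (trans (proj₁ (mass-cong all deg)) (trans (massA-+ all (λ _ → 1) _) (cong (numA all +_) (massA-* all 2 excess)))))
        (trans total (trans (proj₂ (mass-cong all deg)) (trans (massB-+ all (λ _ → 1) _)
          (cong₂ _+_ (sym balanced) (massB-* all 2 excess)))))))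
      excess-a : excess a ≡ 1
      excess-a = cong (λ p → 𝟙 (p ∨ b == a)) (==-refl a)
      excess-elsewhere : ∀ v → a ≢ v → b ≢ v → excess v ≡ 0
      excess-elsewhere v a≢v b≢v = cong₂ (λ p q → 𝟙 (p ∨ q)) (≢⇒== a≢v) (≢⇒== b≢v)
      zeroB : lookup A a ≡ true → lookup A b ≡ true → massB all excess ≡ 0
      zeroB p q = sum-0 λ v → go v (lookup A v) refl
        where
        go : ∀ v t → lookup A v ≡ t → 𝟙 (not (lookup A v)) * excess v ≡ 0
        go v true  eq = cong (λ t → 𝟙 (not t) * excess v) eq
        go v false eq = trans (cong (𝟙 (not (lookup A v)) *_) (excess-elsewhere v
          (λ { refl → true≢false p eq }) (λ { refl → true≢false q eq }))) (ℕₚ.*-zeroʳ (𝟙 (not (lookup A v))))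
      zeroA : lookup A a ≡ false → lookup A b ≡ false → massA all excess ≡ 0
      zeroA p q = sum-0 λ v → go v (lookup A v) refl
        where
        go : ∀ v t → lookup A v ≡ t → 𝟙 (lookup A v) * excess v ≡ 0
        go v false eq = cong (λ t → 𝟙 t * excess v) eq
        go v true  eq = trans (cong (𝟙 (lookup A v) *_) (excess-elsewhere v
          (λ { refl → true≢false eq p }) (λ { refl → true≢false eq q }))) (ℕₚ.*-zeroʳ (𝟙 (lookup A v)))
      aux : ∀ s t → lookup A a ≡ s → lookup A b ≡ t → lookup A b ≡ not (lookup A a)
      aux true  false p q = trans q (cong not (sym p))
      aux false true  p q = trans q (cong not (sym p))
      aux true true p q = ⊥-elim (ℕₚ.1+n≢0 (trans (sym (cong₂ (λ t x → 𝟙 t * x) p excess-a))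
        (sum≡0 (λ v → 𝟙 (lookup A v) * excess v) (trans excess-balanced (zeroB p q)) a)))
      aux false false p q = ⊥-elim (ℕₚ.1+n≢0 (trans (sym (cong₂ (λ t x → 𝟙 (not t) * x) p excess-a))
        (sum≡0 (λ v → 𝟙 (not (lookup A v)) * excess v) (trans (sym excess-balanced) (zeroA p q)) a)))

    Barrier : Vertex G → Vertex G → Subset (order G) → Set
    Barrier a b X = a ∈ X × b ∉ X × out all (lookup X) ≡ 0 × into all (lookup X) ≡ 3

    -- Only sets with `a` inside and `b` outside need more than `numA≤`. For these the supply
    -- condition, multiplied by 3, reads `6 ≤ 2 * out + into`, and integrality lowers the 6 to 4. As
    -- `out + into ≥ 3`, this fails only for `out = 0` and `into = 3`, that is for a barrier.
    λ-exists : EdgeConnected G → ∀ {a b} → lookup A a ≡ true → lookup A b ≡ false →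
               (∀ X → ¬ Barrier a b X) → ∃ (IsλMatching G a b)
    λ-exists ec {a} {b} a∈A b∉A no-barrier =
      let F , _ , F-deg = factor all (λdeg a b) total cond in tabulate F , deg⇒λ (λ { refl → true≢false a∈A b∉A }) F-deg
      where
      total : massA all (λdeg a b) ≡ massB all (λdeg a b)
      total = trans (λ-massA all a∈A b∉A) (trans (cong (_+ 2) balanced) (sym (λ-massB all a∈A b∉A)))
      cut≡ : ∀ S → cut all α β S ≡ out all S
      cut≡ S = sum-cong λ e → sym (ℕₚ.*-identityˡ _)
      key : ∀ X → a ∈ X → b ∉ X → 4 ≤ 2 * out all (lookup X) + into all (lookup X)
      key X a∈X b∉X = go (out all (lookup X)) (into all (lookup X)) refl refl (subst (3 ≤_) (∣∂X∣ X) (ec X a∈X b∉X))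
        where
        go : ∀ o r → out all (lookup X) ≡ o → into all (lookup X) ≡ r → 3 ≤ o + r → 4 ≤ 2 * o + r
        go zero    r p q 3≤r = ℕₚ.≤∧≢⇒< 3≤r λ 3≡r → no-barrier X (a∈X , b∉X , p , trans q (sym 3≡r))
        go (suc o) r p q 3≤  = by-≤ o 3≤ (lemma o r)
          where
          lemma : ∀ o r → 4 + (suc o + r) + o ≡ 2 * suc o + r + 3
          lemma = solve-∀
      cond′ : ∀ X s t → lookup X a ≡ s → lookup X b ≡ t →
              numA (lookup X) + 2 * 𝟙 s ≤ numB (lookup X) + 2 * 𝟙 t + out all (lookup X)
      cond′ X false t p q = by-≤ (2 * 𝟙 t) (numA≤ (lookup X)) (lemma (numA (lookup X)) (numB (lookup X)) (𝟙 t) (out all (lookup X)))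
        where
        lemma : ∀ x y t o → x + 0 + (y + o) + 2 * t ≡ y + 2 * t + o + x
        lemma = solve-∀
      cond′ X true true p q = by-≤ 0 (numA≤ (lookup X)) (lemma (numA (lookup X)) (numB (lookup X)) (out all (lookup X)))
        where
        lemma : ∀ x y o → x + 2 + (y + o) + 0 ≡ y + 2 + o + x
        lemma = solve-∀
      cond′ X true false p q = div3 _ _ (by-≤ 0 (ℕₚ.≤-reflexive (cubic-balance (lookup X)) ⊕ key X (lookup⇒∈ p) (lookup⇒∉ q))
        (lemma (numA (lookup X)) (numB (lookup X)) (out all (lookup X)) (into all (lookup X))))
        where
        lemma : ∀ x y o r → 3 * (x + 2) + (3 * y + o + (2 * o + r)) + 0 ≡ 3 * (y + 0 + o) + 2 + (3 * x + r + 4)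
        lemma = solve-∀
      cond : ∀ X → massA (lookup X) (λdeg a b) ≤ massB (lookup X) (λdeg a b) + cut all α β (lookup X)
      cond X = subst₂ _≤_ (sym (λ-massA (lookup X) a∈A b∉A))
        (sym (cong₂ _+_ (λ-massB (lookup X) a∈A b∉A) (cut≡ (lookup X)))) (cond′ X _ _ refl refl)

    -- The edge `e` itself leaves every set that contains `α e` but not `β e`, so no such set is a
    -- barrier.
    λ-adjacent : EdgeConnected G → ∀ e → ∃ (IsλMatching G (α e) (β e))
    λ-adjacent ec e = λ-exists ec (α∈A e) (β∉A e) λ X (α∈X , β∉X , o≡0 , _) →
      ℕₚ.1+n≢0 (trans (sym (cong₂ (λ a b → 1 * 𝟙 (a ∧ not b)) (∈⇒lookup α∈X) (∉⇒lookup β∉X)))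
        (sum≡0 (λ e → 1 * 𝟙 (lookup X (α e) ∧ not (lookup X (β e)))) o≡0 e))

    out-mono : ∀ F S → out F S ≤ out all S
    out-mono F S = sum-mono λ e → ℕₚ.*-monoˡ-≤ (𝟙 (S (α e) ∧ not (S (β e)))) (𝟙≤1 (F e))

    into-mono : ∀ F S → into F S ≤ into all S
    into-mono F S = sum-mono λ e → ℕₚ.*-monoˡ-≤ (𝟙 (not (S (α e)) ∧ S (β e))) (𝟙≤1 (F e))

    perfect : ∀ {M} → IsPerfectMatching G M → ∀ v → d (lookup M) v ≡ 1
    perfect {M} M-perfect v = trans (sym (degree-d M v)) (M-perfect v)

    data ThreeCut (S : Vertex G → Bool) : Set where
      outward : out all S ≡ 3 → into all S ≡ 0 → ThreeCut S
      inward  : out all S ≡ 0 → into all S ≡ 3 → ThreeCut S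

    outward-num : ∀ S → out all S ≡ 3 → into all S ≡ 0 → numA S ≡ suc (numB S)
    outward-num S o r = ℕₚ.*-cancelˡ-≡ _ _ 3 (trans (sym (ℕₚ.+-identityʳ (3 * numA S)))
      (trans (subst₂ (λ o r → 3 * numA S + r ≡ 3 * numB S + o) o r (cubic-balance S)) (lemma (numB S))))
      where
      lemma : ∀ y → 3 * y + 3 ≡ 3 * suc y
      lemma = solve-∀

    inward-num : ∀ S → out all S ≡ 0 → into all S ≡ 3 → numB S ≡ suc (numA S)
    inward-num S o r = ℕₚ.*-cancelˡ-≡ _ _ 3 (trans (sym (ℕₚ.+-identityʳ (3 * numB S)))
      (trans (sym (subst₂ (λ o r → 3 * numA S + r ≡ 3 * numB S + o) o r (cubic-balance S))) (lemma (numA S))))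
      where
      lemma : ∀ y → 3 * y + 3 ≡ 3 * suc y
      lemma = solve-∀

    -- One colour class of the shore exceeds the other by 1, and a perfect matching can make up for
    -- this only with cut edges, which all have the same direction.
    threeCut⇒tight : ∀ X → ThreeCut (lookup X) → Tight G X
    threeCut⇒tight X (outward o r) M M-perfect = trans (cut-size X M) (trans (cong (out (lookup M) S +_) no-into)
      (ℕₚ.+-cancelˡ-≡ (numB S) _ _ (trans (cong (numB S +_) (ℕₚ.+-identityʳ _)) (trans (sym (perfect-balance (lookup M) (perfect {M} M-perfect) S))
        (trans (cong₂ _+_ (outward-num S o r) no-into) (lemma (numB S)))))))
      where
      S = lookup X
      no-into = ℕₚ.n≤0⇒n≡0 (subst (into (lookup M) S ≤_) r (into-mono (lookup M) S))
      lemma : ∀ y → suc y + 0 ≡ y + 1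
      lemma = solve-∀
    threeCut⇒tight X (inward o r) M M-perfect = trans (cut-size X M) (trans (cong (_+ into (lookup M) S) no-out)
      (ℕₚ.+-cancelˡ-≡ (numA S) _ _ (trans (perfect-balance (lookup M) (perfect {M} M-perfect) S)
        (trans (cong₂ _+_ (inward-num S o r) no-out) (lemma (numA S))))))
      where
      S = lookup X
      no-out = ℕₚ.n≤0⇒n≡0 (subst (out (lookup M) S ≤_) o (out-mono (lookup M) S))
      lemma : ∀ y → suc y + 0 ≡ y + 1
      lemma = solve-∀

    private
      positive : ∀ {n} → 0 < 1 * n → 0 < n
      positive {n} = subst (0 <_) (ℕₚ.*-identityˡ n)

    crossing-out : ∀ S → 0 < out all S → ∃ λ e → S (α e) ≡ true × S (β e) ≡ false
    crossing-out S 0<o = let e , 0<e = 0<sum _ 0<o ; p , q = ∧-true (1≤𝟙 (positive 0<e)) in e , p , not-true q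

    crossing-into : ∀ S → 0 < into all S → ∃ λ e → S (α e) ≡ false × S (β e) ≡ true
    crossing-into S 0<r = let e , 0<e = 0<sum _ 0<r ; p , q = ∧-true (1≤𝟙 (positive 0<e)) in e , not-true p , q

    crosses-out : ∀ {F} S {e} → F e ≡ true → S (α e) ≡ true → S (β e) ≡ false → 0 < out F S
    crosses-out {F} S {e} f p q = ℕₚ.≤-trans
      (ℕₚ.≤-reflexive (sym (trans (cong (λ f → 𝟙 f * _) f) (cong₂ (λ a b → 1 * 𝟙 (a ∧ not b)) p q))))
      (term≤sum (λ e → 𝟙 (F e) * 𝟙 (S (α e) ∧ not (S (β e)))) e)

    crosses-into : ∀ {F} S {e} → F e ≡ true → S (α e) ≡ false → S (β e) ≡ true → 0 < into F S
    crosses-into {F} S {e} f p q = ℕₚ.≤-trans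
      (ℕₚ.≤-reflexive (sym (trans (cong (λ f → 𝟙 f * _) f) (cong₂ (λ a b → 1 * 𝟙 (not a ∧ b)) p q))))
      (term≤sum (λ e → 𝟙 (F e) * 𝟙 (not (S (α e)) ∧ S (β e))) e)

    edgeAt : ∀ v → ∃ λ e → v ≡ α e ⊎ v ≡ β e
    edgeAt v with 0<sum _ (subst (0 <_) (sym (d-all v)) (s≤s z≤n))
    ... | e , 0<e = e , aux (α e ≟ v) (β e ≟ v) 0<e
      where
      aux : (p : Dec (α e ≡ v)) (q : Dec (β e ≡ v)) → 0 < 1 * (𝟙 (does p) + 𝟙 (does q)) → v ≡ α e ⊎ v ≡ β e
      aux (yes p) _       _ = inj₁ (sym p)
      aux (no _)  (yes q) _ = inj₂ (sym q)

    -- A perfect matching through a second kind of cut edge would give the other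
    -- sign to the difference between the colour classes of X.
    tight⇒threeCut : ∀ X {x} → x ∈ X → Tight G X → ThreeCut (lookup X)
    tight⇒threeCut X {x} _ tight =
      let M , M-perfect , _ = covered (proj₁ (edgeAt x))
      in go M M-perfect _ _ refl refl (trans (sym (cut-size X M)) (tight M M-perfect))
      where
      S = lookup X
      absurd : ∀ {x y o r} → x ≡ suc y → x + r ≡ y + o → o + r ≡ 1 → 0 < r → ⊥
      absurd {x} {y} {o} {r} x≡ balanced o+r≡1 0<r = by-⊥ 1
        (ℕₚ.≤-reflexive balanced ⊕ ℕₚ.≤-reflexive (sym x≡) ⊕ ℕₚ.≤-reflexive o+r≡1 ⊕ 0<r ⊕ 0<r) (lemma x y o r)
        where
        lemma : ∀ x y o r → x + r + (suc y + (o + r + (1 + 1))) ≡ suc (1 + (y + o + (x + (1 + (r + r)))))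
        lemma = solve-∀
      three : ∀ {x y o r} → x ≡ suc y → 3 * x + r ≡ 3 * y + o → r ≡ 0 → o ≡ 3
      three {y = y} {o} refl balanced refl = ℕₚ.+-cancelˡ-≡ (3 * y) o 3 (trans (sym balanced) (lemma y))
        where
        lemma : ∀ y → 3 * suc y + 0 ≡ 3 * y + 3
        lemma = solve-∀
      go : ∀ M → IsPerfectMatching G M → ∀ o r → out (lookup M) S ≡ o → into (lookup M) S ≡ r → o + r ≡ 1 → ThreeCut S
      go M M-perfect (suc zero) zero p q _ = outward (three x≡ (cubic-balance S) r≡0) r≡0
        where
        x≡ : numA S ≡ suc (numB S)
        x≡ = trans (sym (ℕₚ.+-identityʳ _)) (trans (subst₂ (λ o r → numA S + r ≡ numB S + o) p q (perfect-balance (lookup M) (perfect {M} M-perfect) S))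
          (ℕₚ.+-comm (numB S) 1))
        r≡0 : into all S ≡ 0
        r≡0 = ℕₚ.n≤0⇒n≡0 (ℕₚ.≮⇒≥ λ 0<r → let e , eα , eβ = crossing-into S 0<r ; M′ , pm , e∈ = covered e in
          absurd x≡ (perfect-balance (lookup M′) (perfect {M′} pm) S) (trans (sym (cut-size X M′)) (tight M′ pm))
                 (crosses-into {lookup M′} S (∈⇒lookup e∈) eα eβ))
      go M M-perfect zero (suc zero) p q _ = inward o≡0 (three y≡ (sym (cubic-balance S)) o≡0)
        where
        y≡ : numB S ≡ suc (numA S)
        y≡ = trans (sym (ℕₚ.+-identityʳ _)) (trans (sym (subst₂ (λ o r → numA S + r ≡ numB S + o) p q (perfect-balance (lookup M) (perfect {M} M-perfect) S)))
          (ℕₚ.+-comm (numA S) 1))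
        o≡0 : out all S ≡ 0
        o≡0 = ℕₚ.n≤0⇒n≡0 (ℕₚ.≮⇒≥ λ 0<o → let e , eα , eβ = crossing-out S 0<o ; M′ , pm , e∈ = covered e in
          absurd y≡ (sym (perfect-balance (lookup M′) (perfect {M′} pm) S))
                 (trans (ℕₚ.+-comm (into (lookup M′) S) _) (trans (sym (cut-size X M′)) (tight M′ pm)))
                 (crosses-out {lookup M′} S (∈⇒lookup e∈) eα eβ))

    -- An entering edge provides the second vertex of each shore: its B-end lies with `a`, its A-end
    -- with `b`.
    barrier⇒nontrivial : ∀ {a b X} → lookup A a ≡ true → lookup A b ≡ false → Barrier a b X → NontrivialTight G X
    barrier⇒nontrivial {a} {b} {X} a∈A b∉A (a∈X , b∉X , o , r) =
      let e , αe∉X , βe∈X = crossing-into (lookup X) (subst (0 <_) (sym r) (s≤s z≤n)) in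
      2≤∣∣ (λ a≡β → true≢false a∈A (trans (cong (lookup A) a≡β) (β∉A e))) a∈X (lookup⇒∈ βe∈X) ,
      2≤∣∣ (λ b≡α → true≢false (α∈A e) (trans (cong (lookup A) (sym b≡α)) b∉A)) (x∉p⇒x∈∁p b∉X) (x∉p⇒x∈∁p (lookup⇒∉ αe∉X)) ,
      threeCut⇒tight X (inward o r)

    λ-all : EdgeConnected G → TightCutFree G → ∀ {a b} → lookup A a ≡ true → lookup A b ≡ false → ∃ (IsλMatching G a b)
    λ-all ec tcf a∈A b∉A = λ-exists ec a∈A b∉A λ X barrier → tcf X (barrier⇒nontrivial a∈A b∉A barrier)

    Ends : Edge G → Vertex G → Set
    Ends e v = α e ≡ v ⊎ β e ≡ v

    incidence : ∀ {e v} → Ends e v → 𝟙 (α e == v) + 𝟙 (β e == v) ≡ 1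
    incidence {e} (inj₁ refl) = cong₂ (λ a b → 𝟙 a + 𝟙 b) (==-refl (α e)) (≢⇒== (joins-≢ G (αβ-joins e) ∘ sym))
    incidence {e} (inj₂ refl) = cong₂ (λ a b → 𝟙 a + 𝟙 b) (≢⇒== (joins-≢ G (αβ-joins e))) (==-refl (β e))

    d≡1-exists : ∀ F v → d F v ≡ 1 → ∃ λ e → F e ≡ true × Ends e v
    d≡1-exists F v dF≡1 =
      let e , 0<e = 0<sum (λ e → 𝟙 (F e) * (𝟙 (α e == v) + 𝟙 (β e == v))) (subst (0 <_) (sym dF≡1) (s≤s z≤n))
      in e , aux (F e) (α e ≟ v) (β e ≟ v) 0<e
      where
      aux : ∀ {e} b (p : Dec (α e ≡ v)) (q : Dec (β e ≡ v)) → 0 < 𝟙 b * (𝟙 (does p) + 𝟙 (does q)) → b ≡ true × Ends e v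
      aux true (yes p) _       _ = refl , inj₁ p
      aux true (no _)  (yes q) _ = refl , inj₂ q

    d≡1-unique : ∀ F v → d F v ≡ 1 → ∀ {e e′} → Ends e v → Ends e′ v → F e ≡ true → F e′ ≡ true → e ≡ e′
    d≡1-unique F v dF≡1 {e} {e′} i i′ p p′ with e ≟ e′
    ... | yes e≡e′ = e≡e′
    ... | no e≢e′  = ⊥-elim (ℕₚ.<-irrefl refl (subst₂ _≤_
      (cong₂ _+_ (cong₂ (λ b n → 𝟙 b * n) p (incidence i)) (cong₂ (λ b n → 𝟙 b * n) p′ (incidence i′))) dF≡1
      (terms≤sum (λ e → 𝟙 (F e) * (𝟙 (α e == v) + 𝟙 (β e == v))) e≢e′)))

    d≡3-full : ∀ F v → d F v ≡ 3 → ∀ {e} → Ends e v → F e ≡ true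
    d≡3-full F v dF≡3 {e} i = aux (F e) (trans (cong (𝟙 (F e) *_) (sym (incidence i)))
      (trans (sum-mono-≡ (λ e → ℕₚ.*-monoˡ-≤ (𝟙 (α e == v) + 𝟙 (β e == v)) (𝟙≤1 (F e)))
        (ℕₚ.≤-reflexive (trans (d-all v) (sym dF≡3))) e) (cong (1 *_) (incidence i))))
      where
      aux : ∀ b → 𝟙 b * 1 ≡ 1 * 1 → b ≡ true
      aux true _ = refl

    λ-deg-elsewhere : ∀ {a b M v} → IsλMatching G a b M → a ≢ v → b ≢ v → d (lookup M) v ≡ 1
    λ-deg-elsewhere {M = M} {v} (_ , _ , rest) a≢v b≢v = trans (sym (degree-d M v)) (rest v [ a≢v ∘ sym , b≢v ∘ sym ]′)

    λ-≢ : ∀ {a b M} → IsλMatching G a b M → a ≢ b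
    λ-≢ {a} {b} {M} m refl = not-self (λ-opposite {a} {a} {M} m)

  -- Counting λ-matchable pairs

  opaque
    -- No bipartition occurs here, which makes `ρAt` visibly the same for all bipartitions. Opaque,
    -- so that the search through all edge sets is not unfolded.
    matchable : (G : Graph) → Vertex G → Vertex G → Bool
    matchable G a b = does (anySubset? (λMatching? G a b))

    matchable⇒ : ∀ {G a b} → matchable G a b ≡ true → ∃ (IsλMatching G a b)
    matchable⇒ {G} {a} {b} eq with anySubset? (λMatching? G a b)
    ... | yes m = m

    ⇒matchable : ∀ {G a b} → ∃ (IsλMatching G a b) → matchable G a b ≡ true
    ⇒matchable {G} {a} {b} m = dec-true (anySubset? (λMatching? G a b)) m

  matchable-sym : ∀ G a b → matchable G a b ≡ matchable G b a
  matchable-sym G a b = ≡-iff (λ p → let M , m = matchable⇒ p in ⇒matchable (M , λ-sym G {M = M} m))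
                              (λ p → let M , m = matchable⇒ p in ⇒matchable (M , λ-sym G {M = M} m))

  length-filter-tabulate : ∀ {a p} {S : Set a} {P : S → Set p} (P? : ∀ x → Dec (P x)) {n} (h : Fin n → S) →
    length (filter P? (List.tabulate h)) ≡ sum (λ i → 𝟙 (does (P? (h i))))
  length-filter-tabulate P? {zero}  h = sym (sum-zero _)
  length-filter-tabulate P? {suc n} h = trans (aux (does (P? (h zero))) refl) (sym (sum-suc _))
    where
    aux : ∀ b → does (P? (h zero)) ≡ b → length (filter P? (List.tabulate h)) ≡ 𝟙 b + sum (λ i → 𝟙 (does (P? (h (suc i)))))
    aux b eq with does (P? (h zero))
    aux .true  refl | true  = cong suc (length-filter-tabulate P? (h ∘ suc))
    aux .false refl | false = length-filter-tabulate P? (h ∘ suc)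

  length-filter-product : ∀ {a p} {S T : Set a} {P : S × T → Set p} (P? : ∀ x → Dec (P x)) {m n} (h : Fin m → S) (k : Fin n → T) →
    length (filter P? (cartesianProduct (List.tabulate h) (List.tabulate k))) ≡ sum (λ i → sum (λ j → 𝟙 (does (P? (h i , k j)))))
  length-filter-product P? {zero}  h k = sym (sum-zero _)
  length-filter-product P? {suc m} h k = begin
    length (filter P? (row ++ rest))
      ≡⟨ cong length (filter-++ P? row rest) ⟩
    length (filter P? row ++ filter P? rest)
      ≡⟨ length-++ (filter P? row) ⟩
    length (filter P? row) + length (filter P? rest)
      ≡⟨ cong₂ _+_ (trans (cong (length ∘ filter P?) (map-tabulate k (h zero ,_))) (length-filter-tabulate P? ((h zero ,_) ∘ k)))
                   (length-filter-product P? (h ∘ suc) k) ⟩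
    _ ≡⟨ sum-suc _ ⟨
    _ ∎
    where
    open ≡-Reasoning
    row  = List.map (h zero ,_) (List.tabulate k)
    rest = cartesianProduct (List.tabulate (h ∘ suc)) (List.tabulate k)

  module Counting (G : Graph) (A : Subset (order G)) (bip : IsBipartition G A) (cubic : Cubic G) where
    open CubicBipartite G A bip cubic

    matchable-opposite : ∀ {a b} → matchable G a b ≡ true → lookup A b ≡ not (lookup A a)
    matchable-opposite eq = let M , m = matchable⇒ eq in λ-opposite {M = M} m

    matchable-same : ∀ {a b c} → lookup A a ≡ c → lookup A b ≡ c → matchable G a b ≡ false
    matchable-same {a} {b} {c} p q = ≡false λ eq → not-self (trans (sym q) (trans (matchable-opposite eq) (cong not p)))

    row : Vertex G → ℕ
    row a = sum λ b → 𝟙 (matchable G a b)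

    λMatchable⇔ : ∀ a b → does (λMatchable? G A (a , b)) ≡ lookup A a ∧ matchable G a b
    λMatchable⇔ a b = ≡-iff to from
      where
      to : does (λMatchable? G A (a , b)) ≡ true → lookup A a ∧ matchable G a b ≡ true
      to eq = let a∈A , _ , m = does⇒ (λMatchable? G A (a , b)) eq in cong₂ _∧_ (∈⇒lookup a∈A) (⇒matchable m)
      from : lookup A a ∧ matchable G a b ≡ true → does (λMatchable? G A (a , b)) ≡ true
      from eq = let a∈A , m = ∧-true eq in
        dec-true (λMatchable? G A (a , b))
          (lookup⇒∈ a∈A , lookup⇒∉ (trans (matchable-opposite m) (cong not a∈A)) , matchable⇒ m)

    ρ-sum : ρ G A ≡ sum λ a → 𝟙 (lookup A a) * row a
    ρ-sum = trans (length-filter-product (λMatchable? G A) (λ x → x) (λ x → x))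
      (sum-cong λ a → trans (sum-cong λ b → trans (cong 𝟙 (λMatchable⇔ a b)) (𝟙-∧ (lookup A a) (matchable G a b)))
                            (sym (*-sumˡ (𝟙 (lookup A a)) _)))

    ρAt-sum : ∀ u → ρAt G A u ≡ row u
    ρAt-sum u = trans (length-filter-tabulate _ (λ x → x)) (sum-cong λ w → cong 𝟙 (≡-iff (to w) (from w)))
      where
      to : ∀ w → does (λMatchable? G A (u , w)) ∨ does (λMatchable? G A (w , u)) ≡ true → matchable G u w ≡ true
      to w eq with does⇒ (λMatchable? G A (u , w) ⊎-dec λMatchable? G A (w , u)) eq
      ... | inj₁ (_ , _ , m) = ⇒matchable m
      ... | inj₂ (_ , _ , m) = trans (matchable-sym G u w) (⇒matchable m)
      from : ∀ w → matchable G u w ≡ true → does (λMatchable? G A (u , w)) ∨ does (λMatchable? G A (w , u)) ≡ true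
      from w eq rewrite λMatchable⇔ u w | λMatchable⇔ w u | matchable-sym G w u | eq | matchable-opposite eq = aux (lookup A u)
        where
        aux : ∀ b → b ∧ true ∨ not b ∧ true ≡ true
        aux true  = refl
        aux false = refl

    AllMatchable : Set
    AllMatchable = ∀ {a b} → lookup A a ≡ true → lookup A b ≡ false → matchable G a b ≡ true

    row-all : AllMatchable → ∀ a → row a ≡ (if lookup A a then numB all else numA all)
    row-all am a = aux (lookup A a) refl
      where
      aux : ∀ c → lookup A a ≡ c → row a ≡ (if c then numB all else numA all)
      aux true  p = sum-cong λ b → trans (go (lookup A b) refl) (sym (ℕₚ.*-identityʳ _))
        where
        go : ∀ {b} c → lookup A b ≡ c → 𝟙 (matchable G a b) ≡ 𝟙 (not (lookup A b))
        go true  q = trans (cong 𝟙 (matchable-same p q)) (cong (𝟙 ∘ not) (sym q))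
        go false q = trans (cong 𝟙 (am p q)) (cong (𝟙 ∘ not) (sym q))
      aux false p = sum-cong λ b → trans (go (lookup A b) refl) (sym (ℕₚ.*-identityʳ _))
        where
        go : ∀ {b} c → lookup A b ≡ c → 𝟙 (matchable G a b) ≡ 𝟙 (lookup A b)
        go {b} true  q = trans (cong 𝟙 (trans (matchable-sym G a b) (am q p))) (cong 𝟙 (sym q))
        go false q = trans (cong 𝟙 (matchable-same p q)) (cong 𝟙 (sym q))

    ρAt-all : AllMatchable → ∀ a → ρAt G A a ≡ numA all
    ρAt-all am a = trans (ρAt-sum a) (trans (row-all am a) (aux (lookup A a)))
      where
      aux : ∀ c → (if c then numB all else numA all) ≡ numA all
      aux true  = sym balanced
      aux false = refl

    ρ-all : AllMatchable → ρ G A ≡ numA all * numA all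
    ρ-all am = trans ρ-sum (trans (sum-cong each) (sym (*-sumʳ (numA all) (λ a → 𝟙 (lookup A a) * 1))))
      where
      each : ∀ a → 𝟙 (lookup A a) * row a ≡ 𝟙 (lookup A a) * 1 * numA all
      each a = trans (cong (𝟙 (lookup A a) *_) (trans (sym (ρAt-sum a)) (ρAt-all am a)))
        (cong (_* numA all) (sym (ℕₚ.*-identityʳ (𝟙 (lookup A a)))))

    order≡ : order G ≡ numA all + numA all
    order≡ = trans (sym (trans (sum-const (order G) 1) (ℕₚ.*-identityʳ _)))
      (trans (sum-cong λ v → 𝟙-split (lookup A v) 1) (trans (sum-+ (λ v → 𝟙 (lookup A v) * 1) _) (cong (numA all +_) (sym balanced))))

  -- Contractions

  nonempty : ∀ {n} (X : Subset n) → 2 ≤ ∣ X ∣ → ∃ (_∈ X)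
  nonempty X 2≤X = let x , 0<x = 0<sum (𝟙 ∘ lookup X) (subst (0 <_) (∣∣-sum X) (ℕₚ.≤-trans (s≤s z≤n) 2≤X)) in
    x , lookup⇒∈ (1≤𝟙 0<x)

  ∣p∣+∣∁p∣ : ∀ {n} (p : Subset n) → ∣ p ∣ + ∣ ∁ p ∣ ≡ n
  ∣p∣+∣∁p∣ {n} p = trans (cong₂ _+_ (∣∣-sum p) (∣∣-sum (∁ p))) (trans (sym (sum-+ _ _)) (trans
    (sum-cong λ x → trans (cong (λ b → 𝟙 (lookup p x) + 𝟙 b) (lookup-∁ p x)) (𝟙-not (lookup p x)))
    (trans (sum-const n 1) (ℕₚ.*-identityʳ _))))

  -- G₁ arises from G by shrinking the complement of K to the vertex apex.
  record Contraction (G : Graph) (K : Subset (order G)) (G₁ : Graph) : Set where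
    field
      apex        : Vertex G₁
      f           : Vertex G → Vertex G₁
      f-outside   : ∀ {x} → lookup K x ≡ false → f x ≡ apex
      f-inside    : ∀ {x} → lookup K x ≡ true → f x ≢ apex
      f-injective : ∀ {x y} → lookup K x ≡ true → lookup K y ≡ true → f x ≡ f y → x ≡ y
      f-onto      : ∀ y → y ≢ apex → ∃ λ x → lookup K x ≡ true × f x ≡ y
      g           : Edge G₁ → Edge G
      g-injective : ∀ {e e′} → g e ≡ g e′ → e ≡ e′
      g-onto      : ∀ {e x y} → Graph.Joins G e x y → lookup K x ≡ true → ∃ λ e₁ → g e₁ ≡ e
      joins       : ∀ e₁ {x y} → Graph.Joins G (g e₁) x y → Graph.Joins G₁ e₁ (f x) (f y)

    f-apex : ∀ {x} → f x ≡ apex → lookup K x ≡ false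
    f-apex fx≡ = ≡false λ x∈K → f-inside x∈K fx≡

    not-outside : ∀ e₁ {x y} → Graph.Joins G (g e₁) x y → lookup K x ≡ false → lookup K y ≡ true
    not-outside e₁ {x} {y} j x∉K with lookup K y in y∉K
    ... | true  = refl
    ... | false = ⊥-elim (joins-≢ G₁ (joins e₁ j) (trans (f-outside x∉K) (sym (f-outside y∉K))))

    f-== : ∀ {x} → lookup K x ≡ true → ∀ y → f y == f x ≡ y == x
    f-== {x} x∈K y = ≡-iff (λ p → trans (cong (_== x) (back (==⇒≡ p))) (==-refl x))
                           (λ p → trans (cong (λ z → f z == f x) (==⇒≡ p)) (==-refl (f x)))
      where
      back : f y ≡ f x → y ≡ x
      back fy≡fx with lookup K y in eq
      ... | true  = f-injective eq x∈K fy≡fx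
      ... | false = ⊥-elim (f-inside x∈K (trans (sym fy≡fx) (f-outside eq)))

    f-==apex : ∀ x → f x == apex ≡ not (lookup K x)
    f-==apex x with lookup K x in eq
    ... | true  = ≢⇒== (f-inside eq)
    ... | false = trans (cong (_== apex) (f-outside eq)) (==-refl apex)

    -- The fibre of `f` within `K` is a single vertex over every vertex other than `apex`, and empty
    -- over `apex`.
    sum-vertices : ∀ h → sum h ≡ h apex + sum (λ x → 𝟙 (lookup K x) * h (f x))
    sum-vertices h = begin
      sum h
        ≡⟨ sum-cong (λ y → 𝟙-split (y == apex) (h y)) ⟩
      sum (λ y → 𝟙 (y == apex) * h y + 𝟙 (not (y == apex)) * h y)
        ≡⟨ sum-+ (λ y → 𝟙 (y == apex) * h y) _ ⟩
      sum (λ y → 𝟙 (y == apex) * h y) + sum (λ y → 𝟙 (not (y == apex)) * h y)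
        ≡⟨ cong₂ _+_ (trans (sum-cong λ y → ℕₚ.*-comm (𝟙 (y == apex)) (h y)) (sum-δ h apex))
                     (sum-cong λ y → cong (_* h y) (sym (fibre y (y ≟ apex)))) ⟩
      h apex + sum (λ y → sum (λ x → 𝟙 (lookup K x) * 𝟙 (f x == y)) * h y)
        ≡⟨ cong (h apex +_) (sum-push f (𝟙 ∘ lookup K) h) ⟨
      h apex + sum (λ x → 𝟙 (lookup K x) * h (f x)) ∎
      where
      open ≡-Reasoning
      fibre : ∀ y (p : Dec (y ≡ apex)) → sum (λ x → 𝟙 (lookup K x) * 𝟙 (f x == y)) ≡ 𝟙 (not (does p))
      fibre y (yes refl) = sum-0 λ x → trans (cong (λ b → 𝟙 (lookup K x) * 𝟙 b) (f-==apex x)) (aux (lookup K x))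
        where
        aux : ∀ b → 𝟙 b * 𝟙 (not b) ≡ 0
        aux true  = refl
        aux false = refl
      fibre y (no y≢apex) with f-onto y y≢apex
      ... | x₀ , x₀∈K , refl = trans (sum-cong λ x → cong (λ b → 𝟙 (lookup K x) * 𝟙 b) (f-== x₀∈K x))
                                     (trans (sum-δ (𝟙 ∘ lookup K) x₀) (cong 𝟙 x₀∈K))

    -- Every edge with an end in `K` is hit exactly once by `g`; on the edges with both ends
    -- outside, `h` vanishes by hypothesis.
    sum-edges : ∀ h → (∀ {e x y} → Graph.Joins G e x y → lookup K x ≡ false → lookup K y ≡ false → h e ≡ 0) →
                sum (h ∘ g) ≡ sum h
    sum-edges h vanishes = begin
      sum (h ∘ g)
        ≡⟨ sum-cong (λ e₁ → ℕₚ.*-identityˡ (h (g e₁))) ⟨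
      sum (λ e₁ → 1 * h (g e₁))
        ≡⟨ sum-push g (λ _ → 1) h ⟩
      sum (λ e → sum (λ e₁ → 1 * 𝟙 (g e₁ == e)) * h e)
        ≡⟨ sum-cong (λ e → at e _ _ refl refl) ⟩
      sum h ∎
      where
      open ≡-Reasoning
      hit : ∀ e → (∃ λ e₁ → g e₁ ≡ e) → sum (λ e₁ → 1 * 𝟙 (g e₁ == e)) * h e ≡ h e
      hit e (e₀ , refl) = trans (cong (_* h e) (trans (sum-cong λ e₁ → cong (λ b → 1 * 𝟙 b)
        (≡-iff {g e₁ == g e₀} {e₁ == e₀} (λ p → trans (cong (_== e₀) (g-injective (==⇒≡ p))) (==-refl e₀))
                      (λ p → trans (cong (λ z → g z == g e₀) (==⇒≡ p)) (==-refl (g e₀)))))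
        (sum-δ (λ _ → 1) e₀))) (ℕₚ.*-identityˡ (h e))
      at : ∀ e s t → lookup K (proj₁ (Graph.ends G e)) ≡ s → lookup K (proj₂ (Graph.ends G e)) ≡ t →
           sum (λ e₁ → 1 * 𝟙 (g e₁ == e)) * h e ≡ h e
      at e true  _     p q = hit e (g-onto (inj₁ refl) p)
      at e false true  p q = hit e (g-onto (inj₂ refl) q)
      at e false false p q = trans (cong (count *_) h≡0) (trans (ℕₚ.*-zeroʳ count) (sym h≡0))
        where
        count = sum (λ e₁ → 1 * 𝟙 (g e₁ == e))
        h≡0 = vanishes (inj₁ refl) p q

    order₁ : order G₁ ≡ suc ∣ K ∣
    order₁ = trans (sym (trans (sum-const (order G₁) 1) (ℕₚ.*-identityʳ _)))
      (trans (sum-vertices (λ _ → 1)) (cong suc (trans (sum-cong λ x → ℕₚ.*-identityʳ _) (sym (∣∣-sum K)))))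

  -- By `outer`, all ends of cut edges outside `K` have the colour `c`. So `apex` can be given this
  -- colour, and the contraction is again bipartite.
  module Contracted (G : Graph) (A : Subset (order G)) (bip : IsBipartition G A)
    {K : Subset (order G)} {G₁ : Graph} (C : Contraction G K G₁) (c : Bool)
    (outer : ∀ {e x y} → Graph.Joins G e x y → lookup K x ≡ true → lookup K y ≡ false → lookup A y ≡ c) where
    open Contraction C
    private module B = Bipartitioned G A bip

    private
      colour : ∀ y → Dec (y ≡ apex) → Bool
      colour y (yes _)     = c
      colour y (no y≢apex) = lookup A (proj₁ (f-onto y y≢apex))

    A₁ : Subset (order G₁)
    A₁ = tabulate λ y → colour y (y ≟ apex)

    A₁-apex : lookup A₁ apex ≡ c
    A₁-apex = trans (lookup∘tabulate _ apex) (aux (apex ≟ apex))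
      where
      aux : ∀ p → colour apex p ≡ c
      aux (yes _) = refl
      aux (no ≢)  = contradiction refl ≢

    A₁-f : ∀ {x} → lookup K x ≡ true → lookup A₁ (f x) ≡ lookup A x
    A₁-f {x} x∈K = trans (lookup∘tabulate _ (f x)) (aux (f x ≟ apex))
      where
      aux : ∀ p → colour (f x) p ≡ lookup A x
      aux (yes fx≡)  = contradiction fx≡ (f-inside x∈K)
      aux (no fx≢) = let x′ , x′∈K , fx′≡fx = f-onto (f x) fx≢ in cong (lookup A) (f-injective x′∈K x∈K fx′≡fx)

    A₁-edge : ∀ e₁ {x y} → Graph.Joins G (g e₁) x y → lookup A₁ (f x) ≡ lookup A x
    A₁-edge e₁ {x} {y} j = aux (lookup K x) refl
      where
      aux : ∀ s → lookup K x ≡ s → lookup A₁ (f x) ≡ lookup A x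
      aux true  x∈K = A₁-f x∈K
      aux false x∉K = trans (cong (lookup A₁) (f-outside x∉K)) (trans A₁-apex
        (sym (outer (joins-sym G j) (not-outside e₁ j x∉K) x∉K)))

    bip₁ : IsBipartition G₁ A₁
    bip₁ e₁ = lookup⇒∈ (trans (∂-joins G₁ (joins e₁ j) A₁) (trans
      (cong₂ _xor_ (A₁-edge e₁ j) (A₁-edge e₁ (joins-sym G j)))
      (cong₂ _xor_ (B.α∈A (g e₁)) (B.β∉A (g e₁)))))
      where
      j = B.αβ-joins (g e₁)

    module B₁ = Bipartitioned G₁ A₁ bip₁

    αβ₁ : ∀ e₁ → f (B.α (g e₁)) ≡ B₁.α e₁ × f (B.β (g e₁)) ≡ B₁.β e₁
    αβ₁ e₁ = B₁.α-unique (joins e₁ (B.αβ-joins (g e₁))) (trans (A₁-edge e₁ (B.αβ-joins (g e₁))) (B.α∈A (g e₁)))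

    d-cong : ∀ {F F′} → (∀ e → F e ≡ F′ e) → ∀ y → B₁.d F y ≡ B₁.d F′ y
    d-cong F≗F′ y = sum-cong λ e → cong (λ b → 𝟙 b * (𝟙 (B₁.α e == y) + 𝟙 (B₁.β e == y))) (F≗F′ e)

    d-inside : ∀ F {x} → lookup K x ≡ true → B₁.d (F ∘ g) (f x) ≡ B.d F x
    d-inside F {x} x∈K = begin
      B₁.d (F ∘ g) (f x)
        ≡⟨ sum-cong (λ e₁ → let p , q = αβ₁ e₁ in cong₂ (λ a b → 𝟙 (F (g e₁)) * (𝟙 a + 𝟙 b))
             (trans (cong (_== f x) (sym p)) (f-== x∈K _)) (trans (cong (_== f x) (sym q)) (f-== x∈K _))) ⟩
      sum (λ e₁ → incidence (g e₁))
        ≡⟨ sum-edges incidence vanishes ⟩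
      B.d F x ∎
      where
      open ≡-Reasoning
      incidence : Edge G → ℕ
      incidence e = 𝟙 (F e) * (𝟙 (B.α e == x) + 𝟙 (B.β e == x))
      misses : ∀ {y} → lookup K y ≡ false → y == x ≡ false
      misses {y} y∉K = ≢⇒== {x = y} {x} λ { refl → true≢false x∈K y∉K }
      vanishes : ∀ {e y z} → Graph.Joins G e y z → lookup K y ≡ false → lookup K z ≡ false → incidence e ≡ 0
      vanishes {e} j y∉K z∉K with joins-unique G j (B.αβ-joins e)
      ... | inj₁ (refl , refl) = trans (cong₂ (λ a b → 𝟙 (F e) * (𝟙 a + 𝟙 b)) (misses y∉K) (misses z∉K)) (ℕₚ.*-zeroʳ (𝟙 (F e)))
      ... | inj₂ (refl , refl) = trans (cong₂ (λ a b → 𝟙 (F e) * (𝟙 a + 𝟙 b)) (misses z∉K) (misses y∉K)) (ℕₚ.*-zeroʳ (𝟙 (F e)))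

    d-apex : ∀ F → B₁.d (F ∘ g) apex ≡ B.out F (lookup K) + B.into F (lookup K)
    d-apex F = begin
      B₁.d (F ∘ g) apex
        ≡⟨ sum-cong (λ e₁ → let p , q = αβ₁ e₁ in trans (cong₂ (λ a b → 𝟙 (F (g e₁)) * (𝟙 a + 𝟙 b))
             (trans (cong (_== apex) (sym p)) (f-==apex _)) (trans (cong (_== apex) (sym q)) (f-==apex _)))
             (cong (𝟙 (F (g e₁)) *_) (aux (lookup K (B.α (g e₁))) (lookup K (B.β (g e₁))) (not-outside e₁ (B.αβ-joins (g e₁)))))) ⟩
      sum (λ e₁ → crossing (g e₁))
        ≡⟨ sum-edges crossing vanishes ⟩
      sum crossing
        ≡⟨ sum-cong (λ e → ℕₚ.*-distribˡ-+ (𝟙 (F e)) (𝟙 (lookup K (B.α e) ∧ _)) _) ⟩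
      sum (λ e → 𝟙 (F e) * 𝟙 (lookup K (B.α e) ∧ not (lookup K (B.β e))) + 𝟙 (F e) * 𝟙 (not (lookup K (B.α e)) ∧ lookup K (B.β e)))
        ≡⟨ sum-+ _ _ ⟩
      B.out F (lookup K) + B.into F (lookup K) ∎
      where
      open ≡-Reasoning
      crossing : Edge G → ℕ
      crossing e = 𝟙 (F e) * (𝟙 (lookup K (B.α e) ∧ not (lookup K (B.β e))) + 𝟙 (not (lookup K (B.α e)) ∧ lookup K (B.β e)))
      aux : ∀ a b → (a ≡ false → b ≡ true) → 𝟙 (not a) + 𝟙 (not b) ≡ 𝟙 (a ∧ not b) + 𝟙 (not a ∧ b)
      aux true  true  _ = refl
      aux true  false _ = refl
      aux false true  _ = refl
      aux false false h with () ← h refl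
      vanishes : ∀ {e y z} → Graph.Joins G e y z → lookup K y ≡ false → lookup K z ≡ false → crossing e ≡ 0
      vanishes {e} j y∉K z∉K with joins-unique G j (B.αβ-joins e)
      ... | inj₁ (refl , refl) = trans (cong₂ (λ a b → 𝟙 (F e) * (𝟙 (a ∧ not b) + 𝟙 (not a ∧ b))) y∉K z∉K) (ℕₚ.*-zeroʳ (𝟙 (F e)))
      ... | inj₂ (refl , refl) = trans (cong₂ (λ a b → 𝟙 (F e) * (𝟙 (a ∧ not b) + 𝟙 (not a ∧ b))) z∉K y∉K) (ℕₚ.*-zeroʳ (𝟙 (F e)))

    everywhere : ∀ {P : Vertex G₁ → Set} → P apex → (∀ {x} → lookup K x ≡ true → P (f x)) → ∀ y → P y
    everywhere {P} p q y with y ≟ apex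
    ... | yes refl = p
    ... | no y≢    = let x , x∈K , fx≡y = f-onto y y≢ in subst P fx≡y (q x∈K)

    cubic₁ : Cubic G → B.out all (lookup K) + B.into all (lookup K) ≡ 3 → Cubic G₁
    cubic₁ cubic three = everywhere (trans (B₁.∣∂∣-d apex) (trans (d-apex all) three))
      λ {x} x∈K → trans (B₁.∣∂∣-d (f x)) (trans (d-inside all x∈K) (trans (sym (B.∣∂∣-d x)) (cubic x)))

    preimage : Subset (order G₁) → Subset (order G)
    preimage X = tabulate (lookup X ∘ f)

    ∣∂preimage∣ : ∀ X → ∣ Graph.∂ G₁ X ∣ ≡ ∣ Graph.∂ G (preimage X) ∣
    ∣∂preimage∣ X = begin
      ∣ Graph.∂ G₁ X ∣
        ≡⟨ ∣∣-sum (Graph.∂ G₁ X) ⟩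
      sum (𝟙 ∘ lookup (Graph.∂ G₁ X))
        ≡⟨ sum-cong (λ e₁ → cong 𝟙 (trans (∂-joins G₁ (joins e₁ (B.αβ-joins (g e₁))) X) (sym (pull (B.αβ-joins (g e₁)))))) ⟩
      sum (λ e₁ → 𝟙 (lookup (Graph.∂ G (preimage X)) (g e₁)))
        ≡⟨ sum-edges (𝟙 ∘ lookup (Graph.∂ G (preimage X))) (λ j y∉K z∉K → cong 𝟙 (trans (pull j)
             (trans (cong₂ (λ a b → lookup X a xor lookup X b) (f-outside y∉K) (f-outside z∉K)) (xor-self (lookup X apex))))) ⟩
      sum (𝟙 ∘ lookup (Graph.∂ G (preimage X)))
        ≡⟨ ∣∣-sum (Graph.∂ G (preimage X)) ⟨
      ∣ Graph.∂ G (preimage X) ∣ ∎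
      where
      open ≡-Reasoning
      xor-self : ∀ b → b xor b ≡ false
      xor-self true  = refl
      xor-self false = refl
      pull : ∀ {e x y} → Graph.Joins G e x y → lookup (Graph.∂ G (preimage X)) e ≡ lookup X (f x) xor lookup X (f y)
      pull {e} {x} {y} j = trans (∂-joins G j (preimage X)) (cong₂ _xor_ (lookup∘tabulate (lookup X ∘ f) x) (lookup∘tabulate (lookup X ∘ f) y))

    -- Cuts are pulled back along `f` with their size unchanged. A vertex outside `K` is required so
    -- that something lies over `apex` and the preimage is again nonempty and proper.
    edgeConnected₁ : EdgeConnected G → ∃ (λ x → lookup K x ≡ false) → EdgeConnected G₁
    edgeConnected₁ ec (z , z∉K) X {x} {y} x∈X y∉X = subst (3 ≤_) (sym (∣∂preimage∣ X))
      (ec (preimage X) {proj₁ (lift x)} {proj₁ (lift y)} (lookup⇒∈ (at x (∈⇒lookup x∈X))) (lookup⇒∉ (at y (∉⇒lookup y∉X))))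
      where
      lift : ∀ y → ∃ λ x → f x ≡ y
      lift = everywhere (z , f-outside z∉K) λ {x} _ → x , refl
      at : ∀ y {b} → lookup X y ≡ b → lookup (preimage X) (proj₁ (lift y)) ≡ b
      at y eq = trans (lookup∘tabulate (lookup X ∘ f) (proj₁ (lift y))) (trans (cong (lookup X) (proj₂ (lift y))) eq)

  -- λ-matchings across a cut of three edges

  Outer : (G : Graph) → Subset (order G) → Subset (order G) → Bool → Set
  Outer G A K c = ∀ {e x y} → Graph.Joins G e x y → lookup K x ≡ true → lookup K y ≡ false → lookup A y ≡ c

  -- The second shore is a set `K′` with a pointwise complement condition rather than `∁ K`, so that
  -- the module can be instantiated with the shores exchanged.
  module Glue (G : Graph) (A : Subset (order G)) (bip : IsBipartition G A) (cubic : Cubic G)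
    {K K′ : Subset (order G)} (compl : ∀ x → lookup K′ x ≡ not (lookup K x))
    {G₁ G₂ : Graph} (C₁ : Contraction G K G₁) (C₂ : Contraction G K′ G₂)
    {c₁ c₂ : Bool} (outer₁ : Outer G A K c₁) (outer₂ : Outer G A K′ c₂)
    (cubic₁ : Cubic G₁) (cubic₂ : Cubic G₂) where

    private
      module C₁ = Contraction C₁
      module C₂ = Contraction C₂
      module D₁ = Contracted G A bip C₁ c₁ outer₁
      module D₂ = Contracted G A bip C₂ c₂ outer₂
      module B  = CubicBipartite G A bip cubic
      module B₁ = CubicBipartite G₁ D₁.A₁ D₁.bip₁ cubic₁
      module B₂ = CubicBipartite G₂ D₂.A₁ D₂.bip₁ cubic₂

    inside′ : ∀ {x} → lookup K x ≡ false → lookup K′ x ≡ true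
    inside′ {x} x∉K = trans (compl x) (cong not x∉K)

    outside′ : ∀ {x} → lookup K x ≡ true → lookup K′ x ≡ false
    outside′ {x} x∈K = trans (compl x) (cong not x∈K)

    module _ (F₁ : Edge G₁ → Bool) (F₂ : Edge G₂ → Bool)
             (agree : ∀ e₁ e₂ → C₁.g e₁ ≡ C₂.g e₂ → F₁ e₁ ≡ F₂ e₂) where

      private
        choose : ∀ e → Dec (∃ λ e₁ → C₁.g e₁ ≡ e) → Dec (∃ λ e₂ → C₂.g e₂ ≡ e) → Bool
        choose e (yes (e₁ , _)) _              = F₁ e₁
        choose e (no _)         (yes (e₂ , _)) = F₂ e₂
        -- A default: every edge has an end in `K` or in `K′`, hence lies in the image of one of the
        -- two maps `g`.
        choose e (no _)         (no _)         = false

      glue : Edge G → Bool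
      glue e = choose e (any? λ e₁ → C₁.g e₁ ≟ e) (any? λ e₂ → C₂.g e₂ ≟ e)

      glue-g₁ : ∀ e₁ → glue (C₁.g e₁) ≡ F₁ e₁
      glue-g₁ e₁ = aux (any? λ e₁′ → C₁.g e₁′ ≟ C₁.g e₁) _
        where
        aux : ∀ p q → choose (C₁.g e₁) p q ≡ F₁ e₁
        aux (yes (e₁′ , eq)) _ = cong F₁ (C₁.g-injective eq)
        aux (no none)        _ = contradiction (e₁ , refl) none

      glue-g₂ : ∀ e₂ → glue (C₂.g e₂) ≡ F₂ e₂
      glue-g₂ e₂ = aux (any? λ e₁ → C₁.g e₁ ≟ C₂.g e₂) (any? λ e₂′ → C₂.g e₂′ ≟ C₂.g e₂)
        where
        aux : ∀ p q → choose (C₂.g e₂) p q ≡ F₂ e₂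
        aux (yes (e₁ , eq)) _                = agree e₁ e₂ eq
        aux (no _)          (yes (e₂′ , eq)) = cong F₂ (C₂.g-injective eq)
        aux (no _)          (no none)        = contradiction (e₂ , refl) none

      glue-d₁ : ∀ {x} → lookup K x ≡ true → B.d glue x ≡ B₁.d F₁ (C₁.f x)
      glue-d₁ {x} x∈K = trans (sym (D₁.d-inside glue x∈K)) (D₁.d-cong glue-g₁ (C₁.f x))

      glue-d₂ : ∀ {x} → lookup K x ≡ false → B.d glue x ≡ B₂.d F₂ (C₂.f x)
      glue-d₂ {x} x∉K = trans (sym (D₂.d-inside glue (inside′ x∉K))) (D₂.d-cong glue-g₂ (C₂.f x))

    -- An edge of both G₁ and G₂ is a cut edge.
    shared₁ : ∀ {e₁ e₂} → C₁.g e₁ ≡ C₂.g e₂ → B₁.Ends e₁ C₁.apex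
    shared₁ {e₁} {e₂} eq = aux _ _ refl refl
      where
      e = C₁.g e₁
      aux : ∀ a b → lookup K (B.α e) ≡ a → lookup K (B.β e) ≡ b → B₁.Ends e₁ C₁.apex
      aux false _     p q = inj₁ (trans (sym (proj₁ (D₁.αβ₁ e₁))) (C₁.f-outside p))
      aux true  false p q = inj₂ (trans (sym (proj₂ (D₁.αβ₁ e₁))) (C₁.f-outside q))
      aux true  true  p q = ⊥-elim (true≢false
        (C₂.not-outside e₂ (subst (λ e′ → Graph.Joins G e′ (B.α e) (B.β e)) eq (B.αβ-joins e)) (outside′ p)) (outside′ q))

    shared₂ : ∀ {e₁ e₂} → C₁.g e₁ ≡ C₂.g e₂ → B₂.Ends e₂ C₂.apex
    shared₂ {e₁} {e₂} eq = aux _ _ refl refl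
      where
      e = C₂.g e₂
      aux : ∀ a b → lookup K (B.α e) ≡ a → lookup K (B.β e) ≡ b → B₂.Ends e₂ C₂.apex
      aux true  _     p q = inj₁ (trans (sym (proj₁ (D₂.αβ₁ e₂))) (C₂.f-outside (outside′ p)))
      aux false true  p q = inj₂ (trans (sym (proj₂ (D₂.αβ₁ e₂))) (C₂.f-outside (outside′ q)))
      aux false false p q = ⊥-elim (true≢false
        (C₁.not-outside e₁ (subst (λ e′ → Graph.Joins G e′ (B.α e) (B.β e)) (sym eq) (B.αβ-joins e)) p) q)

    counterpart : ∀ {e₁} → B₁.Ends e₁ C₁.apex → ∃ λ e₂ → C₁.g e₁ ≡ C₂.g e₂
    counterpart {e₁} (inj₁ α≡) =
      let e₂ , eq = C₂.g-onto (B.αβ-joins (C₁.g e₁)) (inside′ (C₁.f-apex (trans (proj₁ (D₁.αβ₁ e₁)) α≡))) in e₂ , sym eq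
    counterpart {e₁} (inj₂ β≡) =
      let e₂ , eq = C₂.g-onto (joins-sym G (B.αβ-joins (C₁.g e₁))) (inside′ (C₁.f-apex (trans (proj₂ (D₁.αβ₁ e₁)) β≡))) in e₂ , sym eq

    cutSize : Subset (size G) → ℕ
    cutSize M = B.out (lookup M) (lookup K) + B.into (lookup M) (lookup K)

    λdeg-f : ∀ {a b x} → lookup K x ≡ true → B.λdeg a b x ≡ B₁.λdeg (C₁.f a) (C₁.f b) (C₁.f x)
    λdeg-f {a} {b} x∈K = cong₂ (λ p q → 1 + 2 * (𝟙 p + 𝟙 q)) (sym (C₁.f-== x∈K a)) (sym (C₁.f-== x∈K b))

    -- The hypothesis on `cutSize` is the degree condition at `apex`. It asks for 1 if `b` lies in
    -- `K`, and for 3 if `b` lies outside, where `C₁.f b` is `apex`.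
    restrict : ∀ {a b M} → lookup K a ≡ true → IsλMatching G a b M →
               cutSize M ≡ B₁.λdeg (C₁.f a) (C₁.f b) C₁.apex → ∃ (IsλMatching G₁ (C₁.f a) (C₁.f b))
    restrict {a} {b} {M} a∈K m size≡ = tabulate (lookup M ∘ C₁.g) ,
      B₁.deg⇒λ (λ fa≡fb → B.λ-≢ {M = M} m (sym (==⇒≡ (trans (sym (C₁.f-== a∈K b)) (trans (cong (_== C₁.f a) (sym fa≡fb)) (==-refl (C₁.f a)))))))
        (D₁.everywhere (trans (D₁.d-apex (lookup M)) size≡)
          λ x∈K → trans (D₁.d-inside (lookup M) x∈K) (trans (B.λ⇒deg {M = M} (B.λ-≢ {M = M} m) m _) (λdeg-f x∈K)))

    -- A λ-matching of `G₁` for two vertices of `K` has a single edge at `apex`. By `covered`, some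
    -- perfect matching of `G₂` contains the same cut edge, so the two agree on the whole cut.
    extend : ∀ {a b} → lookup K a ≡ true → lookup K b ≡ true →
             ∃ (IsλMatching G₁ (C₁.f a) (C₁.f b)) → ∃ (IsλMatching G a b)
    extend {a} {b} a∈K b∈K (M₁ , m₁) =
      let d₁≡1 = B₁.λ-deg-elsewhere {M = M₁} m₁ (C₁.f-inside a∈K) (C₁.f-inside b∈K)
          e₁ , e₁∈M₁ , e₁-ends = B₁.d≡1-exists (lookup M₁) C₁.apex d₁≡1
          e₂ , eq = counterpart e₁-ends
          M₂ , M₂-perfect , e₂∈M₂ = B₂.covered e₂
      in go d₁≡1 e₁ e₂ eq e₁∈M₁ M₂ (B₂.perfect {M₂} M₂-perfect) (∈⇒lookup e₂∈M₂)
      where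
      go : B₁.d (lookup M₁) C₁.apex ≡ 1 → ∀ e₁ e₂ → C₁.g e₁ ≡ C₂.g e₂ → lookup M₁ e₁ ≡ true →
           ∀ M₂ → (∀ v → B₂.d (lookup M₂) v ≡ 1) → lookup M₂ e₂ ≡ true → ∃ (IsλMatching G a b)
      go d₁≡1 e₁ e₂ eq e₁∈M₁ M₂ d₂≡1 e₂∈M₂ = tabulate F , B.deg⇒λ a≢b (λ x → at x (lookup K x) refl)
        where
        agree : ∀ e₁′ e₂′ → C₁.g e₁′ ≡ C₂.g e₂′ → lookup M₁ e₁′ ≡ lookup M₂ e₂′
        agree e₁′ e₂′ eq′ = ≡-iff
          (λ p → trans (cong (lookup M₂) (C₂.g-injective (trans (sym eq′) (trans (cong C₁.g
             (B₁.d≡1-unique (lookup M₁) C₁.apex d₁≡1 (shared₁ eq′) (shared₁ eq) p e₁∈M₁)) eq)))) e₂∈M₂)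
          (λ p → trans (cong (lookup M₁) (C₁.g-injective (trans eq′ (trans (cong C₂.g
             (B₂.d≡1-unique (lookup M₂) C₂.apex (d₂≡1 C₂.apex) (shared₂ eq′) (shared₂ eq) p e₂∈M₂)) (sym eq))))) e₁∈M₁)
        F = glue (lookup M₁) (lookup M₂) agree
        a≢b : a ≢ b
        a≢b refl = B₁.λ-≢ {M = M₁} m₁ refl
        at : ∀ x s → lookup K x ≡ s → B.d F x ≡ B.λdeg a b x
        at x true  p = trans (glue-d₁ _ _ agree p) (trans (B₁.λ⇒deg {M = M₁} (B₁.λ-≢ {M = M₁} m₁) m₁ (C₁.f x)) (sym (λdeg-f p)))
        at x false p = trans (glue-d₂ _ _ agree p) (trans (d₂≡1 (C₂.f x)) (sym (cong₂ (λ p q → 1 + 2 * (𝟙 p + 𝟙 q)) (miss a∈K) (miss b∈K))))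
          where
          miss : ∀ {z} → lookup K z ≡ true → z == x ≡ false
          miss {z} z∈K = ≢⇒== {x = z} {x} λ { refl → true≢false z∈K p }

    -- Both λ-matchings contain all edges at their apex, hence agree on the cut.
    extend₃ : ∀ {a b} → lookup K a ≡ true → lookup K b ≡ false →
              ∃ (IsλMatching G₁ (C₁.f a) C₁.apex) → ∃ (IsλMatching G₂ C₂.apex (C₂.f b)) → ∃ (IsλMatching G a b)
    extend₃ {a} {b} a∈K b∉K (M₁ , m₁) (M₂ , m₂) = tabulate F , B.deg⇒λ (λ { refl → true≢false a∈K b∉K }) (λ x → at x (lookup K x) refl)
      where
      agree : ∀ e₁ e₂ → C₁.g e₁ ≡ C₂.g e₂ → lookup M₁ e₁ ≡ lookup M₂ e₂
      agree e₁ e₂ eq = trans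
        (B₁.d≡3-full (lookup M₁) C₁.apex (trans (sym (B₁.degree-d M₁ C₁.apex)) (proj₁ (proj₂ m₁))) (shared₁ eq))
        (sym (B₂.d≡3-full (lookup M₂) C₂.apex (trans (sym (B₂.degree-d M₂ C₂.apex)) (proj₁ m₂)) (shared₂ eq)))
      F = glue (lookup M₁) (lookup M₂) agree
      at : ∀ x s → lookup K x ≡ s → B.d F x ≡ B.λdeg a b x
      at x true p = trans (glue-d₁ _ _ agree p) (trans (B₁.λ⇒deg {M = M₁} (B₁.λ-≢ {M = M₁} m₁) m₁ (C₁.f x))
        (cong₂ (λ p q → 1 + 2 * (𝟙 p + 𝟙 q)) (C₁.f-== p a)
          (trans (≢⇒== (C₁.f-inside p ∘ sym)) (sym (≢⇒== {x = b} {x} λ { refl → true≢false p b∉K })))))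
      at x false p = trans (glue-d₂ _ _ agree p) (trans (B₂.λ⇒deg {M = M₂} (B₂.λ-≢ {M = M₂} m₂) m₂ (C₂.f x))
        (cong₂ (λ p q → 1 + 2 * (𝟙 p + 𝟙 q))
          (trans (≢⇒== (C₂.f-inside (inside′ p) ∘ sym)) (sym (≢⇒== {x = a} {x} λ { refl → true≢false a∈K p })))
          (C₂.f-== (inside′ p) b)))

  -- The formula for ρ at a cut of three edges

  module Split (G : Graph) (A : Subset (order G)) (bip : IsBipartition G A) (cubic : Cubic G)
    {K : Subset (order G)} {G₁ G₂ : Graph} (C₁ : Contraction G K G₁) (C₂ : Contraction G (∁ K) G₂)
    (out≡3 : CubicBipartite.out G A bip cubic all (lookup K) ≡ 3)
    (into≡0 : CubicBipartite.into G A bip cubic all (lookup K) ≡ 0) where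

    private
      module C₁ = Contraction C₁
      module C₂ = Contraction C₂
      module B  = CubicBipartite G A bip cubic

    no-into : ∀ {e} → lookup K (B.α e) ≡ false → lookup K (B.β e) ≡ true → ⊥
    no-into p q = ℕₚ.<-irrefl (sym into≡0) (B.crosses-into {all} (lookup K) refl p q)

    -- No edge enters `K`, so the cut edges have their A-ends in `K` and their B-ends outside. Hence
    -- the apex of `G₁` counts as a vertex of B and the apex of `G₂` as a vertex of A.
    outer₁ : Outer G A K false
    outer₁ {e} {x} {y} j x∈K y∉K = ≡false λ y∈A → let y≡α , x≡β = B.α-unique (joins-sym G j) y∈A in
      no-into (trans (cong (lookup K) (sym y≡α)) y∉K) (trans (cong (lookup K) (sym x≡β)) x∈K)

    out-of-∁ : ∀ {x b} → lookup (∁ K) x ≡ b → lookup K x ≡ not b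
    out-of-∁ {x} eq = trans (sym (not-involutive _)) (cong not (trans (sym (lookup-∁ K x)) eq))

    outer₂ : Outer G A (∁ K) true
    outer₂ {e} {x} {y} j x∈∁K y∉∁K = aux (lookup A y) refl
      where
      aux : ∀ c → lookup A y ≡ c → lookup A y ≡ true
      aux true  eq = eq
      aux false eq = let x≡α , y≡β = B.α-unique j (trans (B.joins-colours (joins-sym G j)) (cong not eq)) in
        ⊥-elim (no-into (trans (cong (lookup K) (sym x≡α)) (out-of-∁ x∈∁K)) (trans (cong (lookup K) (sym y≡β)) (out-of-∁ y∉∁K)))

    module D₁ = Contracted G A bip C₁ false outer₁
    module D₂ = Contracted G A bip C₂ true outer₂

    cut-∁ : ∀ F → B.out F (lookup (∁ K)) + B.into F (lookup (∁ K)) ≡ B.out F (lookup K) + B.into F (lookup K)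
    cut-∁ F = trans (ℕₚ.+-comm (B.out F (lookup (∁ K))) _) (cong₂ _+_ (B.into-∁ F K) (B.out-∁ F K))

    cut≡3 : B.out all (lookup K) + B.into all (lookup K) ≡ 3
    cut≡3 = cong₂ _+_ out≡3 into≡0

    cubic₁ : Cubic G₁
    cubic₁ = D₁.cubic₁ cubic cut≡3

    cubic₂ : Cubic G₂
    cubic₂ = D₂.cubic₁ cubic (trans (cut-∁ all) cut≡3)

    private
      module G₁₂ = Glue G A bip cubic (lookup-∁ K) C₁ C₂ outer₁ outer₂ cubic₁ cubic₂
      module G₂₁ = Glue G A bip cubic {∁ K} {K} (λ x → sym (trans (cong not (lookup-∁ K x)) (not-involutive _))) C₂ C₁ outer₂ outer₁ cubic₂ cubic₁
      module N  = Counting G A bip cubic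
      module N₁ = Counting G₁ D₁.A₁ D₁.bip₁ cubic₁
      module N₂ = Counting G₂ D₂.A₁ D₂.bip₁ cubic₂

    in-∁ : ∀ {x} → lookup K x ≡ false → lookup (∁ K) x ≡ true
    in-∁ {x} x∉K = trans (lookup-∁ K x) (cong not x∉K)

    no-into-M : ∀ M → B.into (lookup M) (lookup K) ≡ 0
    no-into-M M = ℕₚ.n≤0⇒n≡0 (subst (B.into (lookup M) (lookup K) ≤_) into≡0 (B.into-mono (lookup M) (lookup K)))

    -- Since `K` has one vertex more in A than in B, `λ-balance` fixes the number of cut edges in
    -- `M`: it is 1 if `a` and `b` are in the same shore, 3 if only `a` is in `K`, and would be -1
    -- if only `b` is.
    cut-count : ∀ {a b s t M} → lookup A a ≡ true → lookup A b ≡ false → IsλMatching G a b M →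
                lookup K a ≡ s → lookup K b ≡ t →
                1 + 2 * 𝟙 s ≡ 2 * 𝟙 t + (B.out (lookup M) (lookup K) + B.into (lookup M) (lookup K))
    cut-count {a} {b} {M = M} a∈A b∉A m refl refl = ℕₚ.+-cancelˡ-≡ (B.numB S) _ _ (begin
      B.numB S + (1 + 2 * 𝟙 (S a))
        ≡⟨ lemma₁ (B.numB S) (2 * 𝟙 (S a)) ⟩
      suc (B.numB S) + 2 * 𝟙 (S a) + 0
        ≡⟨ cong₂ (λ n r → n + 2 * 𝟙 (S a) + r) (B.outward-num S out≡3 into≡0) (no-into-M M) ⟨
      B.numA S + 2 * 𝟙 (S a) + B.into (lookup M) S
        ≡⟨ B.λ-balance {M = M} a∈A b∉A m S ⟩
      B.numB S + 2 * 𝟙 (S b) + B.out (lookup M) S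
        ≡⟨ lemma₂ (B.numB S) (2 * 𝟙 (S b)) (B.out (lookup M) S) ⟩
      B.numB S + (2 * 𝟙 (S b) + (B.out (lookup M) S + 0))
        ≡⟨ cong (λ r → B.numB S + (2 * 𝟙 (S b) + (B.out (lookup M) S + r))) (no-into-M M) ⟨
      B.numB S + (2 * 𝟙 (S b) + (B.out (lookup M) S + B.into (lookup M) S)) ∎)
      where
      open ≡-Reasoning
      S = lookup K
      lemma₁ : ∀ y a → y + (1 + a) ≡ suc y + a + 0
      lemma₁ = solve-∀
      lemma₂ : ∀ y b o → y + b + o ≡ y + (b + (o + 0))
      lemma₂ = solve-∀

    matchable-KK : ∀ {a b} → lookup A a ≡ true → lookup K a ≡ true → lookup K b ≡ true →
                   matchable G a b ≡ matchable G₁ (C₁.f a) (C₁.f b)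
    matchable-KK {a} {b} a∈A a∈K b∈K = ≡-iff
      (λ p → let M , m = matchable⇒ p in ⇒matchable (G₁₂.restrict {M = M} a∈K m
        (trans (sym (ℕₚ.+-cancelˡ-≡ 2 _ _ (cut-count {M = M} a∈A (trans (N.matchable-opposite p) (cong not a∈A)) m a∈K b∈K)))
          (sym (cong₂ (λ p q → 1 + 2 * (𝟙 p + 𝟙 q)) (≢⇒== (C₁.f-inside a∈K)) (≢⇒== (C₁.f-inside b∈K)))))))
      (λ p → ⇒matchable (G₁₂.extend a∈K b∈K (matchable⇒ p)))

    matchable-∁∁ : ∀ {a b} → lookup A a ≡ true → lookup K a ≡ false → lookup K b ≡ false →
                   matchable G a b ≡ matchable G₂ (C₂.f a) (C₂.f b)
    matchable-∁∁ {a} {b} a∈A a∉K b∉K = ≡-iff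
      (λ p → let M , m = matchable⇒ p in ⇒matchable (G₂₁.restrict {M = M} (in-∁ a∉K) m
        (trans (cut-∁ (lookup M)) (trans (sym (cut-count {M = M} a∈A (trans (N.matchable-opposite p) (cong not a∈A)) m a∉K b∉K))
          (sym (cong₂ (λ p q → 1 + 2 * (𝟙 p + 𝟙 q)) (≢⇒== (C₂.f-inside (in-∁ a∉K))) (≢⇒== (C₂.f-inside (in-∁ b∉K)))))))))
      (λ p → ⇒matchable (G₂₁.extend (in-∁ a∉K) (in-∁ b∉K) (matchable⇒ p)))

    matchable-K∁ : ∀ {a b} → lookup A a ≡ true → lookup K a ≡ true → lookup K b ≡ false →
                   matchable G a b ≡ matchable G₁ (C₁.f a) C₁.apex ∧ matchable G₂ C₂.apex (C₂.f b)
    matchable-K∁ {a} {b} a∈A a∈K b∉K = ≡-iff to from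
      where
      size≡3 : ∀ M → matchable G a b ≡ true → IsλMatching G a b M → B.out (lookup M) (lookup K) + B.into (lookup M) (lookup K) ≡ 3
      size≡3 M p m = sym (cut-count {M = M} a∈A (trans (N.matchable-opposite p) (cong not a∈A)) m a∈K b∉K)
      f₁b : C₁.f b ≡ C₁.apex
      f₁b = C₁.f-outside b∉K
      f₂a : C₂.f a ≡ C₂.apex
      f₂a = C₂.f-outside (trans (lookup-∁ K a) (cong not a∈K))
      to : matchable G a b ≡ true → matchable G₁ (C₁.f a) C₁.apex ∧ matchable G₂ C₂.apex (C₂.f b) ≡ true
      to p = let M , m = matchable⇒ p in cong₂ _∧_
        (trans (cong (matchable G₁ (C₁.f a)) (sym f₁b)) (⇒matchable (G₁₂.restrict {M = M} a∈K m
          (trans (size≡3 M p m) (sym (cong₂ (λ p q → 1 + 2 * (𝟙 p + 𝟙 q)) (≢⇒== (C₁.f-inside a∈K))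
            (trans (cong (_== C₁.apex) f₁b) (==-refl C₁.apex))))))))
        (trans (matchable-sym G₂ C₂.apex (C₂.f b)) (trans (cong (matchable G₂ (C₂.f b)) (sym f₂a)) (⇒matchable (G₂₁.restrict {M = M} (in-∁ b∉K) (λ-sym G {M = M} m)
          (trans (cut-∁ (lookup M)) (trans (size≡3 M p m) (sym (cong₂ (λ p q → 1 + 2 * (𝟙 p + 𝟙 q)) (≢⇒== (C₂.f-inside (in-∁ b∉K)))
            (trans (cong (_== C₂.apex) f₂a) (==-refl C₂.apex))))))))))
      from : matchable G₁ (C₁.f a) C₁.apex ∧ matchable G₂ C₂.apex (C₂.f b) ≡ true → matchable G a b ≡ true
      from eq = let p , q = ∧-true eq in ⇒matchable (G₁₂.extend₃ a∈K b∉K (matchable⇒ p) (matchable⇒ q))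

    matchable-∁K : ∀ {a b} → lookup A a ≡ true → lookup K a ≡ false → lookup K b ≡ true → matchable G a b ≡ false
    matchable-∁K {a} {b} a∈A a∉K b∈K = ≡false λ p → let M , m = matchable⇒ p in absurd
      (cut-count {M = M} a∈A (trans (N.matchable-opposite p) (cong not a∈A)) m a∉K b∈K)
      where
      absurd : ∀ {n} → 1 ≡ 2 + n → ⊥
      absurd ()

    ρ₁ ρ₂ p q : ℕ
    ρ₁ = ρ G₁ D₁.A₁
    ρ₂ = ρ G₂ D₂.A₁
    p  = ρAt G₁ D₁.A₁ C₁.apex
    q  = ρAt G₂ D₂.A₁ C₂.apex

    private
      inK in∁ : Vertex G → ℕ → ℕ
      inK x n = 𝟙 (lookup K x) * n
      in∁ x n = 𝟙 (lookup (∁ K) x) * n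
      inA : Vertex G → ℕ → ℕ
      inA x n = 𝟙 (lookup A x) * n

      rowK row∁ toApex fromApex : Vertex G → ℕ
      rowK a     = sum λ b → inK b (𝟙 (matchable G₁ (C₁.f a) (C₁.f b)))
      row∁ a     = sum λ b → in∁ b (𝟙 (matchable G₂ (C₂.f a) (C₂.f b)))
      toApex a   = 𝟙 (matchable G₁ (C₁.f a) C₁.apex)
      fromApex b = 𝟙 (matchable G₂ C₂.apex (C₂.f b))

      -- The matchable pairs of `G₁` and of `G₂` that avoid the apex. They correspond to the
      -- matchable pairs of `G` within one shore; the pairs across contribute `p * q`.
      S₁ S₂ : ℕ
      S₁ = sum λ a → inK a (inA a (rowK a))
      S₂ = sum λ a → in∁ a (inA a (row∁ a))

      split-K : ∀ x n → n ≡ inK x n + in∁ x n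
      split-K x n = trans (𝟙-split (lookup K x) n) (cong (λ b → inK x n + 𝟙 b * n) (sym (lookup-∁ K x)))

      weighted : ∀ s {m n} → (s ≡ true → m ≡ n) → 𝟙 s * m ≡ 𝟙 s * n
      weighted true  eq = cong (1 *_) (eq refl)
      weighted false eq = refl

      p≡ : p ≡ sum λ a → inK a (inA a (toApex a))
      p≡ = trans (N₁.ρAt-sum C₁.apex) (trans (C₁.sum-vertices _) (trans
        (cong (λ b → 𝟙 b + sum (λ x → inK x (𝟙 (matchable G₁ C₁.apex (C₁.f x))))) (N₁.matchable-same refl refl))
        (sum-cong λ x → weighted (lookup K x) λ x∈K → aux x x∈K (lookup A x) refl)))
        where
        aux : ∀ x → lookup K x ≡ true → ∀ c → lookup A x ≡ c → 𝟙 (matchable G₁ C₁.apex (C₁.f x)) ≡ inA x (toApex x)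
        aux x x∈K true  eq = trans (cong 𝟙 (matchable-sym G₁ _ _)) (trans (sym (ℕₚ.*-identityˡ _)) (cong (λ c → 𝟙 c * toApex x) (sym eq)))
        aux x x∈K false eq = trans (cong 𝟙 (N₁.matchable-same D₁.A₁-apex (trans (D₁.A₁-f x∈K) eq))) (cong (λ c → 𝟙 c * toApex x) (sym eq))

      q≡ : q ≡ sum λ b → in∁ b (fromApex b)
      q≡ = trans (N₂.ρAt-sum C₂.apex) (trans (C₂.sum-vertices _)
        (cong (λ b → 𝟙 b + sum (λ x → in∁ x (fromApex x))) (N₂.matchable-same refl refl)))

      ρ₁≡ : ρ₁ ≡ p + S₁
      ρ₁≡ = begin
        ρ₁ ≡⟨ N₁.ρ-sum ⟩
        sum (λ y → 𝟙 (lookup D₁.A₁ y) * N₁.row y)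
          ≡⟨ C₁.sum-vertices _ ⟩
        𝟙 (lookup D₁.A₁ C₁.apex) * N₁.row C₁.apex + sum (λ x → inK x (𝟙 (lookup D₁.A₁ (C₁.f x)) * N₁.row (C₁.f x)))
          ≡⟨ cong₂ _+_ (cong (λ c → 𝟙 c * N₁.row C₁.apex) D₁.A₁-apex) (sum-cong λ x → weighted (lookup K x) λ x∈K →
               cong₂ (λ c n → 𝟙 c * n) (D₁.A₁-f x∈K) (C₁.sum-vertices _)) ⟩
        sum (λ x → inK x (inA x (toApex x + rowK x)))
          ≡⟨ trans (sum-cong λ x → distrib (𝟙 (lookup K x)) (𝟙 (lookup A x)) (toApex x) (rowK x)) (sum-+ _ _) ⟩
        sum (λ x → inK x (inA x (toApex x))) + S₁
          ≡⟨ cong (_+ S₁) p≡ ⟨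
        p + S₁ ∎
        where
        open ≡-Reasoning
        distrib : ∀ k a t r → k * (a * (t + r)) ≡ k * (a * t) + k * (a * r)
        distrib = solve-∀

      ρ₂≡ : ρ₂ ≡ q + S₂
      ρ₂≡ = begin
        ρ₂ ≡⟨ N₂.ρ-sum ⟩
        sum (λ y → 𝟙 (lookup D₂.A₁ y) * N₂.row y)
          ≡⟨ C₂.sum-vertices _ ⟩
        𝟙 (lookup D₂.A₁ C₂.apex) * N₂.row C₂.apex + sum (λ x → in∁ x (𝟙 (lookup D₂.A₁ (C₂.f x)) * N₂.row (C₂.f x)))
          ≡⟨ cong₂ _+_ (trans (cong (λ c → 𝟙 c * N₂.row C₂.apex) D₂.A₁-apex) (trans (ℕₚ.*-identityˡ _) (sym (N₂.ρAt-sum C₂.apex))))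
               (sum-cong λ x → weighted (lookup (∁ K) x) λ x∈∁ → trans (cong (λ c → 𝟙 c * N₂.row (C₂.f x)) (D₂.A₁-f x∈∁))
                 (weighted (lookup A x) λ x∈A → trans (C₂.sum-vertices _)
                   (cong (λ b → 𝟙 b + row∁ x) (N₂.matchable-same (trans (D₂.A₁-f x∈∁) x∈A) D₂.A₁-apex)))) ⟩
        q + S₂ ∎
        where open ≡-Reasoning

      ρ≡ : ρ G A ≡ S₁ + p * q + S₂
      ρ≡ = begin
        ρ G A ≡⟨ N.ρ-sum ⟩
        sum (λ a → inA a (N.row a))
          ≡⟨ sum-cong (λ a → trans (split-K a _) (cong₂ _+_
               (weighted (lookup K a) λ a∈K → weighted (lookup A a) λ a∈A → inside-row a a∈A a∈K)
               (weighted (lookup (∁ K) a) λ a∈∁ → weighted (lookup A a) λ a∈A → outside-row a a∈A (out-of-∁ a∈∁)))) ⟩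
        sum (λ a → inK a (inA a (rowK a + toApex a * q)) + in∁ a (inA a (row∁ a)))
          ≡⟨ sum-+ (λ a → inK a (inA a (rowK a + toApex a * q))) _ ⟩
        sum (λ a → inK a (inA a (rowK a + toApex a * q))) + S₂
          ≡⟨ cong (_+ S₂) (trans (sum-cong λ a → distrib (𝟙 (lookup K a)) (𝟙 (lookup A a)) (rowK a) (toApex a) q) (sum-+ _ _)) ⟩
        S₁ + sum (λ a → inK a (inA a (toApex a)) * q) + S₂
          ≡⟨ cong (λ n → S₁ + n + S₂) (trans (sym (*-sumʳ q _)) (cong (_* q) (sym p≡))) ⟩
        S₁ + p * q + S₂ ∎
        where
        open ≡-Reasoning
        distrib : ∀ k a r t q → k * (a * (r + t * q)) ≡ k * (a * r) + k * (a * t) * q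
        distrib = solve-∀
        row-split : ∀ a → N.row a ≡ sum (λ b → inK b (𝟙 (matchable G a b))) + sum (λ b → in∁ b (𝟙 (matchable G a b)))
        row-split a = trans (sum-cong λ b → split-K b (𝟙 (matchable G a b))) (sum-+ (λ b → inK b (𝟙 (matchable G a b))) _)
        inside-row : ∀ a → lookup A a ≡ true → lookup K a ≡ true → N.row a ≡ rowK a + toApex a * q
        inside-row a a∈A a∈K = trans (row-split a) (cong₂ _+_
          (sum-cong λ b → weighted (lookup K b) λ b∈K → cong 𝟙 (matchable-KK a∈A a∈K b∈K))
          (trans (sum-cong λ b → trans (weighted (lookup (∁ K) b) λ b∈∁ →
              trans (cong 𝟙 (matchable-K∁ a∈A a∈K (out-of-∁ b∈∁))) (𝟙-∧ _ (matchable G₂ C₂.apex (C₂.f b))))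
              (assoc (𝟙 (lookup (∁ K) b)) (toApex a) (fromApex b)))
            (trans (sym (*-sumˡ (toApex a) _)) (cong (toApex a *_) (sym q≡)))))
          where
          assoc : ∀ c t f → c * (t * f) ≡ t * (c * f)
          assoc = solve-∀
        outside-row : ∀ a → lookup A a ≡ true → lookup K a ≡ false → N.row a ≡ row∁ a
        outside-row a a∈A a∉K = trans (row-split a) (cong₂ _+_
          (sum-0 λ b → trans (weighted (lookup K b) λ b∈K → cong 𝟙 (matchable-∁K a∈A a∉K b∈K)) (ℕₚ.*-zeroʳ (𝟙 (lookup K b))))
          (sum-cong λ b → weighted (lookup (∁ K) b) λ b∈∁ → cong 𝟙 (matchable-∁∁ a∈A a∉K (out-of-∁ b∈∁))))

    ρ-split : ρ G A + (p + q) ≡ ρ₁ + ρ₂ + p * q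
    ρ-split = trans (cong (_+ (p + q)) ρ≡) (trans (lemma S₁ S₂ p q) (cong₂ (λ m n → m + n + p * q) (sym ρ₁≡) (sym ρ₂≡)))
      where
      lemma : ∀ s₁ s₂ p q → s₁ + p * q + s₂ + (p + q) ≡ p + s₁ + (q + s₂) + p * q
      lemma = solve-∀

    order-split : order G + 2 ≡ order G₁ + order G₂
    order-split = sym (trans (cong₂ _+_ C₁.order₁ C₂.order₁) (trans (lemma ∣ K ∣ ∣ ∁ K ∣) (cong (_+ 2) (∣p∣+∣∁p∣ K))))
      where
      lemma : ∀ a b → suc a + suc b ≡ a + b + 2
      lemma = solve-∀

  -- The two inequalities

  subset-≡ : ∀ {n} {p q : Subset n} → (∀ x → lookup p x ≡ lookup q x) → p ≡ q
  subset-≡ {p = p} {q} eq = trans (sym (tabulate∘lookup p)) (trans (tabulate-cong eq) (tabulate∘lookup q))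

  ∁-involutive : ∀ {n} (p : Subset n) → ∁ (∁ p) ≡ p
  ∁-involutive p = subset-≡ λ x → trans (lookup-∁ (∁ p) x) (trans (cong not (lookup-∁ p x)) (not-involutive _))

  members-≡ : ∀ {n} {p : Subset n} {x y : Members p} → proj₁ x ≡ proj₁ y → x ≡ y
  members-≡ {x = x , i} {.x , j} refl = cong (x ,_) (∈-unique i j)

  module _ {G G₁ : Graph} {X : Subset (order G)} (iso : ⌊ G₁ ⌋ ≅ contraction G X) where
    private
      module V = Inverse (_≅_.vertices iso)
      module E = Inverse (_≅_.edges iso)
      module C = Contract G X

      ∈X : ∀ {x} → lookup (∁ X) x ≡ false → x ∈ X
      ∈X {x} eq = lookup⇒∈ {x = x} {X} (trans (sym (not-involutive (lookup X x))) (cong not (trans (sym (lookup-∁ X x)) eq)))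

      V-from-injective : ∀ {x y} → V.from x ≡ V.from y → x ≡ y
      V-from-injective {x} {y} eq = trans (sym (V.strictlyInverseˡ x)) (trans (cong V.to eq) (V.strictlyInverseˡ y))

      f : Vertex G → Vertex G₁
      f x = V.from (C.shrunk x)

      f-inside : ∀ {x} → lookup (∁ X) x ≡ true → f x ≢ V.from (inj₂ tt)
      f-inside x∈∁X eq with () ← trans (sym (C.↦⇒≡ (keep (lookup⇒∈ x∈∁X)))) (V-from-injective eq)

      f-injective : ∀ {x y} → lookup (∁ X) x ≡ true → lookup (∁ X) y ≡ true → f x ≡ f y → x ≡ y
      f-injective x∈∁X _ eq with C.shrunk-injective (V-from-injective eq)
      ... | inj₁ x≡y       = x≡y
      ... | inj₂ (x∈X , _) = contradiction x∈X (x∈∁p⇒x∉p (lookup⇒∈ x∈∁X))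

      f-onto : ∀ y → y ≢ V.from (inj₂ tt) → ∃ λ x → lookup (∁ X) x ≡ true × f x ≡ y
      f-onto y y≢ = aux (V.to y) refl
        where
        aux : ∀ z → V.to y ≡ z → ∃ λ x → lookup (∁ X) x ≡ true × f x ≡ y
        aux (inj₁ (x , i)) eq = x , ∈⇒lookup i , trans (cong V.from (trans (C.↦⇒≡ (keep i)) (sym eq))) (V.strictlyInverseʳ y)
        aux (inj₂ tt)      eq = contradiction (trans (sym (V.strictlyInverseʳ y)) (cong V.from eq)) y≢

      edgesInside-joins : ∀ {e x y} → Graph.Joins G e x y → lookup (edgesInside G X) e ≡ lookup X x ∧ lookup X y
      edgesInside-joins {e} (inj₁ eq) = trans (lookup∘tabulate _ e) (cong (λ p → lookup X (proj₁ p) ∧ lookup X (proj₂ p)) eq)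
      edgesInside-joins {e} {x} {y} (inj₂ eq) = trans (lookup∘tabulate _ e) (trans (cong (λ p → lookup X (proj₁ p) ∧ lookup X (proj₂ p)) eq)
        (∧-comm (lookup X y) (lookup X x)))

      g-onto : ∀ {e x y} → Graph.Joins G e x y → lookup (∁ X) x ≡ true → ∃ λ e₁ → proj₁ (E.to e₁) ≡ e
      g-onto {e} {x} {y} j x∈∁X = E.from (e , e∉) , cong proj₁ (E.strictlyInverseˡ (e , e∉))
        where
        e∉ : e ∈ ∁ (edgesInside G X)
        e∉ = lookup⇒∈ (trans (lookup-∁ (edgesInside G X) e) (cong not (trans (edgesInside-joins j)
          (cong (_∧ lookup X y) (∉⇒lookup {x = x} {X} (x∈∁p⇒x∉p (lookup⇒∈ {x = x} {∁ X} x∈∁X)))))))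

      joins : ∀ e₁ {x y} → Graph.Joins G (proj₁ (E.to e₁)) x y → Graph.Joins G₁ e₁ (f x) (f y)
      joins e₁ {x} {y} j = Equivalence.from (_≅_.joins iso e₁ (f x) (f y))
        (x , y , j , C.≡⇒↦ (sym (V.strictlyInverseˡ _)) , C.≡⇒↦ (sym (V.strictlyInverseˡ _)))

    -- The complement appears because `contraction` names the set that is shrunk, `Contraction` the
    -- set that is kept.
    fromContraction : Contraction G (∁ X) G₁
    fromContraction = record
      { apex        = V.from (inj₂ tt)
      ; f           = f
      ; f-outside   = λ {x} eq → cong V.from (C.↦⇒≡ (shrink (∈X {x} eq)))
      ; f-inside    = f-inside
      ; f-injective = f-injective
      ; f-onto      = f-onto
      ; g           = proj₁ ∘ E.to
      ; g-injective = λ eq → trans (sym (E.strictlyInverseʳ _)) (trans (cong E.from (members-≡ eq)) (E.strictlyInverseʳ _))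
      ; g-onto      = g-onto
      ; joins       = joins
      }

  complement-bipartition : ∀ G A → IsBipartition G A → IsBipartition G (∁ A)
  complement-bipartition G A bip e = lookup⇒∈ (trans (∂-joins G j (∁ A)) (trans
    (cong₂ _xor_ (trans (lookup-∁ A _) (cong not (B.α∈A e))) (trans (lookup-∁ A _) (cong not (B.β∉A e)))) refl))
    where
    module B = Bipartitioned G A bip
    j = B.αβ-joins e

  third : ∀ {n} → 3 ≤ n → (x y : Fin n) → ∃ λ z → z ≢ x × z ≢ y
  third {n} 3≤n x y with any? (λ z → ¬? (z ≟ x) ×-dec ¬? (z ≟ y))
  ... | yes found = found
  ... | no none   = ⊥-elim (ℕₚ.<-irrefl refl (ℕₚ.≤-trans 3≤n (subst₂ _≤_
      (trans (sum-const n 1) (ℕₚ.*-identityʳ n))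
      (trans (sum-+ (λ z → 1 * 𝟙 (z == x)) _) (cong₂ _+_ (sum-δ (λ _ → 1) x) (sum-δ (λ _ → 1) y))) (sum-mono λ z → aux z (z ≟ x) (z ≟ y)))))
      where
      aux : ∀ z (p : Dec (z ≡ x)) (q : Dec (z ≡ y)) → 1 ≤ 1 * 𝟙 (does p) + 1 * 𝟙 (does q)
      aux z (yes _) _       = s≤s z≤n
      aux z (no _)  (yes _) = s≤s z≤n
      aux z (no p)  (no q)  = contradiction (z , p , q) none

  module Simple (G : Graph) (A : Subset (order G)) (bip : IsBipartition G A) (cubic : Cubic G)
    (ec : EdgeConnected G) (3≤n : 3 ≤ order G) where
    open CubicBipartite G A bip cubic
    open Counting G A bip cubic

    multiplicity : Vertex G → Vertex G → ℕ
    multiplicity x y = sum λ e → 𝟙 (α e == x ∧ β e == y)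

    degA : ∀ {x} → lookup A x ≡ true → sum (λ e → 𝟙 (α e == x)) ≡ 3
    degA {x} x∈A = trans (sum-cong λ e → sym (trans (ℕₚ.*-identityˡ _) (trans (cong (λ b → 𝟙 (α e == x) + 𝟙 b)
      (≢⇒== {x = β e} {x} λ { refl → true≢false x∈A (β∉A e) })) (ℕₚ.+-identityʳ _)))) (d-all x)

    degB : ∀ {y} → lookup A y ≡ false → sum (λ e → 𝟙 (β e == y)) ≡ 3
    degB {y} y∉A = trans (sum-cong λ e → sym (trans (ℕₚ.*-identityˡ _) (cong (λ b → 𝟙 b + 𝟙 (β e == y))
      (≢⇒== {x = α e} {y} λ { refl → true≢false (α∈A e) y∉A })))) (d-all y)

    -- The edges that leave a pair of vertices joined by k edges are 2 (3 - k).
    multiplicity≤1 : ∀ {x y} → lookup A x ≡ true → lookup A y ≡ false → multiplicity x y ≤ 1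
    multiplicity≤1 {x} {y} x∈A y∉A =
      let z , z≢x , z≢y = third 3≤n x y
          3≤cut = subst (3 ≤_) (∣∂X∣ X) (ec X {x} {z} (lookup⇒∈ (trans (X≡ x) (cong (_∨ x == y) (==-refl x))))
            (lookup⇒∉ (trans (X≡ z) (cong₂ _∨_ (≢⇒== z≢x) (≢⇒== z≢y)))))
      in ℕₚ.≮⇒≥ λ 1<m → by-⊥ 0 (3≤cut ⊕ ℕₚ.≤-reflexive out-eq ⊕ ℕₚ.≤-reflexive into-eq ⊕ 1<m ⊕ 1<m)
           (lemma (multiplicity x y) (out all (lookup X)) (into all (lookup X)))
      where
      X = ⁅ x ⁆ ∪ ⁅ y ⁆
      X≡ : ∀ z → lookup X z ≡ z == x ∨ z == y
      X≡ z = trans (lookup-∪ ⁅ x ⁆ ⁅ y ⁆ z) (cong₂ _∨_ (lookup-⁅⁆ x z) (lookup-⁅⁆ y z))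
      Xα : ∀ e → lookup X (α e) ≡ α e == x
      Xα e = trans (X≡ (α e)) (trans (cong (α e == x ∨_) (≢⇒== {x = α e} {y} λ { refl → true≢false (α∈A e) y∉A })) (∨-identityʳ _))
      Xβ : ∀ e → lookup X (β e) ≡ β e == y
      Xβ e = trans (X≡ (β e)) (cong (_∨ β e == y) (≢⇒== {x = β e} {x} λ { refl → true≢false x∈A (β∉A e) }))
      out-eq : multiplicity x y + out all (lookup X) ≡ 3
      out-eq = trans (sym (sum-+ _ _)) (trans (sum-cong λ e →
        trans (cong₂ (λ a b → 𝟙 (α e == x ∧ β e == y) + 1 * 𝟙 (a ∧ not b)) (Xα e) (Xβ e)) (aux (α e == x) (β e == y))) (degA x∈A))
        where
        aux : ∀ a b → 𝟙 (a ∧ b) + 1 * 𝟙 (a ∧ not b) ≡ 𝟙 a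
        aux true true = refl
        aux true false = refl
        aux false _ = refl
      into-eq : multiplicity x y + into all (lookup X) ≡ 3
      into-eq = trans (sym (sum-+ _ _)) (trans (sum-cong λ e →
        trans (cong₂ (λ a b → 𝟙 (α e == x ∧ β e == y) + 1 * 𝟙 (not a ∧ b)) (Xα e) (Xβ e)) (aux (α e == x) (β e == y))) (degB y∉A))
        where
        aux : ∀ a b → 𝟙 (a ∧ b) + 1 * 𝟙 (not a ∧ b) ≡ 𝟙 b
        aux true true = refl
        aux true false = refl
        aux false true = refl
        aux false false = refl
      lemma : ∀ m o r → 3 + (m + o + (m + r + (2 + 2))) ≡ suc (0 + (o + r + (3 + (3 + (m + m)))))
      lemma = solve-∀

    multiplicity-total : ∀ {x} → lookup A x ≡ true → sum (λ w → multiplicity x w) ≡ 3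
    multiplicity-total {x} x∈A = trans (sum-swap (λ w e → 𝟙 (α e == x ∧ β e == w))) (trans (sum-cong λ e →
        trans (sum-cong λ w → 𝟙-∧ (α e == x) (β e == w)) (sum-δ′ (λ _ → 𝟙 (α e == x)) (β e))) (degA x∈A))

    multiplicity-same : ∀ {x w} → lookup A w ≡ true → multiplicity x w ≡ 0
    multiplicity-same {x} {w} w∈A = sum-0 λ e → cong 𝟙 (trans (cong (α e == x ∧_)
        (≢⇒== {x = β e} {w} λ { refl → true≢false w∈A (β∉A e) })) (∧-zeroʳ (α e == x)))

    -- The three edges at `x` lead to three different vertices by `multiplicity≤1`, and adjacent
    -- pairs are matchable by `λ-adjacent`.
    row≥3 : ∀ {x} → lookup A x ≡ true → 3 ≤ row x
    row≥3 {x} x∈A = subst (_≤ row x) (multiplicity-total x∈A) (sum-mono λ w → aux w (lookup A w) refl)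
      where
      aux : ∀ w c → lookup A w ≡ c → multiplicity x w ≤ 𝟙 (matchable G x w)
      aux w true w∈A = ℕₚ.≤-trans (ℕₚ.≤-reflexive (multiplicity-same w∈A)) z≤n
      aux w false w∉A with matchable G x w in eq
      ... | true  = multiplicity≤1 x∈A w∉A
      ... | false = ℕₚ.≮⇒≥ λ 0<m → let e , 0<e = 0<sum _ 0<m ; p , q = ∧-true (1≤𝟙 0<e) in
        true≢false (⇒matchable (subst₂ (λ a b → ∃ (IsλMatching G a b)) (==⇒≡ p) (==⇒≡ q) (λ-adjacent ec e))) eq

  ρAt≥3 : ∀ G A → IsBipartition G A → Cubic G → EdgeConnected G → 3 ≤ order G → ∀ v → 3 ≤ ρAt G A v
  ρAt≥3 G A bip cubic ec 3≤n v = subst (3 ≤_) (sym (Counting.ρAt-sum G A bip cubic v)) (aux (lookup A v) refl)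
    where
    aux : ∀ c → lookup A v ≡ c → 3 ≤ sum (λ b → 𝟙 (matchable G v b))
    aux true  v∈A = Simple.row≥3 G A bip cubic ec 3≤n v∈A
    aux false v∉A = Simple.row≥3 G (∁ A) (complement-bipartition G A bip) cubic ec 3≤n (trans (lookup-∁ A v) (cong not v∉A))

  module TightCutFreeGraph (G : Graph) (A : Subset (order G)) (bip : IsBipartition G A) (cubic : Cubic G)
    (ec : EdgeConnected G) (tcf : TightCutFree G) where
    open CubicBipartite G A bip cubic
    open Counting G A bip cubic

    k : ℕ
    k = numA all

    allMatchable : AllMatchable
    allMatchable a∈A b∉A = ⇒matchable (λ-all ec tcf a∈A b∉A)

    ρ≡k² : ρ G A ≡ k * k
    ρ≡k² = ρ-all allMatchable

    -- Every vertex has `k` partners, and at least 3 by `ρAt≥3`. Hence a brace with more than two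
    -- vertices has at least six; a graph such as `ℂ₄` is excluded by `EdgeConnected`.
    3≤k : 3 ≤ order G → 3 ≤ k
    3≤k 3≤n = let v = proj₁ (0<sum (λ (_ : Vertex G) → 1) (subst (0 <_) (sym (trans (sum-const (order G) 1) (ℕₚ.*-identityʳ _))) (ℕₚ.≤-trans (s≤s z≤n) 3≤n))) in
      subst (3 ≤_) (ρAt-all allMatchable v) (ρAt≥3 G A bip cubic ec 3≤n v)

    6≤order : 3 ≤ order G → 6 ≤ order G
    6≤order 3≤n = subst (6 ≤_) (sym order≡) (3≤k 3≤n ⊕ 3≤k 3≤n)

  -- The constants suit the induction: along a tight cut `m` and `3 n - 6` are additive and `ρ + 3`
  -- is superadditive. The first alternative in `equal` is there because a brace of any order
  -- attains the first bound.
  record Bounds (G : Graph) (A : Subset (order G)) (m : ℕ) : Set where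
    field
      lower : m ≤ ρ G A + 3
      upper : 3 * order G ≤ m + 6
      equal : ρ G A + 3 ≡ m → TightCutFree G ⊎ ρ G A + 9 ≡ 3 * order G

  middle : List Graph → ℕ
  middle Js = β′ Js + 3 * b′ Js

  -- This is `0 ≤ (k - 3)²`. The case split lets `d = k - 3` be a natural number in the last clause;
  -- the first three are numerical.
  square-bound : ∀ k → 3 * (k + k) ≤ k * k + 3 + 6
  square-bound 0 = z≤n
  square-bound 1 = ℕₚ.m≤m+n 6 4
  square-bound 2 = ℕₚ.m≤m+n 12 1
  square-bound (suc (suc (suc d))) = by-≤ (d * d) (z≤n {0}) (lemma d)
    where
    lemma : ∀ d → 3 * (3 + d + (3 + d)) + 0 + d * d ≡ (3 + d) * (3 + d) + 3 + 6 + 0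
    lemma = solve-∀

  module BraceBounds (G : Graph) (A : Subset (order G)) (bip : IsBipartition G A) (cubic : Cubic G)
    (ec : EdgeConnected G) (tcf : TightCutFree G) where
    private
      module C = Counting G A bip cubic
      module T = TightCutFreeGraph G A bip cubic ec tcf
      k = T.k

      total : List Graph → ℕ
      total Js = ListAction.sum (map (λ J → (order J / 2) ^ 2) Js) + 3 * length Js

      Large : Graph → Set
      Large J = Bipartite J × 6 ≤ order J

      large? : ∀ J → Dec (Large J)
      large? J = bipartite? J ×-dec 6 ≤? order J

    middle-small : ¬ 3 ≤ order G → middle [ G ] ≡ 0
    middle-small n<3 = cong total (filter-reject large? {G} {[]} λ (_ , 6≤n) → n<3 (ℕₚ.≤-trans (s≤s (s≤s (s≤s z≤n))) 6≤n))

    half : order G / 2 ≡ k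
    half = trans (cong (_/ 2) (trans C.order≡ (double k))) (m*n/n≡m k 2)
      where
      double : ∀ k → k + k ≡ k * 2
      double = solve-∀

    middle-large : 3 ≤ order G → middle [ G ] ≡ k * k + 3
    middle-large 3≤n = trans (cong total (filter-accept large? {G} {[]} ((A , bip) , T.6≤order 3≤n)))
      (trans (cong (λ h → h ^ 2 + 0 + 3) half) (lemma k))
      where
      lemma : ∀ k → k * (k * 1) + 0 + 3 ≡ k * k + 3
      lemma = solve-∀

    small : ¬ 3 ≤ order G → Bounds G A 0
    small n<3 = record
      { lower = z≤n
      ; upper = ℕₚ.*-monoʳ-≤ 3 (ℕₚ.≤-pred (ℕₚ.≰⇒> n<3))
      ; equal = λ eq → contradiction (trans (ℕₚ.+-comm 3 _) eq) λ ()
      }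

    large : Bounds G A (k * k + 3)
    large = record
      { lower = ℕₚ.+-monoˡ-≤ 3 (ℕₚ.≤-reflexive (sym T.ρ≡k²))
      ; upper = subst (λ n → 3 * n ≤ k * k + 3 + 6) (sym C.order≡) (square-bound k)
      ; equal = λ _ → inj₁ tcf
      }

    bounds : Bounds G A (middle [ G ])
    bounds = aux (3 ≤? order G)
      where
      aux : Dec (3 ≤ order G) → Bounds G A (middle [ G ])
      aux (yes 3≤n) = subst (Bounds G A) (sym (middle-large 3≤n)) large
      aux (no n<3)  = subst (Bounds G A) (sym (middle-small n<3)) (small n<3)

  module Combine (G : Graph) (A : Subset (order G)) (bip : IsBipartition G A) (cubic : Cubic G) (ec : EdgeConnected G)
    {K : Subset (order G)} {G₁ G₂ : Graph} (C₁ : Contraction G K G₁) (C₂ : Contraction G (∁ K) G₂)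
    (out≡3 : CubicBipartite.out G A bip cubic all (lookup K) ≡ 3)
    (into≡0 : CubicBipartite.into G A bip cubic all (lookup K) ≡ 0)
    (2≤K : 2 ≤ ∣ K ∣) (2≤∁K : 2 ≤ ∣ ∁ K ∣) where

    open Split G A bip cubic C₁ C₂ out≡3 into≡0 public
    private
      module C₁ = Contraction C₁
      module C₂ = Contraction C₂

    ec₁ : EdgeConnected G₁
    ec₁ = D₁.edgeConnected₁ ec (let x , x∈∁K = nonempty (∁ K) 2≤∁K in x , out-of-∁ (∈⇒lookup x∈∁K))

    ec₂ : EdgeConnected G₂
    ec₂ = D₂.edgeConnected₁ ec (let x , x∈K = nonempty K 2≤K in x , trans (lookup-∁ K x) (cong not (∈⇒lookup x∈K)))

    3≤n₁ : 3 ≤ order G₁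
    3≤n₁ = subst (3 ≤_) (sym C₁.order₁) (s≤s 2≤K)

    3≤n₂ : 3 ≤ order G₂
    3≤n₂ = subst (3 ≤_) (sym C₂.order₁) (s≤s 2≤∁K)

    private
      -- Put `p = 3 + p′` and `q = 3 + q′`. Then `p q - p - q = 3 + 2 (p′ + q′) + p′ q′`, and the
      -- part beyond 3 vanishes only for `p′ = q′ = 0`.
      arithmetic : ∀ {ρ ρ₁ ρ₂ p q} → 3 ≤ p → 3 ≤ q → ρ + (p + q) ≡ ρ₁ + ρ₂ + p * q →
                   ∃ λ x → ρ ≡ ρ₁ + ρ₂ + 3 + x × (x ≡ 0 → p ≡ 3 × q ≡ 3)
      arithmetic {ρ} {ρ₁} {ρ₂} {suc (suc (suc p))} {suc (suc (suc q))} (s≤s (s≤s (s≤s z≤n))) (s≤s (s≤s (s≤s z≤n))) eq =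
        p + q + (p + q) + p * q , by-≡ eq (lemma ρ ρ₁ ρ₂ p q) ,
        λ x≡0 → let p+q≡0 = ℕₚ.m+n≡0⇒m≡0 (p + q) (ℕₚ.m+n≡0⇒m≡0 (p + q + (p + q)) x≡0) in
          cong (3 +_) (ℕₚ.m+n≡0⇒m≡0 p p+q≡0) , cong (3 +_) (ℕₚ.m+n≡0⇒n≡0 p p+q≡0)
        where
        lemma : ∀ ρ ρ₁ ρ₂ p q → ρ + (ρ₁ + ρ₂ + (3 + p) * (3 + q)) ≡ ρ₁ + ρ₂ + 3 + (p + q + (p + q) + p * q) + (ρ + (3 + p + (3 + q)))
        lemma = solve-∀

    excess : ∃ λ x → ρ G A ≡ ρ₁ + ρ₂ + 3 + x × (x ≡ 0 → p ≡ 3 × q ≡ 3)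
    excess = arithmetic {ρ G A} {ρ₁} {ρ₂} {p} {q} (ρAt≥3 G₁ D₁.A₁ D₁.bip₁ cubic₁ ec₁ 3≤n₁ C₁.apex)
                        (ρAt≥3 G₂ D₂.A₁ D₂.bip₁ cubic₂ ec₂ 3≤n₂ C₂.apex) ρ-split

    private
      x = proj₁ excess
      ρ≡ = proj₁ (proj₂ excess)

      squeeze : ∀ {a₁ a₂ x m₁ m₂} → m₁ ≤ a₁ → m₂ ≤ a₂ → a₁ + a₂ + x ≤ m₁ + m₂ → x ≡ 0 × a₁ ≡ m₁ × a₂ ≡ m₂
      squeeze {a₁} {a₂} {x} {m₁} {m₂} l₁ l₂ h =
        ℕₚ.n≤0⇒n≡0 (by-≤ 0 (l₁ ⊕ l₂ ⊕ h) (lemma₀ a₁ a₂ x m₁ m₂)) ,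
        ℕₚ.≤-antisym (by-≤ x (l₂ ⊕ h) (lemma₁ a₁ a₂ x m₁ m₂)) l₁ ,
        ℕₚ.≤-antisym (by-≤ x (l₁ ⊕ h) (lemma₂ a₁ a₂ x m₁ m₂)) l₂
        where
        lemma₀ : ∀ a₁ a₂ x m₁ m₂ → x + (a₁ + (a₂ + (m₁ + m₂))) + 0 ≡ 0 + (m₁ + (m₂ + (a₁ + a₂ + x)))
        lemma₀ = solve-∀
        lemma₁ : ∀ a₁ a₂ x m₁ m₂ → a₁ + (a₂ + (m₁ + m₂)) + x ≡ m₁ + (m₂ + (a₁ + a₂ + x))
        lemma₁ = solve-∀
        lemma₂ : ∀ a₁ a₂ x m₁ m₂ → a₂ + (a₁ + (m₁ + m₂)) + x ≡ m₂ + (m₁ + (a₁ + a₂ + x))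
        lemma₂ = solve-∀

      tripled : 3 * (order G + 2) ≡ 3 * order G₁ + 3 * order G₂
      tripled = trans (cong (3 *_) order-split) (ℕₚ.*-distribˡ-+ 3 (order G₁) (order G₂))

      final : ∀ {n ρ₁ ρ₂} → ρ₁ + 9 + (ρ₂ + 9) ≡ 3 * (n + 2) → ρ₁ + ρ₂ + 3 + 0 + 9 ≡ 3 * n
      final {n} {ρ₁} {ρ₂} eq = by-≡ eq (lemma n ρ₁ ρ₂)
        where
        lemma : ∀ n ρ₁ ρ₂ → ρ₁ + ρ₂ + 3 + 0 + 9 + 3 * (n + 2) ≡ 3 * n + (ρ₁ + 9 + (ρ₂ + 9))
        lemma = solve-∀

    -- The bounds for the two parts add up to the bound for `G` with the surplus `x` to spare. If
    -- there is no room, both are tight and `x` is 0.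
    sharp : ρ G A + 9 ≡ 3 * order G → 3 * order G₁ ≤ ρ₁ + 9 → 3 * order G₂ ≤ ρ₂ + 9 →
            (p ≡ 3 × q ≡ 3) × ρ₁ + 9 ≡ 3 * order G₁ × ρ₂ + 9 ≡ 3 * order G₂
    sharp eq l₁ l₂ =
      let x≡0 , eq₁ , eq₂ = squeeze l₁ l₂ (ℕₚ.≤-reflexive (trans (lemma₁ ρ₁ ρ₂ x) (trans (cong (λ n → n + 9 + 6) (sym ρ≡))
            (trans (cong (_+ 6) eq) (trans (lemma₂ (order G)) tripled)))))
      in proj₂ (proj₂ excess) x≡0 , eq₁ , eq₂
      where
      lemma₁ : ∀ ρ₁ ρ₂ x → ρ₁ + 9 + (ρ₂ + 9) + x ≡ ρ₁ + ρ₂ + 3 + x + 9 + 6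
      lemma₁ = solve-∀
      lemma₂ : ∀ n → 3 * n + 6 ≡ 3 * (n + 2)
      lemma₂ = solve-∀

    module _ {m₁ m₂ : ℕ} (b₁ : Bounds G₁ D₁.A₁ m₁) (b₂ : Bounds G₂ D₂.A₁ m₂) where
      private
        module b₁ = Bounds b₁
        module b₂ = Bounds b₂

        -- In a graph without nontrivial tight cuts every vertex has `k` partners. A vertex with
        -- exactly 3 thus forces `k = 3`, that is `ρ = 9` and order 6, so this alternative also
        -- gives `ρ + 9 = 3 n`.
        resolve : ∀ G′ A′ → IsBipartition G′ A′ → Cubic G′ → EdgeConnected G′ → ∀ {v} → ρAt G′ A′ v ≡ 3 →
                  TightCutFree G′ ⊎ ρ G′ A′ + 9 ≡ 3 * order G′ → ρ G′ A′ + 9 ≡ 3 * order G′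
        resolve G′ A′ bip′ cubic′ ec′ _ (inj₂ eq) = eq
        resolve G′ A′ bip′ cubic′ ec′ {v} ρv≡3 (inj₁ tcf) =
          trans (cong (_+ 9) (trans T.ρ≡k² (cong (λ k → k * k) k≡3))) (sym (cong (3 *_) (trans N.order≡ (cong (λ k → k + k) k≡3))))
          where
          module T = TightCutFreeGraph G′ A′ bip′ cubic′ ec′ tcf
          module N = Counting G′ A′ bip′ cubic′
          k≡3 : T.k ≡ 3
          k≡3 = trans (sym (N.ρAt-all T.allMatchable v)) ρv≡3

      combined : Bounds G A (m₁ + m₂)
      combined = record
        { lower = subst (λ n → m₁ + m₂ ≤ n + 3) (sym ρ≡) (by-≤ x (b₁.lower ⊕ b₂.lower) (lemma₁ ρ₁ ρ₂ x m₁ m₂))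
        ; upper = by-≤ 0 (b₁.upper ⊕ b₂.upper ⊕ ℕₚ.≤-reflexive (cong (3 *_) order-split)) (lemma₂ (order G) (order G₁) (order G₂) m₁ m₂)
        ; equal = λ eq → inj₂ (equality eq)
        }
        where
        lemma₁ : ∀ ρ₁ ρ₂ x m₁ m₂ → m₁ + m₂ + (ρ₁ + 3 + (ρ₂ + 3)) + x ≡ ρ₁ + ρ₂ + 3 + x + 3 + (m₁ + m₂)
        lemma₁ = solve-∀
        lemma₂ : ∀ n n₁ n₂ m₁ m₂ → 3 * n + (m₁ + 6 + (m₂ + 6 + 3 * (n₁ + n₂))) + 0 ≡ m₁ + m₂ + 6 + (3 * n₁ + (3 * n₂ + 3 * (n + 2)))
        lemma₂ = solve-∀
        lemma₃ : ∀ ρ₁ ρ₂ x → ρ₁ + 3 + (ρ₂ + 3) + x ≡ ρ₁ + ρ₂ + 3 + x + 3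
        lemma₃ = solve-∀
        equality : ρ G A + 3 ≡ m₁ + m₂ → ρ G A + 9 ≡ 3 * order G
        equality eq =
          let x≡0 , eq₁ , eq₂ = squeeze b₁.lower b₂.lower (ℕₚ.≤-reflexive (trans (lemma₃ ρ₁ ρ₂ x) (trans (cong (_+ 3) (sym ρ≡)) eq)))
              p≡3 , q≡3 = proj₂ (proj₂ excess) x≡0
              r₁ = resolve G₁ D₁.A₁ D₁.bip₁ cubic₁ ec₁ p≡3 (b₁.equal eq₁)
              r₂ = resolve G₂ D₂.A₁ D₂.bip₁ cubic₂ ec₂ q≡3 (b₂.equal eq₂)
          in trans (cong (_+ 9) (trans ρ≡ (cong (ρ₁ + ρ₂ + 3 +_) x≡0))) (final {order G} {ρ₁} {ρ₂} (trans (cong₂ _+_ r₁ r₂) (sym tripled)))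

  -- A nontrivial tight cut, with its shores named so that K is the one with more vertices in A.
  record Shores (G : Graph) (A : Subset (order G)) (bip : IsBipartition G A) (cubic : Cubic G) (G₁ G₂ : Graph) : Set where
    field
      K      : Subset (order G)
      C₁     : Contraction G K G₁
      C₂     : Contraction G (∁ K) G₂
      out≡3  : CubicBipartite.out G A bip cubic all (lookup K) ≡ 3
      into≡0 : CubicBipartite.into G A bip cubic all (lookup K) ≡ 0
      2≤K    : 2 ≤ ∣ K ∣
      2≤∁K   : 2 ≤ ∣ ∁ K ∣

  module _ {G : Graph} {A : Subset (order G)} {bip : IsBipartition G A} {cubic : Cubic G} where
    private module B = CubicBipartite G A bip cubic

    shores : ∀ {G₁ G₂ X} → NontrivialTight G X → Contraction G (∁ X) G₁ → Contraction G (∁ (∁ X)) G₂ →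
             Shores G A bip cubic G₁ G₂ ⊎ Shores G A bip cubic G₂ G₁
    shores {G₁} {G₂} {X} (2≤X , 2≤∁X , tight) C₁ C₂ = aux (B.tight⇒threeCut X (proj₂ (nonempty X 2≤X)) tight)
      where
      C₂′ : Contraction G X G₂
      C₂′ = subst (λ K → Contraction G K G₂) (∁-involutive X) C₂
      aux : B.ThreeCut (lookup X) → Shores G A bip cubic G₁ G₂ ⊎ Shores G A bip cubic G₂ G₁
      aux (B.outward o r) = inj₂ record { K = X ; C₁ = C₂′ ; C₂ = C₁ ; out≡3 = o ; into≡0 = r ; 2≤K = 2≤X ; 2≤∁K = 2≤∁X }
      aux (B.inward o r)  = inj₁ record { K = ∁ X ; C₁ = C₁ ; C₂ = C₂ ; out≡3 = trans (B.out-∁ all X) r ; into≡0 = trans (B.into-∁ all X) o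
                                        ; 2≤K = 2≤∁X ; 2≤∁K = subst (λ Y → 2 ≤ ∣ Y ∣) (sym (∁-involutive X)) 2≤X }

  middle-++ : ∀ Js₁ Js₂ → middle (Js₁ ++ Js₂) ≡ middle Js₁ + middle Js₂
  middle-++ Js₁ Js₂ = trans (cong₂ _+_ β≡ (cong (3 *_) b≡)) (lemma (β′ Js₁) (β′ Js₂) (b′ Js₁) (b′ Js₂))
    where
    large? : ∀ J → Dec (Bipartite J × 6 ≤ order J)
    large? J = bipartite? J ×-dec 6 ≤? order J
    square : Graph → ℕ
    square J = (order J / 2) ^ 2
    split : bracesOfOrder≥6 (Js₁ ++ Js₂) ≡ bracesOfOrder≥6 Js₁ ++ bracesOfOrder≥6 Js₂
    split = filter-++ large? Js₁ Js₂
    b≡ : b′ (Js₁ ++ Js₂) ≡ b′ Js₁ + b′ Js₂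
    b≡ = trans (cong length split) (length-++ (bracesOfOrder≥6 Js₁))
    β≡ : β′ (Js₁ ++ Js₂) ≡ β′ Js₁ + β′ Js₂
    β≡ = trans (cong (ListAction.sum ∘ map square) split) (trans (cong ListAction.sum (map-++ square (bracesOfOrder≥6 Js₁) _))
      (sum-++ (map square (bracesOfOrder≥6 Js₁)) _))
    lemma : ∀ a b c d → a + b + 3 * (c + d) ≡ a + 3 * c + (b + 3 * d)
    lemma = solve-∀

  bounds : ∀ {G Js} → TightCutDecomposition G Js → ∀ A → IsBipartition G A → Cubic G → EdgeConnected G → Bounds G A (middle Js)
  bounds (indecomposable tcf) A bip cubic ec = BraceBounds.bounds _ A bip cubic ec tcf
  bounds {G} (contract {G₁ = G₁} {G₂} {Js₁} {Js₂} X nt iso₁ iso₂ D₁ D₂) A bip cubic ec =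
    subst (Bounds G A) (sym (middle-++ Js₁ Js₂)) (aux (shores nt (fromContraction iso₁) (fromContraction iso₂)))
    where
    aux : Shores G A bip cubic G₁ G₂ ⊎ Shores G A bip cubic G₂ G₁ → Bounds G A (middle Js₁ + middle Js₂)
    aux (inj₁ S) = M.combined (bounds D₁ _ M.D₁.bip₁ M.cubic₁ M.ec₁) (bounds D₂ _ M.D₂.bip₁ M.cubic₂ M.ec₂)
      where
      open Shores S
      module M = Combine G A bip cubic ec C₁ C₂ out≡3 into≡0 2≤K 2≤∁K
    aux (inj₂ S) = subst (Bounds G A) (ℕₚ.+-comm (middle Js₂) (middle Js₁))
      (M.combined (bounds D₂ _ M.D₁.bip₁ M.cubic₁ M.ec₁) (bounds D₁ _ M.D₂.bip₁ M.cubic₂ M.ec₂))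
      where
      open Shores S
      module M = Combine G A bip cubic ec C₁ C₂ out≡3 into≡0 2≤K 2≤∁K

  -- No decomposition occurs in the statement, so any one may be used to eliminate `m` between
  -- `lower` and `upper`.
  ρ-bound : ∀ G A → IsBipartition G A → Cubic G → EdgeConnected G → 3 * order G ≤ ρ G A + 9
  ρ-bound G A bip cubic ec = by-≤ 0 (lower ⊕ upper) (lemma (order G) (ρ G A) (middle Js))
    where
    Js = proj₁ (tightCutDecomposition G)
    open Bounds (bounds (proj₂ (tightCutDecomposition G)) A bip cubic ec)
    lemma : ∀ n ρ m → 3 * n + (ρ + 3 + (m + 6)) + 0 ≡ ρ + 9 + (m + 3 * n)
    lemma = solve-∀

  -- Isomorphisms and splicing

  ↔-to-injective : ∀ {S T : Set} (I : S ↔ T) {x y : S} → Inverse.to I x ≡ Inverse.to I y → x ≡ y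
  ↔-to-injective I {x} {y} eq = trans (sym (Inverse.strictlyInverseʳ I x)) (trans (cong (Inverse.from I) eq) (Inverse.strictlyInverseʳ I y))

  bijective⇒↔ : ∀ {S T : Set} (h : S → T) → (∀ {x y} → h x ≡ h y → x ≡ y) → (∀ y → ∃ λ x → h x ≡ y) → T ↔ S
  bijective⇒↔ h inj sur = mk↔ₛ′ (proj₁ ∘ sur) h (λ x → inj (proj₂ (sur (h x)))) (proj₂ ∘ sur)

  ≢⇒∁⁅⁆ : ∀ {n} {x y : Fin n} → x ≢ y → x ∈ ∁ ⁅ y ⁆
  ≢⇒∁⁅⁆ {x = x} {y} x≢y = lookup⇒∈ (trans (lookup-∁ ⁅ y ⁆ x) (cong not (trans (lookup-⁅⁆ y x) (≢⇒== x≢y))))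

  ∁⁅⁆⇒≢ : ∀ {n} {x y : Fin n} → x ∈ ∁ ⁅ y ⁆ → x ≢ y
  ∁⁅⁆⇒≢ {x = x} {y} i refl =
    true≢false (∈⇒lookup i) (trans (lookup-∁ ⁅ y ⁆ x) (cong not (trans (lookup-⁅⁆ y x) (==-refl x))))

  -- An edge determines its ends up to order, so one pair of ends for each edge decides adjacency in
  -- both directions.
  mkIso : ∀ {G H} (V : Vertex G ↔ Vertex H) (E : Edge G ↔ Edge H) →
          (∀ e → ∃₂ λ x y → Graph.Joins G e x y × Graph.Joins H (Inverse.to E e) (Inverse.to V x) (Inverse.to V y)) →
          ⌊ G ⌋ ≅ ⌊ H ⌋
  mkIso {G} {H} V E preserved = record { vertices = V ; edges = E ; joins = λ e x y → mk⇔ (to e) (from e) }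
    where
    module V = Inverse V
    module E = Inverse E
    to : ∀ e {x y} → Graph.Joins G e x y → Graph.Joins H (E.to e) (V.to x) (V.to y)
    to e j with preserved e
    ... | x , y , jG , jH with joins-unique G j jG
    ... | inj₁ (refl , refl) = jH
    ... | inj₂ (refl , refl) = joins-sym H jH
    from : ∀ e {x y} → Graph.Joins H (E.to e) (V.to x) (V.to y) → Graph.Joins G e x y
    from e j with preserved e
    ... | x , y , jG , jH with joins-unique H j jH
    ... | inj₁ (p , q) = subst₂ (Graph.Joins G e) (sym (↔-to-injective V p)) (sym (↔-to-injective V q)) jG
    ... | inj₂ (p , q) = subst₂ (Graph.Joins G e) (sym (↔-to-injective V p)) (sym (↔-to-injective V q)) (joins-sym G jG)

  partition : ∀ {n} (p : Subset n) → Fin n ↔ (Members p ⊎ Members (∁ p))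
  partition p = bijective⇒↔ from from-injective from-onto
    where
    from : Members p ⊎ Members (∁ p) → _
    from (inj₁ (x , _)) = x
    from (inj₂ (x , _)) = x
    from-injective : ∀ {x y} → from x ≡ from y → x ≡ y
    from-injective {inj₁ _}       {inj₁ _}       eq   = cong inj₁ (members-≡ eq)
    from-injective {inj₂ _}       {inj₂ _}       eq   = cong inj₂ (members-≡ eq)
    from-injective {inj₁ (x , i)} {inj₂ (_ , j)} refl = contradiction i (x∈∁p⇒x∉p j)
    from-injective {inj₂ (x , i)} {inj₁ (_ , j)} refl = contradiction j (x∈∁p⇒x∉p i)
    from-onto : ∀ x → ∃ λ m → from m ≡ x
    from-onto x = aux (lookup p x) refl
      where
      aux : ∀ b → lookup p x ≡ b → ∃ λ m → from m ≡ x
      aux true  eq = inj₁ (x , lookup⇒∈ eq) , refl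
      aux false eq = inj₂ (x , x∉p⇒x∈∁p (lookup⇒∉ eq)) , refl

  -- Each vertex of A has three edges, no two of them parallel, and B has only three vertices, so
  -- every vertex of A is joined to every vertex of B exactly once. `code` numbers the edges as in
  -- `K₃,₃`.
  module K₃,₃-characterisation (G : Graph) (A : Subset (order G)) (bip : IsBipartition G A) (cubic : Cubic G)
    (ec : EdgeConnected G) (3≤n : 3 ≤ order G) (numA≡3 : CubicBipartite.numA G A bip cubic all ≡ 3) where
    open CubicBipartite G A bip cubic
    open Simple G A bip cubic ec 3≤n

    private
      ∣A∣≡3 : ∣ A ∣ ≡ 3
      ∣A∣≡3 = trans (∣∣-sum A) (trans (sum-cong λ v → sym (ℕₚ.*-identityʳ _)) numA≡3)

      ∣∁A∣≡3 : ∣ ∁ A ∣ ≡ 3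
      ∣∁A∣≡3 = trans (∣∣-sum (∁ A)) (trans (sum-cong λ v → trans (cong 𝟙 (lookup-∁ A v)) (sym (ℕₚ.*-identityʳ _)))
        (trans (sym balanced) numA≡3))

      indexA : Members A ↔ Fin 3
      indexA = subst (λ n → Members A ↔ Fin n) ∣A∣≡3 (members A)

      indexB : Members (∁ A) ↔ Fin 3
      indexB = subst (λ n → Members (∁ A) ↔ Fin n) ∣∁A∣≡3 (members (∁ A))

      module iA = Inverse indexA
      module iB = Inverse indexB

      V : Vertex G ↔ Fin 6
      V = ↔-trans (partition A) (↔-trans (indexA ⊎-↔ indexB) (↔-sym +↔⊎))

      αₘ : Edge G → Members A
      αₘ e = α e , lookup⇒∈ (α∈A e)

      βₘ : Edge G → Members (∁ A)
      βₘ e = β e , x∉p⇒x∈∁p (lookup⇒∉ (β∉A e))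

      V-A : ∀ (x : Members A) → Inverse.to V (proj₁ x) ≡ iA.to x ↑ˡ 3
      V-A x = cong (Inverse.from +↔⊎ ∘ Inverse.to (indexA ⊎-↔ indexB)) (Inverse.strictlyInverseˡ (partition A) (inj₁ x))

      V-B : ∀ (x : Members (∁ A)) → Inverse.to V (proj₁ x) ≡ 3 ↑ʳ iB.to x
      V-B x = cong (Inverse.from +↔⊎ ∘ Inverse.to (indexA ⊎-↔ indexB)) (Inverse.strictlyInverseˡ (partition A) (inj₂ x))

      code : Edge G → Fin 9
      code e = combine (iA.to (αₘ e)) (iB.to (βₘ e))

      parallel : ∀ {e e′} → α e ≡ α e′ → β e ≡ β e′ → e ≡ e′
      parallel {e} {e′} p q with e ≟ e′
      ... | yes eq = eq
      ... | no e≢e′ = ⊥-elim (ℕₚ.<-irrefl refl (ℕₚ.≤-trans (subst₂ (λ m n → m + n ≤ multiplicity (α e) (β e))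
          (cong₂ (λ a b → 𝟙 (a ∧ b)) (==-refl (α e)) (==-refl (β e)))
          (cong₂ (λ a b → 𝟙 (a ∧ b)) (trans (cong (_== α e) (sym p)) (==-refl (α e))) (trans (cong (_== β e) (sym q)) (==-refl (β e))))
          (terms≤sum (λ e″ → 𝟙 (α e″ == α e ∧ β e″ == β e)) e≢e′)) (multiplicity≤1 (α∈A e) (β∉A e))))

      code-injective : ∀ {e e′} → code e ≡ code e′ → e ≡ e′
      code-injective {e} {e′} eq = let p , q = combine-injective (iA.to (αₘ e)) (iB.to (βₘ e)) _ _ eq in
        parallel (cong proj₁ (↔-to-injective indexA p)) (cong proj₁ (↔-to-injective indexB q))

      adjacent : ∀ {x y} → lookup A x ≡ true → lookup A y ≡ false → ∃ λ e → α e ≡ x × β e ≡ y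
      adjacent {x} {y} x∈A y∉A = let e , 0<e = 0<sum _ (ℕₚ.≤-reflexive (sym mult≡1)) ; p , q = ∧-true (1≤𝟙 0<e) in e , ==⇒≡ p , ==⇒≡ q
        where
        bound : ∀ w → multiplicity x w ≤ 𝟙 (not (lookup A w)) * 1
        bound w = aux (lookup A w) refl
          where
          aux : ∀ c → lookup A w ≡ c → multiplicity x w ≤ 𝟙 (not (lookup A w)) * 1
          aux true  w∈A = ℕₚ.≤-trans (ℕₚ.≤-reflexive (multiplicity-same w∈A)) z≤n
          aux false w∉A = subst (λ c → multiplicity x w ≤ 𝟙 (not c) * 1) (sym w∉A) (multiplicity≤1 x∈A w∉A)
        mult≡1 : multiplicity x y ≡ 1
        mult≡1 = trans (sum-mono-≡ bound (ℕₚ.≤-reflexive (trans (sym balanced) (trans numA≡3 (sym (multiplicity-total x∈A))))) y)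
          (cong (λ c → 𝟙 (not c) * 1) y∉A)

      code-onto : ∀ k → ∃ λ e → code e ≡ k
      code-onto k = let i , j = remQuot {3} 3 k
                        x , x∈A = iA.from i
                        y , y∈∁A = iB.from j
                        e , p , q = adjacent (∈⇒lookup x∈A) (∉⇒lookup (x∈∁p⇒x∉p y∈∁A))
                    in e , trans (cong₂ combine (trans (cong iA.to (members-≡ p)) (iA.strictlyInverseˡ i))
                                                (trans (cong iB.to (members-≡ q)) (iB.strictlyInverseˡ j))) (combine-remQuot {3} 3 k)

      E : Edge G ↔ Fin 9
      E = ↔-sym (bijective⇒↔ code code-injective code-onto)

      joins : ∀ e → Graph.Joins K₃,₃ (code e) (Inverse.to V (α e)) (Inverse.to V (β e))
      joins e = inj₁ (trans (cong (λ p → proj₁ p ↑ˡ 3 , 3 ↑ʳ proj₂ p) (remQuot-combine {3} {3} (iA.to (αₘ e)) (iB.to (βₘ e))))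
        (cong₂ _,_ (sym (V-A (αₘ e))) (sym (V-B (βₘ e)))))

    iso : ⌊ G ⌋ ≅ ⌊ K₃,₃ ⌋
    iso = mkIso {G} {K₃,₃} V E λ e → α e , β e , αβ-joins e , joins e

  joins-edge : ∀ G {e e′ x y} → e ≡ e′ → Graph.Joins G e x y → Graph.Joins G e′ x y
  joins-edge G refl j = j

  joins-left : ∀ G {e x x′ y} → x ≡ x′ → Graph.Joins G e x y → Graph.Joins G e x′ y
  joins-left G refl j = j

  contraction-iso : ∀ {G K G₁ G₂} → Contraction G K G₁ → ⌊ G₁ ⌋ ≅ ⌊ G₂ ⌋ → Contraction G K G₂
  contraction-iso {G} {K} {G₁} {G₂} C iso = record
    { apex        = V.to apex
    ; f           = V.to ∘ f
    ; f-outside   = cong V.to ∘ f-outside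
    ; f-inside    = λ x∈K eq → f-inside x∈K (↔-to-injective (_≅_.vertices iso) eq)
    ; f-injective = λ x∈K y∈K eq → f-injective x∈K y∈K (↔-to-injective (_≅_.vertices iso) eq)
    ; f-onto      = λ y y≢ → let x , x∈K , eq = f-onto (V.from y) (λ eq → y≢ (trans (sym (V.strictlyInverseˡ y)) (cong V.to eq))) in
                      x , x∈K , trans (cong V.to eq) (V.strictlyInverseˡ y)
    ; g           = g ∘ E.from
    ; g-injective = λ {e} {e′} eq → trans (sym (E.strictlyInverseˡ e)) (trans (cong E.to (g-injective eq)) (E.strictlyInverseˡ e′))
    ; g-onto      = λ j x∈K → let e₁ , eq = g-onto j x∈K in E.to e₁ , trans (cong g (E.strictlyInverseʳ e₁)) eq
    ; joins       = λ e₂ j → joins-edge G₂ (E.strictlyInverseˡ e₂)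
                      (Equivalence.to (_≅_.joins iso (E.from e₂) _ _) (joins (E.from e₂) j))
    }
    where
    open Contraction C
    module V = Inverse (_≅_.vertices iso)
    module E = Inverse (_≅_.edges iso)

  module _ {G : Graph} {K : Subset (order G)} {G₁ : Graph} (C : Contraction G K G₁) where
    open Contraction C

    f-back : ∀ {x y} → lookup K x ≡ true → f y ≡ f x → y ≡ x
    f-back {x} {y} x∈K eq = ==⇒≡ (trans (sym (f-== x∈K y)) (trans (cong (_== f x) eq) (==-refl (f x))))

    is-end : ∀ {e₁ z x} → Graph.Joins G₁ e₁ z (f x) → lookup K x ≡ true → ∃ λ w → Graph.Joins G (g e₁) x w
    is-end {e₁} {z} {x} j x∈K with joins-unique G₁ j (joins e₁ (inj₁ refl))
    ... | inj₁ (_ , fx≡) = proj₁ (Graph.ends G (g e₁)) , joins-left G (f-back x∈K (sym fx≡)) (inj₂ refl)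
    ... | inj₂ (_ , fx≡) = proj₂ (Graph.ends G (g e₁)) , joins-left G (f-back x∈K (sym fx≡)) (inj₁ refl)

    star-apex : ∀ {e₁ x y} → Graph.Joins G (g e₁) x y → lookup (Graph.∂ G₁ ⁅ apex ⁆) e₁ ≡ not (lookup K x) xor not (lookup K y)
    star-apex {e₁} {x} {y} j = trans (∂-joins G₁ (joins e₁ j) ⁅ apex ⁆)
      (cong₂ _xor_ (trans (lookup-⁅⁆ apex (f x)) (f-==apex x)) (trans (lookup-⁅⁆ apex (f y)) (f-==apex y)))

  both-ends : ∀ G {e x y w w′} → x ≢ y → Graph.Joins G e x w → Graph.Joins G e y w′ → Graph.Joins G e x y
  both-ends G x≢y j j′ with joins-unique G j j′
  ... | inj₁ (x≡y , _) = contradiction x≡y x≢y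
  ... | inj₂ (_ , w≡y) = subst (Graph.Joins G _ _) w≡y j

  -- Contracting both shores of a cut is undone by splicing: a cut edge occurs at the apex in both
  -- contractions, and `π` matches the two occurrences.
  module SplicingIso {G : Graph} {K K′ : Subset (order G)} (compl : ∀ x → lookup K′ x ≡ not (lookup K x))
    {G₁ G₂ : Graph} (C₁ : Contraction G K G₁) (C₂ : Contraction G K′ G₂) where
    private
      module C₁ = Contraction C₁
      module C₂ = Contraction C₂
      u = C₁.apex
      v = C₂.apex

      in′ : ∀ {x} → lookup K x ≡ false → lookup K′ x ≡ true
      in′ {x} x∉K = trans (compl x) (cong not x∉K)

      out′ : ∀ {x} → lookup K x ≡ true → lookup K′ x ≡ false
      out′ {x} x∈K = trans (compl x) (cong not x∈K)

      differ : ∀ a b → (a ≡ false → b ≡ true) → (a ≡ true → b ≡ false) → not a xor not b ≡ true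
      differ true  b _ h = cong not (h refl)
      differ false b h _ = cong (not ∘ not) (h refl)

      shared₁ : ∀ {e₁ e₂} → C₁.g e₁ ≡ C₂.g e₂ → lookup (Graph.∂ G₁ ⁅ u ⁆) e₁ ≡ true
      shared₁ {e₁} {e₂} eq = trans (star-apex C₁ j) (differ _ _ (C₁.not-outside e₁ j)
          (λ p → not-true (trans (sym (compl _)) (C₂.not-outside e₂ (joins-edge G eq j) (out′ p)))))
        where
        j : Graph.Joins G (C₁.g e₁) _ _
        j = inj₁ refl

      shared₂ : ∀ {e₁ e₂} → C₁.g e₁ ≡ C₂.g e₂ → lookup (Graph.∂ G₂ ⁅ v ⁆) e₂ ≡ true
      shared₂ {e₁} {e₂} eq = trans (star-apex C₂ j) (differ _ _ (C₂.not-outside e₂ j)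
          (λ p → trans (compl _) (cong not (C₁.not-outside e₁ (joins-edge G (sym eq) j) (not-true (trans (sym (compl _)) p))))))
        where
        j : Graph.Joins G (C₂.g e₂) _ _
        j = inj₁ refl

      xor-true : ∀ a b → not a xor not b ≡ true → (a ≡ true × b ≡ false) ⊎ (a ≡ false × b ≡ true)
      xor-true true  false _ = inj₁ (refl , refl)
      xor-true false true  _ = inj₂ (refl , refl)

      counterpart₁ : ∀ {e₁} → lookup (Graph.∂ G₁ ⁅ u ⁆) e₁ ≡ true → ∃ λ e₂ → C₂.g e₂ ≡ C₁.g e₁
      counterpart₁ {e₁} i with xor-true _ _ (trans (sym (star-apex C₁ {e₁} (inj₁ refl))) i)
      ... | inj₁ (_ , q) = C₂.g-onto (inj₂ refl) (in′ q)
      ... | inj₂ (p , _) = C₂.g-onto (inj₁ refl) (in′ p)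

      counterpart₂ : ∀ {e₂} → lookup (Graph.∂ G₂ ⁅ v ⁆) e₂ ≡ true → ∃ λ e₁ → C₁.g e₁ ≡ C₂.g e₂
      counterpart₂ {e₂} i with xor-true _ _ (trans (sym (star-apex C₂ {e₂} (inj₁ refl))) i)
      ... | inj₁ (_ , q) = C₁.g-onto (inj₂ refl) (trans (sym (not-involutive _)) (cong not (trans (sym (compl _)) q)))
      ... | inj₂ (p , _) = C₁.g-onto (inj₁ refl) (trans (sym (not-involutive _)) (cong not (trans (sym (compl _)) p)))

      partner₁ : Members (Graph.∂ G₁ ⁅ u ⁆) → Members (Graph.∂ G₂ ⁅ v ⁆)
      partner₁ (e₁ , i) = let e₂ , eq = counterpart₁ (∈⇒lookup i) in e₂ , lookup⇒∈ (shared₂ (sym eq))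

      partner₁-g : ∀ m → C₂.g (proj₁ (partner₁ m)) ≡ C₁.g (proj₁ m)
      partner₁-g (e₁ , i) = proj₂ (counterpart₁ (∈⇒lookup i))

    π : StarBijection G₁ G₂ u v
    π = ↔-sym (bijective⇒↔ partner₁
      (λ {m} {m′} eq → members-≡ (C₁.g-injective (trans (sym (partner₁-g m)) (trans (cong (C₂.g ∘ proj₁) eq) (partner₁-g m′)))))
      (λ (e₂ , j) → let e₁ , eq = counterpart₂ (∈⇒lookup j) ; m = e₁ , lookup⇒∈ (shared₁ eq) in
         m , members-≡ (C₂.g-injective (trans (partner₁-g m) eq))))

    private
      SV = SpliceVertex G₁ G₂ u v π
      SE = SpliceEdge G₁ G₂ u v π
      SJ = SpliceJoins G₁ G₂ u v π

      place : ∀ x b → lookup K x ≡ b → SV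
      place x true  x∈K = inj₁ (C₁.f x , ≢⇒∁⁅⁆ (C₁.f-inside x∈K))
      place x false x∉K = inj₂ (C₂.f x , ≢⇒∁⁅⁆ (C₂.f-inside (in′ x∉K)))

      toV : Vertex G → SV
      toV x = place x _ refl

      toV-in : ∀ {x} → lookup K x ≡ true → (i : C₁.f x ∈ ∁ ⁅ u ⁆) → toV x ≡ inj₁ (C₁.f x , i)
      toV-in {x} x∈K i = aux _ refl
        where
        aux : ∀ b (eq : lookup K x ≡ b) → place x b eq ≡ inj₁ (C₁.f x , i)
        aux true  _  = cong inj₁ (members-≡ refl)
        aux false eq = ⊥-elim (true≢false x∈K eq)

      toV-out : ∀ {x} → lookup K x ≡ false → (i : C₂.f x ∈ ∁ ⁅ v ⁆) → toV x ≡ inj₂ (C₂.f x , i)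
      toV-out {x} x∉K i = aux _ refl
        where
        aux : ∀ b (eq : lookup K x ≡ b) → place x b eq ≡ inj₂ (C₂.f x , i)
        aux false _  = cong inj₂ (members-≡ refl)
        aux true  eq = ⊥-elim (true≢false eq x∉K)

      toV-inj₁ : ∀ {x m} → toV x ≡ inj₁ m → lookup K x ≡ true × C₁.f x ≡ proj₁ m
      toV-inj₁ {x} {m} = aux _ refl
        where
        aux : ∀ b (eq : lookup K x ≡ b) → place x b eq ≡ inj₁ m → lookup K x ≡ true × C₁.f x ≡ proj₁ m
        aux true eq refl = eq , refl

      toV-inj₂ : ∀ {x m} → toV x ≡ inj₂ m → lookup K x ≡ false × C₂.f x ≡ proj₁ m
      toV-inj₂ {x} {m} = aux _ refl
        where
        aux : ∀ b (eq : lookup K x ≡ b) → place x b eq ≡ inj₂ m → lookup K x ≡ false × C₂.f x ≡ proj₁ m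
        aux false eq refl = eq , refl

      toV-injective : ∀ {x y} → toV x ≡ toV y → x ≡ y
      toV-injective {x} {y} eq = aux (toV y) refl
        where
        aux : ∀ s → toV y ≡ s → x ≡ y
        aux (inj₁ m) eq′ = let x∈K , p = toV-inj₁ {m = m} (trans eq eq′) ; y∈K , q = toV-inj₁ {m = m} eq′ in C₁.f-injective x∈K y∈K (trans p (sym q))
        aux (inj₂ m) eq′ = let x∉K , p = toV-inj₂ {m = m} (trans eq eq′) ; y∉K , q = toV-inj₂ {m = m} eq′ in C₂.f-injective (in′ x∉K) (in′ y∉K) (trans p (sym q))

      toV-onto : ∀ s → ∃ λ x → toV x ≡ s
      toV-onto (inj₁ (y , i)) = let x , x∈K , eq = C₁.f-onto y (∁⁅⁆⇒≢ i) in
        x , trans (toV-in x∈K (subst (_∈ ∁ ⁅ u ⁆) (sym eq) i)) (cong inj₁ (members-≡ eq))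
      toV-onto (inj₂ (y , i)) = let x , x∈K′ , eq = C₂.f-onto y (∁⁅⁆⇒≢ i) in
        x , trans (toV-out (trans (sym (not-involutive _)) (cong not (trans (sym (compl x)) x∈K′))) (subst (_∈ ∁ ⁅ v ⁆) (sym eq) i)) (cong inj₂ (members-≡ eq))

      fromE : SE → Edge G
      fromE (inj₁ (e₁ , _))        = C₁.g e₁
      fromE (inj₂ (inj₁ (e₂ , _))) = C₂.g e₂
      fromE (inj₂ (inj₂ (e₁ , _))) = C₁.g e₁

      off : ∀ {n} {p : Subset n} {x} → x ∈ ∁ p → lookup p x ≡ true → ⊥
      off i eq = x∈∁p⇒x∉p i (lookup⇒∈ eq)

      fromE-injective : ∀ {s t} → fromE s ≡ fromE t → s ≡ t
      fromE-injective {inj₁ _}              {inj₁ _}              eq = cong inj₁ (members-≡ (C₁.g-injective eq))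
      fromE-injective {inj₁ (_ , i)}        {inj₂ (inj₁ _)}       eq = ⊥-elim (off i (shared₁ eq))
      fromE-injective {inj₁ (_ , i)}        {inj₂ (inj₂ (_ , j))} eq = ⊥-elim (off i (trans (cong (lookup (Graph.∂ G₁ ⁅ u ⁆)) (C₁.g-injective eq)) (∈⇒lookup j)))
      fromE-injective {inj₂ (inj₁ _)}       {inj₁ (_ , i)}        eq = ⊥-elim (off i (shared₁ (sym eq)))
      fromE-injective {inj₂ (inj₁ _)}       {inj₂ (inj₁ _)}       eq = cong (inj₂ ∘ inj₁) (members-≡ (C₂.g-injective eq))
      fromE-injective {inj₂ (inj₁ (_ , i))} {inj₂ (inj₂ _)}       eq = ⊥-elim (off i (shared₂ (sym eq)))
      fromE-injective {inj₂ (inj₂ (_ , j))} {inj₁ (_ , i)}        eq = ⊥-elim (off i (trans (cong (lookup (Graph.∂ G₁ ⁅ u ⁆)) (sym (C₁.g-injective eq))) (∈⇒lookup j)))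
      fromE-injective {inj₂ (inj₂ _)}       {inj₂ (inj₁ (_ , i))} eq = ⊥-elim (off i (shared₂ eq))
      fromE-injective {inj₂ (inj₂ _)}       {inj₂ (inj₂ _)}       eq = cong (inj₂ ∘ inj₂) (members-≡ (C₁.g-injective eq))

      fromE-onto : ∀ e → ∃ λ s → fromE s ≡ e
      fromE-onto e = aux _ _ refl refl
        where
        hit₁ : ∀ e₁ → ∃ λ s → fromE s ≡ C₁.g e₁
        hit₁ e₁ = go (lookup (Graph.∂ G₁ ⁅ u ⁆) e₁) refl
          where
          go : ∀ b → lookup (Graph.∂ G₁ ⁅ u ⁆) e₁ ≡ b → ∃ λ s → fromE s ≡ C₁.g e₁
          go true  eq = inj₂ (inj₂ (e₁ , lookup⇒∈ eq)) , refl
          go false eq = inj₁ (e₁ , x∉p⇒x∈∁p (lookup⇒∉ eq)) , refl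
        onto₁ : (∃ λ e₁ → C₁.g e₁ ≡ e) → ∃ λ s → fromE s ≡ e
        onto₁ (e₁ , eq) = let s , p = hit₁ e₁ in s , trans p eq
        aux : ∀ a b → lookup K (proj₁ (Graph.ends G e)) ≡ a → lookup K (proj₂ (Graph.ends G e)) ≡ b → ∃ λ s → fromE s ≡ e
        aux true  _     p q = onto₁ (C₁.g-onto (inj₁ refl) p)
        aux false true  p q = onto₁ (C₁.g-onto (inj₂ refl) q)
        aux false false p q = let e₂ , eq = C₂.g-onto {e} (inj₁ refl) (in′ p) in
          inj₂ (inj₁ (e₂ , x∉p⇒x∈∁p (lookup⇒∉ (trans (star-apex C₂ (joins-edge G (sym eq) (inj₁ refl)))
            (cong₂ (λ a b → not a xor not b) (in′ p) (in′ q)))))) , eq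

      same : ∀ a b → not a xor not b ≡ false → (a ≡ false → b ≡ true) → a ≡ true × b ≡ true
      same true  true  _ _ = refl , refl
      same false false _ h with () ← h refl

      joins-to : ∀ s {x y} → Graph.Joins G (fromE s) x y → SJ s (toV x) (toV y)
      joins-to (inj₁ (e₁ , i)) {x} {y} j =
        let x∈K , y∈K = same _ _ (trans (sym (star-apex C₁ j)) (∉⇒lookup (x∈∁p⇒x∉p i))) (C₁.not-outside e₁ j) in
        subst₂ (SJ _) (sym (toV-in x∈K (≢⇒∁⁅⁆ (C₁.f-inside x∈K)))) (sym (toV-in y∈K (≢⇒∁⁅⁆ (C₁.f-inside y∈K)))) (left (C₁.joins e₁ j))
      joins-to (inj₂ (inj₁ (e₂ , i))) {x} {y} j =
        let x∈K′ , y∈K′ = same _ _ (trans (sym (star-apex C₂ j)) (∉⇒lookup (x∈∁p⇒x∉p i))) (C₂.not-outside e₂ j) in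
        subst₂ (SJ _) (sym (toV-out (flip x x∈K′) (≢⇒∁⁅⁆ (C₂.f-inside x∈K′)))) (sym (toV-out (flip y y∈K′) (≢⇒∁⁅⁆ (C₂.f-inside y∈K′)))) (right (C₂.joins e₂ j))
        where
        flip : ∀ x → lookup K′ x ≡ true → lookup K x ≡ false
        flip x x∈K′ = trans (sym (not-involutive _)) (cong not (trans (sym (compl x)) x∈K′))
      joins-to (inj₂ (inj₂ m@(e₁ , i))) {x} {y} j = aux (xor-true _ _ (trans (sym (star-apex C₁ j)) (∈⇒lookup i)))
        where
        j₂ : Graph.Joins G (C₂.g (proj₁ (partner₁ m))) x y
        j₂ = subst (λ e → Graph.Joins G e x y) (sym (partner₁-g m)) j
        aux : (lookup K x ≡ true × lookup K y ≡ false) ⊎ (lookup K x ≡ false × lookup K y ≡ true) → SJ (inj₂ (inj₂ m)) (toV x) (toV y)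
        aux (inj₁ (x∈K , y∉K)) = subst₂ (SJ _) (sym (toV-in x∈K (≢⇒∁⁅⁆ (C₁.f-inside x∈K)))) (sym (toV-out y∉K (≢⇒∁⁅⁆ (C₂.f-inside (in′ y∉K)))))
          (link (joins-left G₁ (C₁.f-outside y∉K) (C₁.joins e₁ (joins-sym G j)))
                (joins-left G₂ (C₂.f-outside (out′ x∈K)) (C₂.joins (proj₁ (partner₁ m)) j₂)))
        aux (inj₂ (x∉K , y∈K)) = subst₂ (SJ _) (sym (toV-out x∉K (≢⇒∁⁅⁆ (C₂.f-inside (in′ x∉K))))) (sym (toV-in y∈K (≢⇒∁⁅⁆ (C₁.f-inside y∈K))))
          (link′ (joins-left G₁ (C₁.f-outside x∉K) (C₁.joins e₁ j))
                 (joins-left G₂ (C₂.f-outside (out′ y∈K)) (C₂.joins (proj₁ (partner₁ m)) (joins-sym G j₂))))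

      across : ∀ m {x y} → lookup K x ≡ true → lookup K y ≡ false →
               Graph.Joins G₁ (proj₁ m) u (C₁.f x) → Graph.Joins G₂ (proj₁ (partner₁ m)) v (C₂.f y) → Graph.Joins G (C₁.g (proj₁ m)) x y
      across m {x} {y} x∈K y∉K j₁ j₂ = both-ends G (λ { refl → true≢false x∈K y∉K }) (proj₂ (is-end C₁ j₁ x∈K))
        (joins-edge G (partner₁-g m) (proj₂ (is-end C₂ j₂ (in′ y∉K))))

      joins-from : ∀ s {x y X Y} → toV x ≡ X → toV y ≡ Y → SJ s X Y → Graph.Joins G (fromE s) x y
      joins-from _ {x} {y} p q (left {e₁ , _} {m} {m′} j) =
        let x∈K , fx = toV-inj₁ {m = m} p ; y∈K , fy = toV-inj₁ {m = m′} q
            j′ = subst₂ (Graph.Joins G₁ e₁) (sym fx) (sym fy) j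
        in both-ends G (λ x≡y → joins-≢ G₁ j′ (cong C₁.f x≡y)) (proj₂ (is-end C₁ (joins-sym G₁ j′) x∈K)) (proj₂ (is-end C₁ j′ y∈K))
      joins-from _ {x} {y} p q (right {e₂ , _} {m} {m′} j) =
        let x∉K , fx = toV-inj₂ {m = m} p ; y∉K , fy = toV-inj₂ {m = m′} q
            j′ = subst₂ (Graph.Joins G₂ e₂) (sym fx) (sym fy) j
        in both-ends G (λ x≡y → joins-≢ G₂ j′ (cong C₂.f x≡y)) (proj₂ (is-end C₂ (joins-sym G₂ j′) (in′ x∉K))) (proj₂ (is-end C₂ j′ (in′ y∉K)))
      joins-from _ {x} {y} p q (link {m} {m₁} {m₂} j₁ j₂) =
        let x∈K , fx = toV-inj₁ {m = m₁} p ; y∉K , fy = toV-inj₂ {m = m₂} q in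
        across m x∈K y∉K (subst (Graph.Joins G₁ _ u) (sym fx) j₁) (subst (Graph.Joins G₂ _ v) (sym fy) j₂)
      joins-from _ {x} {y} p q (link′ {m} {m₁} {m₂} j₁ j₂) =
        let y∈K , fy = toV-inj₁ {m = m₁} q ; x∉K , fx = toV-inj₂ {m = m₂} p in
        joins-sym G (across m y∈K x∉K (subst (Graph.Joins G₁ _ u) (sym fy) j₁) (subst (Graph.Joins G₂ _ v) (sym fx) j₂))

      E : Edge G ↔ SE
      E = bijective⇒↔ fromE fromE-injective fromE-onto

    iso : ⌊ G ⌋ ≅ splicing G₁ G₂ u v π
    iso = record
      { vertices = ↔-sym (bijective⇒↔ toV toV-injective toV-onto)
      ; edges    = E
      ; joins    = λ e x y → mk⇔
          (λ j → joins-to (Inverse.to E e) (subst (λ e → Graph.Joins G e x y) (sym (Inverse.strictlyInverseʳ E e)) j))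
          (λ j → subst (λ e → Graph.Joins G e x y) (Inverse.strictlyInverseʳ E e) (joins-from (Inverse.to E e) refl refl j))
      }

  -- Graphs with ρ = 3n - 9 belong to 𝒦

  mod3 : ∀ {x y o r} → 3 * x + r ≡ 3 * y + o → r % 3 ≡ o % 3
  mod3 {x} {y} {o} {r} eq = trans (sym (remainder x r)) (trans (cong (_% 3) eq) (remainder y o))
    where
    remainder : ∀ x r → (3 * x + r) % 3 ≡ r % 3
    remainder x r = trans (cong (_% 3) (trans (ℕₚ.+-comm (3 * x) r) (cong (r +_) (ℕₚ.*-comm 3 x)))) ([m+kn]%n≡m%n r x 3)

  ∂-∁ : ∀ G X → Graph.∂ G (∁ X) ≡ Graph.∂ G X
  ∂-∁ G X = subset-≡ λ e → trans (∂-joins G (inj₁ refl) (∁ X)) (trans (cong₂ _xor_ (lookup-∁ X _) (lookup-∁ X _))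
    (trans (not-xor (lookup X _) (lookup X _)) (sym (∂-joins G (inj₁ refl) X))))

  nontrivial-∁ : ∀ {G X} → NontrivialTight G X → NontrivialTight G (∁ X)
  nontrivial-∁ {G} {X} (2≤X , 2≤∁X , tight) =
    2≤∁X , subst (λ Y → 2 ≤ ∣ Y ∣) (sym (∁-involutive X)) 2≤X , λ M pm → trans (cong (λ C → ∣ C ∩ M ∣) (∂-∁ G X)) (tight M pm)

  nontrivialTight? : ∀ G → Dec (∃ (NontrivialTight G))
  nontrivialTight? G = anySubset? λ X → 2 ≤? ∣ X ∣ ×-dec 2 ≤? ∣ ∁ X ∣ ×-dec tight? G X

  -- By `cubic-balance`, `out` and `into` agree modulo 3. With sum 3 this leaves only 0 + 3 and 3 +
  -- 0.
  size3⇒threeCut : ∀ G A (bip : IsBipartition G A) (cubic : Cubic G) X → ∣ Graph.∂ G X ∣ ≡ 3 →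
                   CubicBipartite.ThreeCut G A bip cubic (lookup X)
  size3⇒threeCut G A bip cubic X eq = aux _ _ refl refl (trans (sym (∣∂X∣ X)) eq) (mod3 {numA S} {numB S} (cubic-balance S))
    where
    open CubicBipartite G A bip cubic
    S = lookup X
    aux : ∀ o r → out all S ≡ o → into all S ≡ r → out all S + into all S ≡ 3 → into all S % 3 ≡ out all S % 3 → ThreeCut S
    aux o r p q = subst₂ (λ o r → o + r ≡ 3 → r % 3 ≡ o % 3 → ThreeCut S) (sym p) (sym q) (go o r p q)
      where
      go : ∀ o r → out all S ≡ o → into all S ≡ r → o + r ≡ 3 → r % 3 ≡ o % 3 → ThreeCut S
      go 0 _ p q refl _ = inward p q
      go 1 _ p q refl ()
      go 2 _ p q refl ()
      go 3 _ p q refl _ = outward p q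
      go (suc (suc (suc (suc _)))) _ p q () _

  module Shrink (G : Graph) (A : Subset (order G)) (bip : IsBipartition G A) (cubic : Cubic G)
    {K : Subset (order G)} {G₁ : Graph} (C : Contraction G K G₁) {c : Bool} (outer : Outer G A K c)
    (cubic₁ : Cubic G₁) (2≤∁K : 2 ≤ ∣ ∁ K ∣) where
    open Contraction C
    open Contracted G A bip C c outer using (A₁; bip₁; preimage; ∣∂preimage∣)
    private
      module B  = CubicBipartite G A bip cubic
      module B₁ = CubicBipartite G₁ A₁ bip₁ cubic₁

    -- As `Y` misses `apex`, its preimage lies in `K` and has the same size and the same cut;
    -- tightness passes through the size 3 of the cut. The inequality is strict because `∁ Y` has a
    -- vertex besides `apex`.
    pullback : ∀ Y → NontrivialTight G₁ Y → lookup Y apex ≡ false → ∃ λ X → NontrivialTight G X × ∣ X ∣ < ∣ K ∣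
    pullback Y (2≤Y , 2≤∁Y , tight) apex∉Y =
      X , (subst (2 ≤_) ∣Y∣≡ 2≤Y , 2≤∁X , B.threeCut⇒tight X (size3⇒threeCut G A bip cubic X
        (trans (sym (∣∂preimage∣ Y)) (trans (B₁.∣∂X∣ Y) (size≡3 (B₁.tight⇒threeCut Y (proj₂ (nonempty Y 2≤Y)) tight)))))) ,
      subst (_< ∣ K ∣) ∣Y∣≡ (ℕₚ.≤-pred (by-≤ 0 (2≤∁Y ⊕ ℕₚ.≤-reflexive (trans (∣p∣+∣∁p∣ Y) order₁)) (lemma (∣ Y ∣) (∣ ∁ Y ∣) (∣ K ∣))))
      where
      X = preimage Y
      lemma : ∀ y ȳ k → suc (suc y) + (ȳ + suc k) + 0 ≡ suc k + (2 + (y + ȳ))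
      lemma = solve-∀
      size≡3 : B₁.ThreeCut (lookup Y) → B₁.out all (lookup Y) + B₁.into all (lookup Y) ≡ 3
      size≡3 (B₁.outward p q) = cong₂ _+_ p q
      size≡3 (B₁.inward p q)  = cong₂ _+_ p q
      X≡ : ∀ x → lookup X x ≡ lookup Y (f x)
      X≡ x = lookup∘tabulate (lookup Y ∘ f) x
      ∣Y∣≡ : ∣ Y ∣ ≡ ∣ X ∣
      ∣Y∣≡ = trans (∣∣-sum Y) (trans (sum-vertices (𝟙 ∘ lookup Y)) (trans (cong (λ b → 𝟙 b + sum (λ x → 𝟙 (lookup K x) * 𝟙 (lookup Y (f x)))) apex∉Y)
        (trans (sum-cong λ x → aux x (lookup K x) refl) (sym (∣∣-sum X)))))
        where
        aux : ∀ x b → lookup K x ≡ b → 𝟙 (lookup K x) * 𝟙 (lookup Y (f x)) ≡ 𝟙 (lookup X x)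
        aux x true  eq = trans (cong (λ b → 𝟙 b * 𝟙 (lookup Y (f x))) eq) (trans (ℕₚ.*-identityˡ _) (cong 𝟙 (sym (X≡ x))))
        aux x false eq = trans (cong (λ b → 𝟙 b * 𝟙 (lookup Y (f x))) eq)
          (sym (cong 𝟙 (trans (X≡ x) (trans (cong (lookup Y) (f-outside eq)) apex∉Y))))
      2≤∁X : 2 ≤ ∣ ∁ X ∣
      2≤∁X = ℕₚ.≤-trans 2≤∁K (subst₂ _≤_ (sym (∣∣-sum (∁ K))) (sym (∣∣-sum (∁ X))) (sum-mono λ x → aux x (lookup K x) refl))
        where
        aux : ∀ x b → lookup K x ≡ b → 𝟙 (lookup (∁ K) x) ≤ 𝟙 (lookup (∁ X) x)
        aux x true  eq = ℕₚ.≤-trans (ℕₚ.≤-reflexive (cong 𝟙 (trans (lookup-∁ K x) (cong not eq)))) z≤n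
        aux x false eq = ℕₚ.≤-trans (𝟙≤1 (lookup (∁ K) x)) (ℕₚ.≤-reflexive (sym (cong 𝟙 (trans (lookup-∁ X x)
          (cong not (trans (X≡ x) (trans (cong (lookup Y) (f-outside eq)) apex∉Y)))))))

    descend : ∀ Y → NontrivialTight G₁ Y → ∃ λ X → NontrivialTight G X × ∣ X ∣ < ∣ K ∣
    descend Y nt = aux (lookup Y apex) refl
      where
      aux : ∀ b → lookup Y apex ≡ b → ∃ λ X → NontrivialTight G X × ∣ X ∣ < ∣ K ∣
      aux false eq = pullback Y nt eq
      aux true  eq = pullback (∁ Y) (nontrivial-∁ {G₁} {Y} nt) (trans (lookup-∁ Y apex) (cong not eq))

  module _ (G : Graph) (A : Subset (order G)) (bip : IsBipartition G A) (cubic : Cubic G) where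

    private
      smaller-cut : ∀ X → NontrivialTight G X → ∃ (NontrivialTight (Contract.graph G (∁ X))) → ∃ λ X′ → NontrivialTight G X′ × ∣ X′ ∣ < ∣ X ∣
      smaller-cut X nt (Y , ntY) =
        aux (shores {bip = bip} {cubic} nt (fromContraction (Contract.iso G X)) (fromContraction (Contract.iso G (∁ X))))
        where
        C : Contraction G (∁ (∁ X)) (Contract.graph G (∁ X))
        C = fromContraction (Contract.iso G (∁ X))
        orderX : order (Contract.graph G (∁ X)) ≡ suc ∣ X ∣
        orderX = trans (Contraction.order₁ C) (cong (λ Z → suc ∣ Z ∣) (∁-involutive X))
        -- `Shores` does not record how its `K` relates to `X`. The order of the contraction gives
        -- the equality of sizes, which is all the descent uses.
        rebase : ∀ (K : Subset (order G)) → order (Contract.graph G (∁ X)) ≡ suc ∣ K ∣ → (∃ λ X′ → NontrivialTight G X′ × ∣ X′ ∣ < ∣ K ∣) → ∃ λ X′ → NontrivialTight G X′ × ∣ X′ ∣ < ∣ X ∣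
        rebase K eq (X′ , nt′ , lt) = X′ , nt′ , subst (∣ X′ ∣ <_) (ℕₚ.suc-injective (trans (sym eq) orderX)) lt
        aux : Shores G A bip cubic (Contract.graph G X) (Contract.graph G (∁ X)) ⊎ Shores G A bip cubic (Contract.graph G (∁ X)) (Contract.graph G X) →
              ∃ λ X′ → NontrivialTight G X′ × ∣ X′ ∣ < ∣ X ∣
        aux (inj₁ S) = rebase (∁ K) (Contraction.order₁ C₂) (Shrink.descend G A bip cubic C₂ M.outer₂ M.cubic₂
            (subst (λ Z → 2 ≤ ∣ Z ∣) (sym (∁-involutive K)) 2≤K) Y ntY)
          where
          open Shores S
          module M = Split G A bip cubic C₁ C₂ out≡3 into≡0
        aux (inj₂ S) = rebase K (Contraction.order₁ C₁) (Shrink.descend G A bip cubic C₁ M.outer₁ M.cubic₁ 2≤∁K Y ntY)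
          where
          open Shores S
          module M = Split G A bip cubic C₁ C₂ out≡3 into≡0

    -- Descent on the size of the shore, with `k` as a bound: a nontrivial tight cut of the graph
    -- that keeps `X` comes from a smaller shore in `G`.
    leaf-cut : ∀ k X → ∣ X ∣ ≤ k → NontrivialTight G X → ∃ λ X′ → NontrivialTight G X′ × TightCutFree (Contract.graph G (∁ X′))
    leaf-cut zero    X ∣X∣≤0 (2≤X , _) = contradiction (ℕₚ.≤-trans 2≤X ∣X∣≤0) λ ()
    leaf-cut (suc k) X ∣X∣≤k nt = aux (nontrivialTight? (Contract.graph G (∁ X)))
      where
      aux : Dec (∃ (NontrivialTight (Contract.graph G (∁ X)))) → ∃ λ X′ → NontrivialTight G X′ × TightCutFree (Contract.graph G (∁ X′))
      aux (no none)   = X , nt , λ Y ntY → none (Y , ntY)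
      aux (yes found) = let X′ , nt′ , lt = smaller-cut X nt found in leaf-cut k X′ (ℕₚ.≤-pred (ℕₚ.≤-trans lt ∣X∣≤k)) nt′

  -- With `ρ = k²` and `n = 2 k` the hypothesis says `(k - 3)² = 0`.
  sharp-brace⇒K₃,₃ : ∀ G A → IsBipartition G A → Cubic G → EdgeConnected G → TightCutFree G →
                     ρ G A + 9 ≡ 3 * order G → ⌊ G ⌋ ≅ ⌊ K₃,₃ ⌋
  sharp-brace⇒K₃,₃ G A bip cubic ec tcf eq = K₃,₃-characterisation.iso G A bip cubic ec
    (subst (3 ≤_) (sym (trans N.order≡ (cong (λ k → k + k) k≡3))) (s≤s (s≤s (s≤s z≤n)))) k≡3
    where
    module T = TightCutFreeGraph G A bip cubic ec tcf
    module N = Counting G A bip cubic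
    root : ∀ k → k * k + 9 ≡ 3 * (k + k) → k ≡ 3
    root 1 ()
    root 2 ()
    root (suc (suc (suc d))) eq = cong (3 +_) ([ (λ p → p) , (λ p → p) ]′ (ℕₚ.m*n≡0⇒m≡0∨n≡0 d (by-≡ eq (lemma d))))
      where
      lemma : ∀ d → d * d + 3 * (3 + d + (3 + d)) ≡ 0 + ((3 + d) * (3 + d) + 9)
      lemma = solve-∀
    k≡3 : T.k ≡ 3
    k≡3 = root T.k (trans (cong (_+ 9) (sym T.ρ≡k²)) (trans eq (cong (3 *_) N.order≡)))

  -- Induction on a bound `n` for the order. At a leaf cut `sharp` gives three things: the leaf is a
  -- sharp brace, the other part is sharp and so in 𝒦, and the apex of that part has exactly 3
  -- partners, as `splice` demands.
  sharp⇒𝒦 : ∀ n G A → order G ≤ n → IsBipartition G A → Cubic G → EdgeConnected G → ρ G A + 9 ≡ 3 * order G → 𝒦 G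
  sharp⇒𝒦 zero G A n≤0 bip cubic ec eq = contradiction (trans (ℕₚ.+-comm 9 (ρ G A)) (trans eq (cong (3 *_) (ℕₚ.n≤0⇒n≡0 n≤0)))) λ ()
  sharp⇒𝒦 (suc n) G A order≤ bip cubic ec eq = decide (nontrivialTight? G)
    where
    module _ (X : Subset (order G)) (nt : NontrivialTight G X) (tcf : TightCutFree (Contract.graph G (∁ X))) where
      G₁ = Contract.graph G X
      G₂ = Contract.graph G (∁ X)

      smaller : order G₁ ≤ n
      smaller = ℕₚ.≤-pred (ℕₚ.≤-trans (Contract.smaller G X (proj₁ nt)) order≤)

      assemble : Shores G A bip cubic G₁ G₂ ⊎ Shores G A bip cubic G₂ G₁ → 𝒦 G
      assemble (inj₁ S) =
        let (p≡3 , _) , eq₁ , eq₂ = M.sharp eq (ρ-bound G₁ M.D₁.A₁ M.D₁.bip₁ M.cubic₁ M.ec₁) (ρ-bound G₂ M.D₂.A₁ M.D₂.bip₁ M.cubic₂ M.ec₂)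
            C₂′ = contraction-iso C₂ (sharp-brace⇒K₃,₃ G₂ M.D₂.A₁ M.D₂.bip₁ M.cubic₂ M.ec₂ tcf eq₂)
        in splice M.D₁.A₁ (Contraction.apex C₁) (Contraction.apex C₂′) (SplicingIso.π (lookup-∁ K) C₁ C₂′)
             (sharp⇒𝒦 n G₁ M.D₁.A₁ smaller M.D₁.bip₁ M.cubic₁ M.ec₁ eq₁) M.D₁.bip₁ p≡3 (SplicingIso.iso (lookup-∁ K) C₁ C₂′)
        where
        open Shores S
        module M = Combine G A bip cubic ec C₁ C₂ out≡3 into≡0 2≤K 2≤∁K
      assemble (inj₂ S) =
        let (_ , q≡3) , eq₁ , eq₂ = M.sharp eq (ρ-bound G₂ M.D₁.A₁ M.D₁.bip₁ M.cubic₁ M.ec₁) (ρ-bound G₁ M.D₂.A₁ M.D₂.bip₁ M.cubic₂ M.ec₂)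
            C₁′ = contraction-iso C₁ (sharp-brace⇒K₃,₃ G₂ M.D₁.A₁ M.D₁.bip₁ M.cubic₁ M.ec₁ tcf eq₁)
        in splice M.D₂.A₁ (Contraction.apex C₂) (Contraction.apex C₁′) (SplicingIso.π compl C₂ C₁′)
             (sharp⇒𝒦 n G₁ M.D₂.A₁ smaller M.D₂.bip₁ M.cubic₂ M.ec₂ eq₂) M.D₂.bip₁ q≡3 (SplicingIso.iso compl C₂ C₁′)
        where
        open Shores S
        module M = Combine G A bip cubic ec C₁ C₂ out≡3 into≡0 2≤K 2≤∁K
        compl : ∀ x → lookup K x ≡ not (lookup (∁ K) x)
        compl x = sym (trans (cong not (lookup-∁ K x)) (not-involutive _))

    decide : Dec (∃ (NontrivialTight G)) → 𝒦 G
    decide (no none)      = base (sharp-brace⇒K₃,₃ G A bip cubic ec (λ X nt → none (X , nt)) eq)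
    decide (yes (X , nt)) = let X′ , nt′ , tcf = leaf-cut G A bip cubic (∣ X ∣) X ℕₚ.≤-refl nt in
      assemble X′ nt′ tcf (shores {bip = bip} {cubic} nt′ (fromContraction (Contract.iso G X′)) (fromContraction (Contract.iso G (∁ X′))))

  -- Members of 𝒦 satisfy ρ = 3n - 9

  module _ {G H : Graph} (iso : ⌊ G ⌋ ≅ ⌊ H ⌋) where
    private
      module V = Inverse (_≅_.vertices iso)
      module E = Inverse (_≅_.edges iso)

    iso-degree : ∀ M x → Graph.degree G (tabulate (lookup M ∘ E.to)) x ≡ Graph.degree H M (V.to x)
    iso-degree M x = begin
      Graph.degree G (tabulate (lookup M ∘ E.to)) x
        ≡⟨ ∣∩∣-sum (tabulate (lookup M ∘ E.to)) (Graph.∂ G ⁅ x ⁆) ⟩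
      sum (λ e → 𝟙 (lookup (tabulate (lookup M ∘ E.to)) e) * 𝟙 (lookup (Graph.∂ G ⁅ x ⁆) e))
        ≡⟨ sum-cong (λ e → cong₂ (λ a b → 𝟙 a * 𝟙 b) (lookup∘tabulate (lookup M ∘ E.to) e) (star e)) ⟩
      sum (λ e → 𝟙 (lookup M (E.to e)) * 𝟙 (lookup (Graph.∂ H ⁅ V.to x ⁆) (E.to e)))
        ≡⟨ sum-↔ (_≅_.edges iso) (λ e → 𝟙 (lookup M e) * 𝟙 (lookup (Graph.∂ H ⁅ V.to x ⁆) e)) ⟨
      sum (λ e → 𝟙 (lookup M e) * 𝟙 (lookup (Graph.∂ H ⁅ V.to x ⁆) e))
        ≡⟨ ∣∩∣-sum M (Graph.∂ H ⁅ V.to x ⁆) ⟨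
      Graph.degree H M (V.to x) ∎
      where
      open ≡-Reasoning
      V-== : ∀ y → y == x ≡ V.to y == V.to x
      V-== y = ≡-iff (λ p → trans (cong (λ z → V.to z == V.to x) (==⇒≡ p)) (==-refl (V.to x)))
                     (λ p → trans (cong (_== x) (↔-to-injective (_≅_.vertices iso) (==⇒≡ p))) (==-refl x))
      star : ∀ e → lookup (Graph.∂ G ⁅ x ⁆) e ≡ lookup (Graph.∂ H ⁅ V.to x ⁆) (E.to e)
      star e = trans (∂-joins G (inj₁ refl) ⁅ x ⁆) (trans
        (cong₂ _xor_ (trans (lookup-⁅⁆ x _) (trans (V-== _) (sym (lookup-⁅⁆ (V.to x) _))))
                     (trans (lookup-⁅⁆ x _) (trans (V-== _) (sym (lookup-⁅⁆ (V.to x) _)))))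
        (sym (∂-joins H (Equivalence.to (_≅_.joins iso e _ _) (inj₁ refl)) ⁅ V.to x ⁆)))

    iso-λ : ∀ {a b} → ∃ (IsλMatching H (V.to a) (V.to b)) → ∃ (IsλMatching G a b)
    iso-λ {a} {b} (M , da , db , rest) = tabulate (lookup M ∘ E.to) ,
      trans (iso-degree M a) da , trans (iso-degree M b) db ,
      λ v v∉ → trans (iso-degree M v) (rest (V.to v) (v∉ ∘ λ { (inj₁ p) → inj₁ (injective p) ; (inj₂ p) → inj₂ (injective p) }))
      where
      injective : ∀ {x y} → V.to x ≡ V.to y → x ≡ y
      injective = ↔-to-injective (_≅_.vertices iso)

  -- The witness consists of all edges at either of the two vertices: any other vertex keeps only
  -- its edge to the one on the opposite side. The nine cases are checked by evaluation.
  K₃,₃-λ : ∀ (i j : Fin 3) → ∃ (IsλMatching K₃,₃ (i ↑ˡ 3) (3 ↑ʳ j))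
  K₃,₃-λ i j = M i j , toWitness {a? = all? λ (i : Fin 3) → all? λ (j : Fin 3) → λMatching? K₃,₃ (i ↑ˡ 3) (3 ↑ʳ j) (M i j)} tt i j
    where
    M : Fin 3 → Fin 3 → Subset 9
    M i j = tabulate λ e → let i′ , j′ = remQuot {3} 3 e in i′ == i ∨ j′ == j

  module IsoK₃,₃ (G : Graph) (A : Subset (order G)) (bip : IsBipartition G A) (cubic : Cubic G) (iso : ⌊ G ⌋ ≅ ⌊ K₃,₃ ⌋) where
    open CubicBipartite G A bip cubic
    open Counting G A bip cubic
    private
      module V = Inverse (_≅_.vertices iso)
      module E = Inverse (_≅_.edges iso)

      adjacent : ∀ {a b} {i j : Fin 3} → V.to a ≡ i ↑ˡ 3 → V.to b ≡ 3 ↑ʳ j → ∃ λ e → Graph.Joins G e a b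
      adjacent {a} {b} {i} {j} p q = E.from (combine i j) , Equivalence.from (_≅_.joins iso (E.from (combine i j)) a b)
        (subst₂ (λ e ends → Graph.Joins K₃,₃ e (proj₁ ends) (proj₂ ends)) (sym (E.strictlyInverseˡ (combine i j)))
          (sym (cong₂ _,_ p q)) (inj₁ (cong (λ ij → proj₁ ij ↑ˡ 3 , 3 ↑ʳ proj₂ ij) (remQuot-combine {3} {3} i j))))

      opposite : ∀ {a b} {i j : Fin 3} → V.to a ≡ i ↑ˡ 3 → V.to b ≡ 3 ↑ʳ j → lookup A b ≡ not (lookup A a)
      opposite p q = joins-colours (proj₂ (adjacent p q))

      not-injective : ∀ {a b} → not a ≡ not b → a ≡ b
      not-injective {a} {b} eq = trans (sym (not-involutive a)) (trans (cong not eq) (not-involutive b))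

      side : ∀ x → (∃ λ (i : Fin 3) → V.to x ≡ i ↑ˡ 3) ⊎ (∃ λ (j : Fin 3) → V.to x ≡ 3 ↑ʳ j)
      side x with splitAt 3 (V.to x) in eq
      ... | inj₁ i = inj₁ (i , sym (splitAt⁻¹-↑ˡ eq))
      ... | inj₂ j = inj₂ (j , sym (splitAt⁻¹-↑ʳ eq))

    allMatchable : AllMatchable
    allMatchable {a} {b} a∈A b∉A = ⇒matchable (aux (side a) (side b))
      where
      aux : (∃ λ (i : Fin 3) → V.to a ≡ i ↑ˡ 3) ⊎ (∃ λ (j : Fin 3) → V.to a ≡ 3 ↑ʳ j) → (∃ λ (i : Fin 3) → V.to b ≡ i ↑ˡ 3) ⊎ (∃ λ (j : Fin 3) → V.to b ≡ 3 ↑ʳ j) →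
            ∃ (IsλMatching G a b)
      aux (inj₁ (i , p)) (inj₂ (j , q)) = iso-λ {G} {K₃,₃} iso (subst₂ (λ x y → ∃ (IsλMatching K₃,₃ x y)) (sym p) (sym q) (K₃,₃-λ i j))
      aux (inj₂ (j , p)) (inj₁ (i , q)) =
        let M , m = iso-λ {G} {K₃,₃} iso {b} {a} (subst₂ (λ x y → ∃ (IsλMatching K₃,₃ x y)) (sym q) (sym p) (K₃,₃-λ i j)) in M , λ-sym G {M = M} m
      -- Two vertices on the same side of `K₃,₃` have a common neighbour, here the one with index
      -- `zero`, and therefore the same colour in `A`.
      aux (inj₁ (i , p)) (inj₁ (i′ , q)) = ⊥-elim (true≢false a∈A (trans (not-injective
        (trans (sym (opposite {j = zero} p (V.strictlyInverseˡ _))) (opposite q (V.strictlyInverseˡ _)))) b∉A))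
      aux (inj₂ (j , p)) (inj₂ (j′ , q)) = ⊥-elim (true≢false a∈A (trans
        (trans (opposite {i = zero} (V.strictlyInverseˡ _) p) (sym (opposite (V.strictlyInverseˡ _) q))) b∉A))

    order≡6 : order G ≡ 6
    order≡6 = ↔⇒≡ (_≅_.vertices iso)

    numA≡3 : numA all ≡ 3
    numA≡3 = ℕₚ.*-cancelˡ-≡ _ 3 2 (trans (double (numA all)) (trans (sym order≡) order≡6))
      where
      double : ∀ k → 2 * k ≡ k + k
      double = solve-∀

    ρAt≡3 : ∀ v → ρAt G A v ≡ 3
    ρAt≡3 v = trans (ρAt-all allMatchable v) numA≡3

    ρ≡ : ρ G A + 9 ≡ 3 * order G
    ρ≡ = trans (cong (_+ 9) (trans (ρ-all allMatchable) (cong (λ k → k * k) numA≡3))) (sym (cong (3 *_) order≡6))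

  K₃,₃-iso : ⌊ K₃,₃ ⌋ ≅ ⌊ K₃,₃ ⌋
  K₃,₃-iso = mkIso {K₃,₃} {K₃,₃} (↔-id _) (↔-id _) λ e → _ , _ , inj₁ refl , inj₁ refl

  apex-degree : ∀ {G K G₁} (C : Contraction G K G₁) → ∣ Graph.∂ G₁ ⁅ Contraction.apex C ⁆ ∣ ≡ ∣ Graph.∂ G K ∣
  apex-degree {G} {K} {G₁} C = trans (∣∣-sum (Graph.∂ G₁ ⁅ apex ⁆)) (trans
    (sum-cong λ e₁ → cong 𝟙 (trans (star-apex C {e₁} (inj₁ refl)) (trans (not-xor (lookup K _) (lookup K _)) (sym (∂-joins G (inj₁ refl) K)))))
    (trans (sum-edges (𝟙 ∘ lookup (Graph.∂ G K)) (λ j p q → cong 𝟙 (trans (∂-joins G j K) (cong₂ _xor_ p q)))) (sym (∣∣-sum (Graph.∂ G K)))))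
    where
    open Contraction C

  -- One half of a splicing, described by partial maps from its vertices and
  -- edges to those of the spliced graph H.
  record Half (S : AbstractGraph) (H : Graph) (v : Vertex H) : Set where
    open AbstractGraph S
    field
      here?      : V → Bool
      val        : V → Vertex H
      val-out    : ∀ X → here? X ≡ false → val X ≡ v
      val-in     : ∀ X → here? X ≡ true → val X ≢ v
      val-inj    : ∀ X Y → here? X ≡ true → here? Y ≡ true → val X ≡ val Y → X ≡ Y
      val-onto   : ∀ y → y ≢ v → ∃ λ X → here? X ≡ true × val X ≡ y
      strip      : E → Maybe (Edge H)
      strip-inj  : ∀ s t {e} → strip s ≡ just e → strip t ≡ just e → s ≡ t
      strip-onto : ∀ e → ∃ λ s → strip s ≡ just e
      strip-def  : ∀ s X Y → Joins s X Y → here? X ≡ true → ∃ λ e → strip s ≡ just e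
      strip-join : ∀ s X Y {e} → Joins s X Y → strip s ≡ just e → Graph.Joins H e (val X) (val Y)

  module _ {G : Graph} {S : AbstractGraph} {H : Graph} {v : Vertex H} (iso : ⌊ G ⌋ ≅ S) (h : Half S H v) where
    open Half h
    private
      module V = Inverse (_≅_.vertices iso)
      module E = Inverse (_≅_.edges iso)

    shore : Subset (order G)
    shore = tabulate (here? ∘ V.to)

    lookup-shore : ∀ x → lookup shore x ≡ here? (V.to x)
    lookup-shore = lookup∘tabulate (here? ∘ V.to)

    private
      at : ∀ {x b} → lookup shore x ≡ b → here? (V.to x) ≡ b
      at {x} eq = trans (sym (lookup-shore x)) eq

      g : Edge H → Edge G
      g e = E.from (proj₁ (strip-onto e))

      strip-g : ∀ e → strip (E.to (g e)) ≡ just e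
      strip-g e = trans (cong strip (E.strictlyInverseˡ _)) (proj₂ (strip-onto e))

      g-injective : ∀ {e e′} → g e ≡ g e′ → e ≡ e′
      g-injective {e} {e′} eq = just-injective (trans (sym (strip-g e)) (trans (cong (strip ∘ E.to) eq) (strip-g e′)))

      g-onto : ∀ {e x y} → Graph.Joins G e x y → lookup shore x ≡ true → ∃ λ e₁ → g e₁ ≡ e
      g-onto {e} {x} {y} j x∈ = let e₁ , p = strip-def (E.to e) (V.to x) (V.to y) (Equivalence.to (_≅_.joins iso e x y) j) (at x∈) in
        e₁ , trans (cong E.from (strip-inj _ _ (proj₂ (strip-onto e₁)) p)) (E.strictlyInverseʳ e)

    half-contraction : Contraction G shore H
    half-contraction = record
      { apex        = v
      ; f           = val ∘ V.to
      ; f-outside   = λ {x} p → val-out (V.to x) (at p)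
      ; f-inside    = λ {x} p → val-in (V.to x) (at p)
      ; f-injective = λ {x} {y} p q eq → ↔-to-injective (_≅_.vertices iso) (val-inj (V.to x) (V.to y) (at p) (at q) eq)
      ; f-onto      = λ y y≢v → let X , p , q = val-onto y y≢v ; eq = V.strictlyInverseˡ X in
                        V.from X , trans (lookup-shore _) (trans (cong here? eq) p) , trans (cong val eq) q
      ; g           = g
      ; g-injective = g-injective
      ; g-onto      = g-onto
      ; joins       = λ e₁ {x} {y} j → strip-join (E.to (g e₁)) (V.to x) (V.to y) (Equivalence.to (_≅_.joins iso (g e₁) x y) j) (strip-g e₁)
      }

  module SpliceHalves (G G₁ G₂ : Graph) (u : Vertex G₁) (v : Vertex G₂) (π : StarBijection G₁ G₂ u v) where
    private
      module π = Inverse π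
      S = splicing G₁ G₂ u v π
      open AbstractGraph S

      off : ∀ {n} {p : Subset n} {x y} → x ∈ ∁ p → y ∈ p → x ≢ y
      off i j refl = x∈∁p⇒x∉p i j

      isLeft : V → Bool
      isLeft (inj₁ _) = true
      isLeft (inj₂ _) = false

      val₁ : V → Vertex G₁
      val₁ (inj₁ (x , _)) = x
      val₁ (inj₂ _)       = u

      val₂ : V → Vertex G₂
      val₂ (inj₁ _)       = v
      val₂ (inj₂ (x , _)) = x

      strip₁ : E → Maybe (Edge G₁)
      strip₁ (inj₁ (e , _))        = just e
      strip₁ (inj₂ (inj₁ _))       = nothing
      strip₁ (inj₂ (inj₂ (e , _))) = just e

      strip₂ : E → Maybe (Edge G₂)
      strip₂ (inj₁ _)              = nothing
      strip₂ (inj₂ (inj₁ (e , _))) = just e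
      strip₂ (inj₂ (inj₂ m))       = just (proj₁ (π.to m))

      strip₁-inj : ∀ s t {e} → strip₁ s ≡ just e → strip₁ t ≡ just e → s ≡ t
      strip₁-inj (inj₁ _)              (inj₁ _)              refl q    = cong inj₁ (members-≡ (sym (just-injective q)))
      strip₁-inj (inj₁ (_ , i))        (inj₂ (inj₂ (_ , j))) refl q    = contradiction (sym (just-injective q)) (off i j)
      strip₁-inj (inj₂ (inj₂ (_ , j))) (inj₁ (_ , i))        refl q    = contradiction (just-injective q) (off i j)
      strip₁-inj (inj₂ (inj₂ _))       (inj₂ (inj₂ _))       refl q    = cong (inj₂ ∘ inj₂) (members-≡ (sym (just-injective q)))

      strip₂-inj : ∀ s t {e} → strip₂ s ≡ just e → strip₂ t ≡ just e → s ≡ t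
      strip₂-inj (inj₂ (inj₁ _))       (inj₂ (inj₁ _))       refl q = cong (inj₂ ∘ inj₁) (members-≡ (sym (just-injective q)))
      strip₂-inj (inj₂ (inj₁ (_ , i))) (inj₂ (inj₂ m))       refl q = contradiction (sym (just-injective q)) (off i (proj₂ (π.to m)))
      strip₂-inj (inj₂ (inj₂ m))       (inj₂ (inj₁ (_ , i))) refl q = contradiction (just-injective q) (off i (proj₂ (π.to m)))
      strip₂-inj (inj₂ (inj₂ m))       (inj₂ (inj₂ m′))      refl q = cong (inj₂ ∘ inj₂) (↔-to-injective π (members-≡ (sym (just-injective q))))

      strip₁-onto : ∀ e → ∃ λ s → strip₁ s ≡ just e
      strip₁-onto e = aux (lookup (Graph.∂ G₁ ⁅ u ⁆) e) refl
        where
        aux : ∀ b → lookup (Graph.∂ G₁ ⁅ u ⁆) e ≡ b → ∃ λ s → strip₁ s ≡ just e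
        aux true  eq = inj₂ (inj₂ (e , lookup⇒∈ eq)) , refl
        aux false eq = inj₁ (e , x∉p⇒x∈∁p (lookup⇒∉ eq)) , refl

      strip₂-onto : ∀ e → ∃ λ s → strip₂ s ≡ just e
      strip₂-onto e = aux (lookup (Graph.∂ G₂ ⁅ v ⁆) e) refl
        where
        aux : ∀ b → lookup (Graph.∂ G₂ ⁅ v ⁆) e ≡ b → ∃ λ s → strip₂ s ≡ just e
        aux true  eq = inj₂ (inj₂ (π.from (e , lookup⇒∈ eq))) , cong (just ∘ proj₁) (π.strictlyInverseˡ (e , lookup⇒∈ eq))
        aux false eq = inj₂ (inj₁ (e , x∉p⇒x∈∁p (lookup⇒∉ eq))) , refl

      strip₁-def : ∀ s X Y → Joins s X Y → isLeft X ≡ true → ∃ λ e → strip₁ s ≡ just e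
      strip₁-def _ _ _ (left _)   _ = _ , refl
      strip₁-def _ _ _ (link _ _) _ = _ , refl

      strip₂-def : ∀ s X Y → Joins s X Y → not (isLeft X) ≡ true → ∃ λ e → strip₂ s ≡ just e
      strip₂-def _ _ _ (right _)   _ = _ , refl
      strip₂-def _ _ _ (link′ _ _) _ = _ , refl

      strip₁-join : ∀ s X Y {e} → Joins s X Y → strip₁ s ≡ just e → Graph.Joins G₁ e (val₁ X) (val₁ Y)
      strip₁-join _ _ _ (left j)    refl = j
      strip₁-join _ _ _ (link j _)  refl = joins-sym G₁ j
      strip₁-join _ _ _ (link′ j _) refl = j

      strip₂-join : ∀ s X Y {e} → Joins s X Y → strip₂ s ≡ just e → Graph.Joins G₂ e (val₂ X) (val₂ Y)
      strip₂-join _ _ _ (right j)   refl = j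
      strip₂-join _ _ _ (link _ j)  refl = j
      strip₂-join _ _ _ (link′ _ j) refl = joins-sym G₂ j

    half₁ : Half S G₁ u
    half₁ = record
      { here?      = isLeft
      ; val        = val₁
      ; val-out    = λ { (inj₂ _) _ → refl }
      ; val-in     = λ { (inj₁ (_ , i)) _ → ∁⁅⁆⇒≢ i }
      ; val-inj    = λ { (inj₁ _) (inj₁ _) _ _ eq → cong inj₁ (members-≡ eq) }
      ; val-onto   = λ y y≢u → inj₁ (y , ≢⇒∁⁅⁆ y≢u) , refl , refl
      ; strip      = strip₁
      ; strip-inj  = strip₁-inj
      ; strip-onto = strip₁-onto
      ; strip-def  = strip₁-def
      ; strip-join = strip₁-join
      }

    half₂ : Half S G₂ v
    half₂ = record
      { here?      = not ∘ isLeft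
      ; val        = val₂
      ; val-out    = λ { (inj₁ _) _ → refl }
      ; val-in     = λ { (inj₂ (_ , i)) _ → ∁⁅⁆⇒≢ i }
      ; val-inj    = λ { (inj₂ _) (inj₂ _) _ _ eq → cong inj₂ (members-≡ eq) }
      ; val-onto   = λ y y≢v → inj₂ (y , ≢⇒∁⁅⁆ y≢v) , refl , refl
      ; strip      = strip₂
      ; strip-inj  = strip₂-inj
      ; strip-onto = strip₂-onto
      ; strip-def  = strip₂-def
      ; strip-join = strip₂-join
      }

    -- The converse of `SplicingIso`: shrinking the vertices that come from one factor to a single
    -- vertex gives back the other factor, so the cut formula applies to splicings.
    halves : ⌊ G ⌋ ≅ S → ∃ λ K → Contraction G K G₁ × Contraction G (∁ K) G₂
    halves iso = K , half-contraction {G} iso half₁ , subst (λ K → Contraction G K G₂) complement (half-contraction {G} iso half₂)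
      where
      K = shore {G} iso half₁
      complement : shore {G} iso half₂ ≡ ∁ K
      complement = subset-≡ λ x → trans (lookup-shore {G} iso half₂ x) (sym (trans (lookup-∁ K x) (cong not (lookup-shore {G} iso half₁ x))))

  sharp-split : ∀ {ρ ρ₁ ρ₂ p q n n₁ n₂} → ρ + (p + q) ≡ ρ₁ + ρ₂ + p * q → p ≡ 3 → q ≡ 3 →
    ρ₁ + 9 ≡ 3 * n₁ → ρ₂ + 9 ≡ 3 * n₂ → n + 2 ≡ n₁ + n₂ → ρ + 9 ≡ 3 * n
  sharp-split {ρ} {ρ₁} {ρ₂} {n = n} {n₁} {n₂} eq refl refl eq₁ eq₂ order-eq =
    by-≡ (cong₂ _+_ (cong₂ _+_ eq (cong₂ _+_ eq₁ eq₂)) (cong (3 *_) (sym order-eq))) (lemma ρ ρ₁ ρ₂ n n₁ n₂)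
    where
    lemma : ∀ ρ ρ₁ ρ₂ n n₁ n₂ →
      ρ + 9 + (ρ₁ + ρ₂ + 9 + (3 * n₁ + 3 * n₂) + 3 * (n + 2))
      ≡ 3 * n + (ρ + 6 + (ρ₁ + 9 + (ρ₂ + 9)) + 3 * (n₁ + n₂))
    lemma = solve-∀

  K₃,₃-cubic : Cubic K₃,₃
  K₃,₃-cubic = toWitness {a? = all? λ v → ∣ Graph.∂ K₃,₃ ⁅ v ⁆ ∣ ℕₚ.≟ 3} _

  apex-subst : ∀ {G K K′ H} (eq : K ≡ K′) (C : Contraction G K H) →
               Contraction.apex (subst (λ K → Contraction G K H) eq C) ≡ Contraction.apex C
  apex-subst refl C = refl

  -- Stated for a copy Q of K₃,₃, since ρ of the concrete graph K₃,₃ would be evaluated.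
  splice-sharp : ∀ G A → IsBipartition G A → Cubic G → ∀ Q → ⌊ Q ⌋ ≅ ⌊ K₃,₃ ⌋ → Cubic Q →
    ∀ H → (∀ A₁ → IsBipartition H A₁ → Cubic H → ρ H A₁ + 9 ≡ 3 * order H) →
    ∀ v → (∀ A₁ → IsBipartition H A₁ → Cubic H → ρAt H A₁ v ≡ 3) →
    ∀ w (π : StarBijection H Q v w) → ⌊ G ⌋ ≅ splicing H Q v w π → ρ G A + 9 ≡ 3 * order G
  splice-sharp G A bip cubic Q Q-iso cubicQ H sharpH v sharpAt w π iso = aux (size3⇒threeCut G A bip cubic K ∣∂K∣≡3)
    where
    K  = proj₁ (SpliceHalves.halves G H Q v w π iso)
    C₁ : Contraction G K H
    C₁ = proj₁ (proj₂ (SpliceHalves.halves G H Q v w π iso))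
    C₂ : Contraction G (∁ K) Q
    C₂ = proj₂ (proj₂ (SpliceHalves.halves G H Q v w π iso))
    C₁′ : Contraction G (∁ (∁ K)) H
    C₁′ = subst (λ K → Contraction G K H) (sym (∁-involutive K)) C₁

    ∣∂K∣≡3 : ∣ Graph.∂ G K ∣ ≡ 3
    ∣∂K∣≡3 = trans (cong ∣_∣ (sym (∂-∁ G K))) (trans (sym (apex-degree C₂)) (cubicQ (Contraction.apex C₂)))

    aux : CubicBipartite.ThreeCut G A bip cubic (lookup K) → ρ G A + 9 ≡ 3 * order G
    aux (CubicBipartite.outward o r) = sharp-split {ρ G A} {M.ρ₁} {M.ρ₂} {M.p} {M.q} {order G} {order H} {order Q} M.ρ-split
      (sharpAt M.D₁.A₁ M.D₁.bip₁ M.cubic₁)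
      (IsoK₃,₃.ρAt≡3 Q M.D₂.A₁ M.D₂.bip₁ M.cubic₂ Q-iso (Contraction.apex C₂))
      (sharpH M.D₁.A₁ M.D₁.bip₁ M.cubic₁)
      (IsoK₃,₃.ρ≡ Q M.D₂.A₁ M.D₂.bip₁ M.cubic₂ Q-iso) M.order-split
      where
      module M = Split G A bip cubic C₁ C₂ o r
    -- The cut edges all enter `K`, so `∁ K` is the shore with the surplus in A, and `Q` becomes the
    -- first contraction.
    aux (CubicBipartite.inward o r) = sharp-split {ρ G A} {M.ρ₁} {M.ρ₂} {M.p} {M.q} {order G} {order Q} {order H} M.ρ-split
      (IsoK₃,₃.ρAt≡3 Q M.D₁.A₁ M.D₁.bip₁ M.cubic₁ Q-iso (Contraction.apex C₂))
      (trans (cong (ρAt H M.D₂.A₁) (apex-subst (sym (∁-involutive K)) C₁)) (sharpAt M.D₂.A₁ M.D₂.bip₁ M.cubic₂))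
      (IsoK₃,₃.ρ≡ Q M.D₁.A₁ M.D₁.bip₁ M.cubic₁ Q-iso)
      (sharpH M.D₂.A₁ M.D₂.bip₁ M.cubic₂) M.order-split
      where
      module M = Split G A bip cubic C₂ C₁′ (trans (CubicBipartite.out-∁ G A bip cubic all K) r) (trans (CubicBipartite.into-∁ G A bip cubic all K) o)

  𝒦⇒sharp : ∀ {G} → 𝒦 G → ∀ A → IsBipartition G A → Cubic G → ρ G A + 9 ≡ 3 * order G
  𝒦⇒sharp {G} (base iso) A bip cubic = IsoK₃,₃.ρ≡ G A bip cubic iso
  𝒦⇒sharp {G} (splice {H} A′ v w π H∈𝒦 bipH ρv≡3 iso) A bip cubic =
    splice-sharp G A bip cubic K₃,₃ K₃,₃-iso K₃,₃-cubic H (𝒦⇒sharp H∈𝒦) v at-v w π iso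
    where
    -- The bipartition stored in `splice` may differ from the one induced by `A`. Both values of
    -- `ρAt` are the same sum over `matchable`, in which no bipartition occurs.
    at-v : ∀ A₁ → IsBipartition H A₁ → Cubic H → ρAt H A₁ v ≡ 3
    at-v A₁ bip₁ cubic₁ = trans (Counting.ρAt-sum H A₁ bip₁ cubic₁ v) (trans (sym (Counting.ρAt-sum H A′ bipH cubic₁ v)) ρv≡3)

  -- Three-connected graphs

  cross : ∀ {V : Set} {R : V → V → Set} (S : V → Bool) {x y} → Star R x y → S x ≡ true → S y ≡ false →
          ∃₂ λ a b → R a b × S a ≡ true × S b ≡ false
  cross S ε x∈S x∉S = ⊥-elim (true≢false x∈S x∉S)
  cross S (_◅_ {x} {z} step path) x∈S y∉S = aux (S z) refl
    where
    aux : ∀ b → S z ≡ b → ∃₂ λ a b → _ × S a ≡ true × S b ≡ false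
    aux true  z∈S = cross S path z∈S y∉S
    aux false z∉S = x , z , step , x∈S , z∉S

  module _ (G : Graph) (A : Subset (order G)) (bip : IsBipartition G A) (cubic : Cubic G) (3-connected : ThreeConnected G) where
    open CubicBipartite G A bip cubic

    private
      unique : ∀ {n} (P : Fin n → Bool) → sum (λ e → 1 * 𝟙 (P e)) ≡ 1 → ∀ {e e′} → P e ≡ true → P e′ ≡ true → e ≡ e′
      unique P Σ≡1 {e} {e′} p p′ with e ≟ e′
      ... | yes e≡e′ = e≡e′
      ... | no e≢e′  = ⊥-elim (ℕₚ.<-irrefl refl (subst₂ _≤_ (cong₂ (λ a b → 1 * 𝟙 a + 1 * 𝟙 b) p p′) Σ≡1
        (terms≤sum (λ e → 1 * 𝟙 (P e)) e≢e′)))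

      module _ (X : Subset (order G)) where
        S = lookup X

        leaving : ∀ T → ∣ T ∣ < 3 → ∀ {x y} → x ∉ T → y ∉ T → S x ≡ true → S y ≡ false →
                  ∃ λ e → α e ∉ T × β e ∉ T × ((S (α e) ≡ true × S (β e) ≡ false) ⊎ (S (α e) ≡ false × S (β e) ≡ true))
        leaving T ∣T∣<3 x∉T y∉T x∈X y∉X with cross S (proj₂ 3-connected T ∣T∣<3 x∉T y∉T) x∈X y∉X
        ... | a , b , (a∉T , b∉T , e , j) , a∈X , b∉X with joins-unique G j (αβ-joins e)
        ... | inj₁ (refl , refl) = e , a∉T , b∉T , inj₁ (a∈X , b∉X)
        ... | inj₂ (refl , refl) = e , b∉T , a∉T , inj₂ (b∉X , a∈X)

        -- A cut with one edge of each kind would be destroyed by deleting the A-ends of its edges.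
        not-1-1 : out all S ≡ 1 → into all S ≡ 1 → ⊥
        not-1-1 o r = delete (crossing-out S (subst (0 <_) (sym o) (s≤s z≤n))) (crossing-into S (subst (0 <_) (sym r) (s≤s z≤n)))
          where
          delete : (∃ λ e → S (α e) ≡ true × S (β e) ≡ false) → (∃ λ e → S (α e) ≡ false × S (β e) ≡ true) → ⊥
          -- `β e₂` lies in `X`, `β e₁` does not, and both survive because only vertices of A are
          -- deleted. The path between them must cross by an edge other than `e₁` and `e₂`.
          delete (e₁ , p₁ , q₁) (e₂ , p₂ , q₂) = absurd (leaving T ∣T∣<3 (β∉T e₂) (β∉T e₁) q₂ q₁)
            where
            T : Subset (order G)
            T = ⁅ α e₁ ⁆ ∪ ⁅ α e₂ ⁆
            T≡ : ∀ z → lookup T z ≡ z == α e₁ ∨ z == α e₂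
            T≡ z = trans (lookup-∪ ⁅ α e₁ ⁆ ⁅ α e₂ ⁆ z) (cong₂ _∨_ (lookup-⁅⁆ (α e₁) z) (lookup-⁅⁆ (α e₂) z))
            ∣T∣<3 : ∣ T ∣ < 3
            ∣T∣<3 = s≤s (subst₂ _≤_ (sym (∣∣-sum T))
              (trans (sum-+ (λ z → 1 * 𝟙 (z == α e₁)) _) (cong₂ _+_ (sum-δ (λ _ → 1) (α e₁)) (sum-δ (λ _ → 1) (α e₂))))
              (sum-mono λ z → ℕₚ.≤-trans (ℕₚ.≤-reflexive (cong 𝟙 (T≡ z))) (bound (z == α e₁) (z == α e₂))))
              where
              bound : ∀ a b → 𝟙 (a ∨ b) ≤ 1 * 𝟙 a + 1 * 𝟙 b
              bound true  b     = s≤s z≤n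
              bound false true  = s≤s z≤n
              bound false false = z≤n
            β∉T : ∀ e → β e ∉ T
            β∉T e = lookup⇒∉ (trans (T≡ (β e)) (cong₂ _∨_ (≢⇒== (β≢α e₁)) (≢⇒== (β≢α e₂))))
              where
              β≢α : ∀ e′ → β e ≢ α e′
              β≢α e′ eq = true≢false (α∈A e′) (trans (cong (lookup A) (sym eq)) (β∉A e))
            absurd : (∃ λ e → α e ∉ T × β e ∉ T × ((S (α e) ≡ true × S (β e) ≡ false) ⊎ (S (α e) ≡ false × S (β e) ≡ true))) → ⊥
            absurd (e , α∉T , _ , inj₁ (p , q)) = true≢false
              (trans (T≡ (α e)) (cong (_∨ α e == α e₂) (trans (cong (λ z → α z == α e₁) e≡e₁) (==-refl (α e₁))))) (∉⇒lookup α∉T)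
              where
              e≡e₁ : e ≡ e₁
              e≡e₁ = unique (λ e → S (α e) ∧ not (S (β e))) o (cong₂ (λ a b → a ∧ not b) p q) (cong₂ (λ a b → a ∧ not b) p₁ q₁)
            absurd (e , α∉T , _ , inj₂ (p , q)) = true≢false
              (trans (T≡ (α e)) (trans (cong (α e == α e₁ ∨_) (trans (cong (λ z → α z == α e₂) e≡e₂) (==-refl (α e₂)))) (∨-zeroʳ (α e == α e₁)))) (∉⇒lookup α∉T)
              where
              e≡e₂ : e ≡ e₂
              e≡e₂ = unique (λ e → not (S (α e)) ∧ S (β e)) r (cong₂ (λ a b → not a ∧ b) p q) (cong₂ (λ a b → not a ∧ b) p₂ q₂)

        not-0-0 : ∀ {x y} → x ∈ X → y ∉ X → out all S ≡ 0 → into all S ≡ 0 → ⊥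
        not-0-0 x∈X y∉X o r with leaving _ (subst (_< 3) (sym (∣⊥∣≡0 (order G))) (s≤s z≤n)) ∉⊥ ∉⊥ (∈⇒lookup x∈X) (∉⇒lookup y∉X)
        ... | e , _ , _ , inj₁ (p , q) = ℕₚ.<-irrefl (sym o) (crosses-out {all} S refl p q)
        ... | e , _ , _ , inj₂ (p , q) = ℕₚ.<-irrefl (sym r) (crosses-into {all} S refl p q)

    -- The congruence of `out` and `into` modulo 3 leaves just two kinds of cut with fewer than
    -- three edges: 0 + 0, against connectedness, and 1 + 1, against 3-connectedness.
    edgeConnected : EdgeConnected G
    edgeConnected X {x} {y} x∈X y∉X = subst (3 ≤_) (sym (∣∂X∣ X)) (go _ _ refl refl)
      where
      congruent : into all (lookup X) % 3 ≡ out all (lookup X) % 3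
      congruent = mod3 {numA (lookup X)} {numB (lookup X)} (cubic-balance (lookup X))
      absurd : ∀ {o r} → out all (lookup X) ≡ o → into all (lookup X) ≡ r → r % 3 ≢ o % 3 → ⊥
      absurd p q ≢ = ≢ (subst₂ (λ o r → r % 3 ≡ o % 3) p q congruent)
      go : ∀ o r → out all (lookup X) ≡ o → into all (lookup X) ≡ r → 3 ≤ out all (lookup X) + into all (lookup X)
      go o r p q = subst₂ (λ o r → 3 ≤ o + r) (sym p) (sym q) (at o r p q)
        where
        at : ∀ o r → out all (lookup X) ≡ o → into all (lookup X) ≡ r → 3 ≤ o + r
        at 0 0 p q = ⊥-elim (not-0-0 X x∈X y∉X p q)
        at 0 1 p q = ⊥-elim (absurd p q λ ())
        at 0 2 p q = ⊥-elim (absurd p q λ ())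
        at 1 0 p q = ⊥-elim (absurd p q λ ())
        at 1 1 p q = ⊥-elim (not-1-1 X p q)
        at 2 0 p q = ⊥-elim (absurd p q λ ())
        at 0 (suc (suc (suc _))) _ _ = s≤s (s≤s (s≤s z≤n))
        at 1 (suc (suc _))       _ _ = s≤s (s≤s (s≤s z≤n))
        at 2 (suc _)             _ _ = s≤s (s≤s (s≤s z≤n))
        at (suc (suc (suc _))) _ _ _ = s≤s (s≤s (s≤s z≤n))

  -- Without loops every edge joins the two vertices, so the degree 3 of one of them is the number
  -- of all edges.
  Θ-iso : ∀ G → Cubic G → order G ≡ 2 → ⌊ G ⌋ ≅ ⌊ Θ ⌋
  Θ-iso G@record { order = .2 ; size = m ; ends = ends ; loopless = loopless } cubic refl =
    mkIso {G} {Θ} (↔-id _) E λ e → let x , y , jG , jΘ = aux e _ refl (loopless e) in x , y , jG , jΘ (Inverse.to E e)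
    where
    aux : ∀ e p → ends e ≡ p → proj₁ (ends e) ≢ proj₂ (ends e) → ∃₂ λ x y → Graph.Joins G e x y × (∀ e′ → Graph.Joins Θ e′ x y)
    aux e (zero , suc zero)     eq _ = zero , suc zero , inj₁ eq , λ _ → inj₁ refl
    aux e (suc zero , zero)     eq _ = suc zero , zero , inj₁ eq , λ _ → inj₂ refl
    aux e (zero , zero)         eq ≢ = contradiction (trans (cong proj₁ eq) (sym (cong proj₂ eq))) ≢
    aux e (suc zero , suc zero) eq ≢ = contradiction (trans (cong proj₁ eq) (sym (cong proj₂ eq))) ≢
    incident : ∀ e p → ends e ≡ p → proj₁ (ends e) ≢ proj₂ (ends e) → lookup (Graph.∂ G ⁅ zero ⁆) e ≡ true
    incident e (zero , suc zero)     eq _ = ∂-joins G (inj₁ eq) ⁅ zero ⁆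
    incident e (suc zero , zero)     eq _ = ∂-joins G (inj₁ eq) ⁅ zero ⁆
    incident e (zero , zero)         eq ≢ = contradiction (trans (cong proj₁ eq) (sym (cong proj₂ eq))) ≢
    incident e (suc zero , suc zero) eq ≢ = contradiction (trans (cong proj₁ eq) (sym (cong proj₂ eq))) ≢
    m≡3 : m ≡ 3
    m≡3 = trans (sym (trans (∣∣-sum (Graph.∂ G ⁅ zero ⁆)) (trans (sum-cong λ e → cong 𝟙 (incident e _ refl (loopless e)))
      (trans (sum-const m 1) (ℕₚ.*-identityʳ m))))) (cubic zero)
    E : Fin m ↔ Fin 3
    E = subst (λ k → Fin m ↔ Fin k) m≡3 (↔-id _)

  tightCutFree⇒indecomposable : ∀ {G Js} → TightCutFree G → TightCutDecomposition G Js → Js ≡ [ G ]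
  tightCutFree⇒indecomposable tcf (indecomposable _)         = refl
  tightCutFree⇒indecomposable tcf (contract X nt _ _ _ _) = ⊥-elim (tcf X nt)

  -- The equality cases over ℕ

  module Main (H : Graph) (A : Subset (order H)) (bip : IsBipartition H A) (cubic : Cubic H) (3-connected : ThreeConnected H)
    (Js : List Graph) (dec : TightCutDecomposition H Js) where

    ec : EdgeConnected H
    ec = edgeConnected H A bip cubic 3-connected

    open Bounds (bounds dec A bip cubic ec) public

    m : ℕ
    m = middle Js

    𝒦⇒ρ : 𝒦 H → ρ H A + 9 ≡ 3 * order H
    𝒦⇒ρ H∈𝒦 = 𝒦⇒sharp H∈𝒦 A bip cubic

    ρ⇒𝒦 : ρ H A + 9 ≡ 3 * order H → 𝒦 H
    ρ⇒𝒦 = sharp⇒𝒦 (order H) H A ℕₚ.≤-refl bip cubic ec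

    -- The bounds `lower` and `upper` place `m` between `3 n - 6` and `ρ + 3`, which coincide for
    -- members of 𝒦.
    𝒦⇒equal : 𝒦 H → ρ H A + 3 ≡ m × m + 6 ≡ 3 * order H
    𝒦⇒equal H∈𝒦 = ρ≡m , trans (cong (_+ 6) (sym ρ≡m)) (trans (lemma₂ (ρ H A)) (𝒦⇒ρ H∈𝒦))
      where
      lemma₁ : ∀ ρ m n → ρ + 3 + (n + (m + 6)) + 0 ≡ m + (ρ + 9 + n)
      lemma₁ = solve-∀
      lemma₂ : ∀ ρ → ρ + 3 + 6 ≡ ρ + 9
      lemma₂ = solve-∀
      ρ≡m : ρ H A + 3 ≡ m
      ρ≡m = ℕₚ.≤-antisym (by-≤ 0 (ℕₚ.≤-reflexive (𝒦⇒ρ H∈𝒦) ⊕ upper) (lemma₁ (ρ H A) m (3 * order H))) lower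

    equal⇒𝒦 : ρ H A + 3 ≡ m → m + 6 ≡ 3 * order H → 𝒦 H
    equal⇒𝒦 eq₁ eq₂ = ρ⇒𝒦 (trans (lemma (ρ H A)) (trans (cong (_+ 6) eq₁) eq₂))
      where
      lemma : ∀ ρ → ρ + 9 ≡ ρ + 3 + 6
      lemma = solve-∀

    -- A brace decomposes only as itself, and `Θ` is the only cubic graph on two vertices; so `m` is
    -- `k² + 3`, while `ρ` is `k²`.
    𝒥⇒equal : 𝒥 H → ρ H A + 3 ≡ m
    𝒥⇒equal (_ , (_ , _ , tcf) , ≇Θ , _) =
      trans (cong (_+ 3) T.ρ≡k²) (sym (trans (cong middle (tightCutFree⇒indecomposable tcf dec)) (B.middle-large 3≤n)))
      where
      module T = TightCutFreeGraph H A bip cubic ec tcf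
      module B = BraceBounds H A bip cubic ec tcf
      3≤n : 3 ≤ order H
      3≤n = ℕₚ.≤∧≢⇒< (proj₁ 3-connected) λ 2≡n → ≇Θ (Θ-iso H cubic (sym 2≡n))

    equal⇒𝒥⊎𝒦 : ρ H A + 3 ≡ m → 𝒥 H ⊎ 𝒦 H
    equal⇒𝒥⊎𝒦 eq = aux (equal eq)
      where
      aux : TightCutFree H ⊎ ρ H A + 9 ≡ 3 * order H → 𝒥 H ⊎ 𝒦 H
      aux (inj₂ sharp) = inj₂ (ρ⇒𝒦 sharp)
      aux (inj₁ tcf)   = inj₁ (cubic , (matchingCovered , (A , bip) , tcf) ,
        (λ iso → ℕₚ.<⇒≢ (ℕₚ.≤-trans (ℕₚ.m≤m+n 3 3) 6≤n) (sym (↔⇒≡ (_≅_.vertices iso)))) ,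
        (λ iso → ℕₚ.<⇒≢ (ℕₚ.≤-trans (ℕₚ.m≤m+n 5 1) 6≤n) (sym (↔⇒≡ (_≅_.vertices iso)))))
        where
        module T = TightCutFreeGraph H A bip cubic ec tcf
        module B = BraceBounds H A bip cubic ec tcf
        6≤n : 6 ≤ order H
        6≤n = go (3 ≤? order H)
          where
          go : Dec (3 ≤ order H) → 6 ≤ order H
          go (yes 3≤n) = T.6≤order 3≤n
          -- For order 2 the graph contributes nothing to `m`, and `ρ + 3 ≡ 0` is impossible: `Θ`
          -- never attains equality.
          go (no n<3)  = contradiction (trans (ℕₚ.+-comm 3 (ρ H A)) (trans eq (trans (cong middle (tightCutFree⇒indecomposable tcf dec)) (B.middle-small n<3)))) λ ()
        matchingCovered : MatchingCovered H
        matchingCovered = proj₁ 3-connected , proj₂ 3-connected _ (subst (_< 3) (sym (∣⊥∣≡0 (order H))) (s≤s z≤n)) ,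
          CubicBipartite.covered H A bip cubic

open CubicBipartiteGraphs
open import Data.Integer using (ℤ; +_; _+_; _*_; _-_; _≥_)

-- Differences of natural numbers in ℤ

-- Brings two differences to a common subtrahend, after which they compare like natural numbers.
expand : ∀ x y z → + x - + y ≡ + (x ℕ.+ z) - + (y ℕ.+ z)
expand x y z = trans (ring (+ x) (+ y) (+ z)) (sym (cong₂ _-_ (ℤₚ.pos-+ x z) (ℤₚ.pos-+ y z)))
  where
  ring : ∀ x y z → x - y ≡ (x + z) - (y + z)
  ring = ℤ-Solver.solve-∀

module _ {a b c d : ℕ} where
  private
    expand₁ : + a - + b ≡ + (a ℕ.+ d) - + (b ℕ.+ d)
    expand₁ = expand a b d

    expand₂ : + c - + d ≡ + (c ℕ.+ b) - + (b ℕ.+ d)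
    expand₂ = trans (expand c d b) (cong (λ n → + (c ℕ.+ b) - + n) (ℕₚ.+-comm d b))

    cancel : ∀ (x y : ℤ) → x - y + y ≡ x
    cancel = ℤ-Solver.solve-∀

  difference-≤ : a ℕ.+ d ≤ c ℕ.+ b → + c - + d ≥ + a - + b
  difference-≤ le = subst₂ ℤ._≤_ (sym expand₁) (sym expand₂) (ℤₚ.+-monoˡ-≤ (ℤ.- + (b ℕ.+ d)) (ℤ.+≤+ le))

  difference-≡ : + a - + b ≡ + c - + d ⇔ a ℕ.+ d ≡ c ℕ.+ b
  difference-≡ = mk⇔
    (λ eq → ℤₚ.+-injective (trans (sym (cancel (+ (a ℕ.+ d)) (+ (b ℕ.+ d)))) (trans
      (cong (λ n → n + + (b ℕ.+ d)) (trans (sym expand₁) (trans eq expand₂))) (cancel (+ (c ℕ.+ b)) (+ (b ℕ.+ d))))))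
    (λ eq → trans expand₁ (trans (cong (λ n → + n - + (b ℕ.+ d)) eq) (sym expand₂)))

theorem2p10 : (H : Graph) (A : Subset (order H)) → IsBipartition H A →
    Cubic H → ThreeConnected H →
    (Js : List Graph) → TightCutDecomposition H Js →
    let middle = + β′ Js + + 3 * + b′ Js - + 3
        right  = + 3 * + order H - + 9
    in (+ ρ H A ≥ middle) × (middle ≥ right) ×
       ((+ ρ H A ≡ middle) ⇔ (𝒥 H ⊎ 𝒦 H)) ×
       ((+ ρ H A ≡ middle × middle ≡ right) ⇔ 𝒦 H)
theorem2p10 H A bip cubic 3-connected Js dec =
  subst₂ _≥_ ρ≡ (sym middle≡) (difference-≤ {M.m} {3} {ρ H A} {0} (subst (_≤ ρ H A ℕ.+ 3) (sym (ℕₚ.+-identityʳ M.m)) M.lower)) ,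
  subst₂ _≥_ (sym middle≡) (sym right≡) (difference-≤ {3 ℕ.* order H} {9} {M.m} {3} (by-≤ 0 M.upper (lemma (order H) M.m))) ,
  mk⇔ (λ eq → M.equal⇒𝒥⊎𝒦 (first eq)) (λ H∈ → first⁻¹ ([ M.𝒥⇒equal , proj₁ ∘ M.𝒦⇒equal ]′ H∈)) ,
  mk⇔ (λ (eq₁ , eq₂) → M.equal⇒𝒦 (first eq₁) (second eq₂))
      (λ H∈𝒦 → let eq₁ , eq₂ = M.𝒦⇒equal H∈𝒦 in first⁻¹ eq₁ , second⁻¹ eq₂)
  where
  module M = Main H A bip cubic 3-connected Js dec
  lemma : ∀ n m → 3 ℕ.* n ℕ.+ 3 ℕ.+ (m ℕ.+ 6) ℕ.+ 0 ≡ m ℕ.+ 9 ℕ.+ 3 ℕ.* n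
  lemma = solve-∀
  -- Reading `ρ` as a difference lets `difference-≤` and `difference-≡` serve both inequalities.
  ρ≡ : + ρ H A - + 0 ≡ + ρ H A
  ρ≡ = ℤₚ.+-identityʳ (+ ρ H A)
  middle≡ : + β′ Js + + 3 * + b′ Js - + 3 ≡ + M.m - + 3
  middle≡ = cong (λ n → n - + 3) (trans (cong (λ n → + β′ Js + n) (sym (ℤₚ.pos-* 3 (b′ Js)))) (sym (ℤₚ.pos-+ (β′ Js) (3 ℕ.* b′ Js))))
  right≡ : + 3 * + order H - + 9 ≡ + (3 ℕ.* order H) - + 9
  right≡ = cong (λ n → n - + 9) (sym (ℤₚ.pos-* 3 (order H)))
  module first-⇔ = Equivalence (difference-≡ {ρ H A} {0} {M.m} {3})
  module second-⇔ = Equivalence (difference-≡ {M.m} {3} {3 ℕ.* order H} {9})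
  first : + ρ H A ≡ + β′ Js + + 3 * + b′ Js - + 3 → ρ H A ℕ.+ 3 ≡ M.m
  first eq = trans (first-⇔.to (trans ρ≡ (trans eq middle≡))) (ℕₚ.+-identityʳ M.m)
  first⁻¹ : ρ H A ℕ.+ 3 ≡ M.m → + ρ H A ≡ + β′ Js + + 3 * + b′ Js - + 3
  first⁻¹ eq = trans (sym ρ≡) (trans (first-⇔.from (trans eq (sym (ℕₚ.+-identityʳ M.m)))) (sym middle≡))
  rearrange : ∀ m → m ℕ.+ 9 ≡ m ℕ.+ 6 ℕ.+ 3
  rearrange = solve-∀
  second : + β′ Js + + 3 * + b′ Js - + 3 ≡ + 3 * + order H - + 9 → M.m ℕ.+ 6 ≡ 3 ℕ.* order H
  second eq = ℕₚ.+-cancelʳ-≡ 3 _ _ (trans (sym (rearrange M.m)) (second-⇔.to (trans (sym middle≡) (trans eq right≡))))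
  second⁻¹ : M.m ℕ.+ 6 ≡ 3 ℕ.* order H → + β′ Js + + 3 * + b′ Js - + 3 ≡ + 3 * + order H - + 9
  second⁻¹ eq = trans middle≡ (trans (second-⇔.from (trans (rearrange M.m) (cong (ℕ._+ 3) eq))) (sym right≡))
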